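{- For any partition $P$ of a positive integer $n$, $\min(\lambda(P))=\mu(P)$, where $\min(\lambda(P))$ is the smallest (positive) part of the partition $\lambda(P)$.
   Context: Partitions and poset. Write a partition as $P=(p_s^{n_s},\dots,p_1^{n_1})$ with $p_s>\cdots>p_1\ge 1$ and $n_i\ge 1$, where $n_i$ is the multiplicity of the part $p_i$. The poset $\mathcal{D}_P$ has as elements the triples $(u,p_i,k)$ with $1\le i\le s$, $1\le u\le p_i$, $1\le k\le n_i$ (so $|\mathcal{D}_P|=n$ if $P\vdash n$). Its order is the partial order with the following covering relations: $(v,p_j,\ell)$ covers $(u,p_i,k)$ if and only if one of the following holds: ($\alpha$) $j=i+1$, $v=u+p_{i+1}-p_i$, $\ell=1$, $k=n_i$; ($\beta$) $j=i-1$, $v=u$, $\ell=1$, $k=n_i$; ($e$) $j=i$, $v=u$, $\ell=k+1$; ($\omega$) $j=i$, neither $p_i+1$ nor $p_i-1$ is a part of $P$, $v=u+1$, $\ell=1$, $k=n_i$. The partition $\lambda(P)$. $\lambda(P)=(\lambda_1,\lambda_2,\dots)$ with $\lambda_k=c_k-c_{k-1}$, where $c_k$ is the maximum cardinality of a union of $k$ chains in $\mathcal{D}_P$ (and $c_0=0$). The number $r(P)$. A partition is almost rectangular if its largest and smallest parts differ by at most $1$. $r(P)$ is the minimum number of almost rectangular subpartitions in a decomposition of $P$ as a union (multiset union of parts) of almost rectangular subpartitions. The invariant $\mu(P)$. An $s$-spread (or spread) is a partition $P=(p_s^{n_s},\dots,p_1^{n_1})$ with $p_1>0$, $p_{i+1}=p_i+1$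 for $1\le i<s$, and $n_i>0$ for all $i$; then $r(P)=\lceil s/2\rceil$. For an $s$-spread with smallest part $p=p_1$, put $n_{s+1}=0$ and $\mu(P)=\min\{p\,n_{2i-1}+(p+1)\,n_{2j} : 1\le i\le j\le r(P)\}$. For an arbitrary partition write $P=P_\ell\cup\cdots\cup P_1$ where each $P_k$ is a spread and the largest part of $P_k$ is at most the smallest part of $P_{k+1}$ minus $2$. With $\bar r_k=\sum_{i=1}^{k-1} r(P_i)$, define $\mu(P)=\min\{\mu(P_k-2\bar r_k): 1\le k\le \ell\}$, where $P-c$ denotes the partition obtained from $P$ by subtracting $c$ from each part. -}

module Defs where

open import Data.Nat using (ℕ; zero; suc; _+_; _*_; _∸_; _≤_; _<_)
open import Data.Fin using (Fin; toℕ)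
open import Data.List using (List; []; _∷_; length; lookup; map; concat; concatMap; replicate; sum; take)
open import Data.List.Membership.Propositional using (_∈_)
open import Data.List.Relation.Unary.All using (All)
open import Data.List.Relation.Unary.Linked using (Linked)
open import Data.List.Relation.Unary.Unique.Propositional using (Unique)
open import Data.List.Relation.Binary.Pointwise using (Pointwise)
open import Data.List.Relation.Binary.Permutation.Propositional using (_↭_)
open import Data.Product using (Σ-syntax; ∃-syntax; _×_)
open import Data.Sum using (_⊎_)
open import Data.Empty using (⊥)
open import Function.Bundles using (_⇔_)
open import Relation.Binary.Construct.Closure.ReflexiveTransitive using (Star)
open import Relation.Binary.PropositionalEquality using (_≡_; _≢_)

IsMinimum : (ℕ → Set) → ℕ → Set
IsMinimum A m = A m × (∀ x → A x → m ≤ x)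

IsMaximum : (ℕ → Set) → ℕ → Set
IsMaximum A m = A m × (∀ x → A x → x ≤ m)

------------------------------------------------------------------------
-- Partitions

record Power : Set where
  constructor _^^_
  field
    part : ℕ
    mult : ℕ

open Power public

-- P = (p_s^{n_s}, …, p_1^{n_1}) is listed from the smallest part up:
-- (p_1 ^^ n_1) ∷ … ∷ (p_s ^^ n_s) ∷ [].
Powers : Set
Powers = List Power

IsPartition : Powers → Set
IsPartition P = Linked (λ a b → part a < part b) P
              × All (λ a → 1 ≤ part a × 1 ≤ mult a) P

parts : Powers → List ℕ
parts = concatMap (λ a → replicate (mult a) (part a))

infix 4 _⊢_
_⊢_ : Powers → ℕ → Set
P ⊢ n = IsPartition P × sum (parts P) ≡ n

infixl 6 _⊖_
_⊖_ : Powers → ℕ → Powers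
P ⊖ c = map (λ a → (part a ∸ c) ^^ mult a) P

------------------------------------------------------------------------
-- The poset 𝒟_P

-- The triple (u, p_i, k); the Fin-valued fields count from 0, so that
-- u = 1 + toℕ height and k = 1 + toℕ copy.
record 𝒟 (P : Powers) : Set where
  constructor elt
  field
    index  : Fin (length P)
    height : Fin (part (lookup P index))
    copy   : Fin (mult (lookup P index))

module _ {P : Powers} where

  private
    i : 𝒟 P → ℕ
    i x = toℕ (𝒟.index x)

    p : 𝒟 P → ℕ
    p x = part (lookup P (𝒟.index x))

    u : 𝒟 P → ℕ
    u x = suc (toℕ (𝒟.height x))

    k : 𝒟 P → ℕ
    k x = suc (toℕ (𝒟.copy x))

    First : 𝒟 P → Set
    First x = k x ≡ 1

    Last : 𝒟 P → Set
    Last x = k x ≡ mult (lookup P (𝒟.index x))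

  -- x ⋖ y : y covers x.  In α, the equation v = u + p_{i+1} - p_i is
  -- written without subtraction.
  infix 4 _⋖_ _≼_
  data _⋖_ (x y : 𝒟 P) : Set where
    α : i y ≡ suc (i x) → u y + p x ≡ u x + p y → First y → Last x → x ⋖ y
    β : i x ≡ suc (i y) → u y ≡ u x → First y → Last x → x ⋖ y
    e : i y ≡ i x → u y ≡ u x → k y ≡ suc (k x) → x ⋖ y
    ω : i y ≡ i x →
        All (λ a → part a ≢ suc (p x) × suc (part a) ≢ p x) P →
        u y ≡ suc (u x) → First y → Last x → x ⋖ y

  _≼_ : 𝒟 P → 𝒟 P → Set
  _≼_ = Star _⋖_

  IsChain : List (𝒟 P) → Set
  IsChain C = ∀ {x y} → x ∈ C → y ∈ C → x ≼ y ⊎ y ≼ x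

------------------------------------------------------------------------
-- The partition λ(P)

-- m is the cardinality of a union of k chains; S enumerates the union
-- without repetition.
UnionOfChains : Powers → ℕ → ℕ → Set
UnionOfChains P k m =
  Σ[ C ∈ (Fin k → List (𝒟 P)) ]
    (∀ j → IsChain (C j)) ×
    Σ[ S ∈ List (𝒟 P) ]
      Unique S × (∀ x → x ∈ S ⇔ (∃[ j ] x ∈ C j)) × length S ≡ m

-- λ(P) as a sequence padded with zeros, where λs k is λ_{k+1}.  The
-- union of no chains is empty, so c 0 is 0; and c is non-decreasing,
-- so the subtraction never truncates.
Isλ : Powers → (ℕ → ℕ) → Set
Isλ P λs =
  Σ[ c ∈ (ℕ → ℕ) ]
    (∀ k → IsMaximum (UnionOfChains P k) (c k)) ×
    (∀ k → λs k ≡ c (suc k) ∸ c k)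

IsSmallestPart : (ℕ → ℕ) → ℕ → Set
IsSmallestPart λs = IsMinimum (λ x → 1 ≤ x × (∃[ k ] λs k ≡ x))

------------------------------------------------------------------------
-- The number r(P)

AlmostRectangular : List ℕ → Set
AlmostRectangular xs = ∀ {x y} → x ∈ xs → y ∈ xs → x ≤ y + 1

Isr : Powers → ℕ → Set
Isr P = IsMinimum λ r →
  Σ[ Qs ∈ List (List ℕ) ]
    All AlmostRectangular Qs × concat Qs ↭ parts P × length Qs ≡ r

------------------------------------------------------------------------
-- The invariant μ(P)

IsSpread : Powers → Set
IsSpread P = P ≢ [] × IsPartition P
           × Linked (λ a b → part b ≡ suc (part a)) P

-- n_i, counting from i = 1; it is 0 for i > s, in particular for i = s + 1.
multAt : Powers → ℕ → ℕ
multAt []      _             = 0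
multAt (_ ∷ _) zero          = 0
multAt (a ∷ _) (suc zero)    = mult a
multAt (_ ∷ P) (suc (suc i)) = multAt P (suc i)

Isμ-spread : Powers → ℕ → Set
Isμ-spread []          m = ⊥
Isμ-spread P@(a ∷ _) m =
  ∃[ r ] Isr P r ×
    IsMinimum (λ x → ∃[ i ] ∃[ j ] 1 ≤ i × i ≤ j × j ≤ r ×
                 x ≡ part a * multAt P (2 * i ∸ 1)
                     + (part a + 1) * multAt P (2 * j)) m

-- The list Ps is P_1 ∷ … ∷ P_ℓ ∷ [] and rs lists r(P_1), …, r(P_ℓ).  The
-- gaps force every part of P_k to exceed 2 r̄_k, so _⊖_ never truncates.
Isμ : Powers → ℕ → Set
Isμ P m =
  Σ[ Ps ∈ List Powers ] Σ[ rs ∈ List ℕ ]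
    concat Ps ≡ P ×
    All IsSpread Ps ×
    Linked (λ Q R → All (λ a → All (λ b → part a + 2 ≤ part b) R) Q) Ps ×
    Pointwise Isr Ps rs ×
    IsMinimum (λ x → Σ[ k ∈ Fin (length Ps) ]
                 Isμ-spread (lookup Ps k ⊖ 2 * sum (take (toℕ k) rs)) x) m

{-# OPTIONS --safe #-}

-- Write A and B for the distances of an element of 𝒟_P to the two ends of its
-- part.  Up to copies, 𝒟_P is a two-dimensional order: two elements are
-- incomparable exactly when both A and B strictly increase from one to the
-- other.  Pairing up consecutive parts of each spread yields r levels
-- {q_t, q_t + 1}.  There are r chains that follow the levels and cover 𝒟_P, and
-- a pair i ≤ j attaining the minimum μ yields r − 1 chains that miss only μ
-- elements.  Conversely there are μ disjoint antichains with one element on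
-- each level, and r − 1 chains miss an element of each.  Hence
-- c_r = |𝒟_P| = c_{r-1} + μ, that is, λ_r = μ and λ_{r+1} = 0.  That λ is
-- non-increasing is the concavity of c, which follows by exchanging edges
-- between two matchings that encode families of k and of k + 2 chains.

module Submission where

open import Defs
open import Data.Nat using (ℕ; zero; suc; pred; _+_; _*_; _∸_; _≤_; _<_; _/_; _%_; _⊓_; _≤?_; _<?_; z≤n; s≤s; s≤s⁻¹; z<s; NonZero; >-nonZero)
import Data.Nat.Properties as ℕ
import Data.Fin
open import Data.Fin using (Fin; toℕ; fromℕ<) renaming (zero to fzero; suc to fsuc)
import Data.Fin.Properties as Fin
open import Data.List using (List; []; _∷_; [_]; _++_; length; lookup; map; concat; concatMap; filter; replicate; take; allFin; upTo; cartesianProductWith)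
import Data.List.Properties as List
open import Data.List.Membership.Propositional using (_∈_; _∉_; find; lose)
import Data.List.Membership.Propositional.Properties as ∈
open import Data.List.Relation.Unary.Any using (Any; here; there; any?)
open import Data.Nat.ListAction using (sum)
open import Data.List.Relation.Unary.All as All using (All; []; _∷_; all?)
import Data.List.Relation.Unary.All.Properties as All
open import Data.List.Relation.Unary.AllPairs as AllPairs using (AllPairs; []; _∷_)
import Data.List.Relation.Unary.AllPairs.Properties as AllPairs
open import Data.List.Relation.Unary.Linked as Linked using (Linked; []; [-]; _∷_)
open import Data.List.Relation.Unary.Unique.Propositional using (Unique)
import Data.List.Relation.Unary.Unique.Propositional.Properties as Unique
open import Data.List.Relation.Binary.Pointwise using (Pointwise; []; _∷_)
open import Data.List.Relation.Binary.Permutation.Propositional as Perm using (_↭_; ↭-refl; ↭-sym; ↭-trans; prep; module PermutationReasoning)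
import Data.List.Relation.Binary.Permutation.Propositional.Properties as ↭
open import Data.Product using (Σ-syntax; ∃-syntax; _×_; _,_; proj₁; proj₂)
open import Data.Sum using (_⊎_; inj₁; inj₂; [_,_]′)
open import Data.Unit using (⊤; tt)
open import Data.Empty using (⊥; ⊥-elim)
open import Function using (_∘_; id; _⇔_; mk⇔; Equivalence)
open import Relation.Binary using (DecidableEquality; Symmetric; tri<; tri≈; tri>)
open import Relation.Binary.Construct.Closure.ReflexiveTransitive using (ε; _◅_; _◅◅_)
open import Relation.Binary.PropositionalEquality using (_≡_; _≢_; refl; sym; trans; cong; cong₂; subst; subst₂; ≢-sym; module ≡-Reasoning)
open import Relation.Nullary using (¬_; Dec; yes; no; contradiction; ¬?)
open import Relation.Unary using (Decidable)

-- Numbering the levels of all spreads consecutively explains the shift by twice the preceding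
-- values of r: on level t the elements with A < t or B < t can be left to chains of smaller index,
-- and p = q - 2t positions remain in each copy of the part q. This p is constant along a spread and
-- does not decrease from one spread to the next. Dropping a chain costs the remaining positions of
-- the lower part of level i and of the upper part of level j, which is the expression minimised in
-- μ.
--
-- The obstacle is to match this count from the other side for all pairs at once. Along an antichain
-- A and B must increase, while disjoint antichains may share a position only as often as it has
-- copies. Spacing the antichains evenly, with κ of them per unit of A and B, makes both demands
-- linear: the copies of q + 1 on level t bound κ from below, those of q on a level s ≤ t bound it
-- from above, and for equal p the two bounds are compatible exactly when μ ≤ p N + (p + 1) M.
--
-- Concavity enters because only c at r - 1 and r is computed, whereas every earlier part of λ has
-- to be at least μ.

module _ {A : Set} where

  AllPairs-resp-↭ : {R : A → A → Set} → Symmetric R →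
                    {xs ys : List A} → xs ↭ ys → AllPairs R xs → AllPairs R ys
  AllPairs-resp-↭ s Perm.refl pxs = pxs
  AllPairs-resp-↭ s (prep x p) (px ∷ pxs) = ↭.All-resp-↭ p px ∷ AllPairs-resp-↭ s p pxs
  AllPairs-resp-↭ s (Perm.swap x y p) ((xy ∷ px) ∷ py ∷ pxs) =
    (s xy ∷ ↭.All-resp-↭ p py) ∷ ↭.All-resp-↭ p px ∷ AllPairs-resp-↭ s p pxs
  AllPairs-resp-↭ s (Perm.trans p q) pxs = AllPairs-resp-↭ s q (AllPairs-resp-↭ s p pxs)

  Unique-resp-↭ : {xs ys : List A} → xs ↭ ys → Unique xs → Unique ys
  Unique-resp-↭ = AllPairs-resp-↭ ≢-sym

  AllPairs-++⁻ : {R : A → A → Set} (xs : List A) {ys : List A} → AllPairs R (xs ++ ys) →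
                 AllPairs R xs × AllPairs R ys × All (λ x → All (R x) ys) xs
  AllPairs-++⁻ [] pys = [] , pys , []
  AllPairs-++⁻ (x ∷ xs) (px ∷ pxs) with AllPairs-++⁻ xs pxs
  ... | a , b , c = All.++⁻ˡ xs px ∷ a , b , All.++⁻ʳ xs px ∷ c

  extract : {x : A} {xs : List A} → x ∈ xs → ∃[ ys ] xs ↭ x ∷ ys
  extract {x} p with ∈.∈-∃++ p
  ... | as , bs , refl = as ++ bs , ↭.shift x as bs

  Unique-⊆⇒length-≤ : {xs ys : List A} → Unique xs → (∀ {x} → x ∈ xs → x ∈ ys) →
                      length xs ≤ length ys
  Unique-⊆⇒length-≤ [] _ = z≤n
  Unique-⊆⇒length-≤ {x ∷ xs} (x∉ ∷ u) sub with extract (sub (here refl))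
  ... | ys , p = subst (suc (length xs) ≤_) (sym (↭.↭-length p))
                   (s≤s (Unique-⊆⇒length-≤ u λ y∈ → drop y∈ (↭.∈-resp-↭ p (sub (there y∈)))))
    where
    drop : ∀ {y} → y ∈ xs → y ∈ x ∷ ys → y ∈ ys
    drop y∈ (here refl) = contradiction refl (All.lookup x∉ y∈)
    drop y∈ (there q) = q

  Unique-⊆-⊇⇒↭ : {xs ys : List A} → Unique xs → Unique ys →
                  (∀ {x} → x ∈ xs → x ∈ ys) → (∀ {x} → x ∈ ys → x ∈ xs) → xs ↭ ys
  Unique-⊆-⊇⇒↭ {ys = []} [] _ _ _ = ↭-refl
  Unique-⊆-⊇⇒↭ {ys = y ∷ _} [] _ _ g with () ← g (here refl)
  Unique-⊆-⊇⇒↭ {x ∷ xs} {ys} (x∉ ∷ u) v f g with extract (f (here refl))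
  ... | zs , p with Unique-resp-↭ p v
  ... | x∉zs ∷ w = ↭-trans (prep x (Unique-⊆-⊇⇒↭ u w f′ g′)) (↭-sym p)
    where
    f′ : ∀ {y} → y ∈ xs → y ∈ zs
    f′ y∈ with ↭.∈-resp-↭ p (f (there y∈))
    ... | here refl = contradiction refl (All.lookup x∉ y∈)
    ... | there q = q
    g′ : ∀ {y} → y ∈ zs → y ∈ xs
    g′ y∈ with g (↭.∈-resp-↭ (↭-sym p) (there y∈))
    ... | here refl = contradiction refl (All.lookup x∉zs y∈)
    ... | there q = q

  filter-split : {P : A → Set} (P? : Decidable P) (xs : List A) →
                 xs ↭ filter P? xs ++ filter (¬? ∘ P?) xs
  filter-split P? [] = ↭-refl
  filter-split P? (x ∷ xs) with P? x
  ... | yes _ = prep x (filter-split P? xs)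
  ... | no _ = ↭-trans (prep x (filter-split P? xs)) (↭-sym (↭.shift x (filter P? xs) _))

length-cartesianProductWith : {A B C : Set} (f : A → B → C) (xs : List A) (ys : List B) →
                              length (cartesianProductWith f xs ys) ≡ length xs * length ys
length-cartesianProductWith f [] ys = refl
length-cartesianProductWith f (x ∷ xs) ys = trans (List.length-++ (map (f x) ys))
  (cong₂ _+_ (List.length-map (f x) ys) (length-cartesianProductWith f xs ys))

-- Exchanging edges between two matchings

module Matchings {A : Set} (_≟_ : DecidableEquality A) where

  -- An edge runs from a left copy of its first component to a right copy of its second, so the
  -- graph is bipartite. The consecutive pairs of disjoint lists form a matching, since every
  -- element has at most one successor and one predecessor.
  Apart : A × A → A × A → Set
  Apart a b = proj₁ a ≢ proj₁ b × proj₂ a ≢ proj₂ b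

  Apart-sym : Symmetric Apart
  Apart-sym (p , q) = ≢-sym p , ≢-sym q

  Matching : List (A × A) → Set
  Matching = AllPairs Apart

  apart? : ∀ a b → Dec (Apart a b)
  apart? (a , b) (c , d) with a ≟ c | b ≟ d
  ... | yes p | _ = no λ x → proj₁ x p
  ... | no _ | yes q = no λ x → proj₂ x q
  ... | no p | no q = yes (p , q)

  Matching-resp-↭ : ∀ {M N} → M ↭ N → Matching M → Matching N
  Matching-resp-↭ = AllPairs-resp-↭ Apart-sym

  -- Some component of the symmetric difference has more edges of M₂ than of M₁;
  -- exchanging its edges gives N₁ and N₂.  The induction contracts the
  -- components along the edges of M₁.
  exchange : ∀ M₁ M₂ → Matching M₁ → Matching M₂ → 2 + length M₁ ≤ length M₂ →
             ∃[ N₁ ] ∃[ N₂ ] Matching N₁ × Matching N₂ × N₁ ++ N₂ ↭ M₁ ++ M₂ ×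
               length N₁ ≡ suc (length M₁)
  exchange [] (f ∷ M₂) _ (_ ∷ m₂) _ = [ f ] , M₂ , [] ∷ [] , m₂ , ↭-refl , refl
  exchange (f@(x , y) ∷ M₁) M₂ (fM₁ ∷ m₁) m₂ ≤M₂ = cases
    where
    Goal : Set
    Goal = ∃[ N₁ ] ∃[ N₂ ] Matching N₁ × Matching N₂ × N₁ ++ N₂ ↭ f ∷ M₁ ++ M₂ ×
             length N₁ ≡ 2 + length M₁

    disjoint : All (Apart f) M₂ → Goal
    disjoint fM₂ with exchange M₁ M₂ m₁ m₂ (ℕ.≤-trans (ℕ.n≤1+n _) ≤M₂)
    ... | N₁ , N₂ , n₁ , n₂ , p , l =
      f ∷ N₁ , N₂ , All.++⁻ˡ N₁ (↭.All-resp-↭ (↭-sym p) (All.++⁺ fM₁ fM₂)) ∷ n₁ , n₂ ,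
      prep f p , cong suc l

    -- f is an end edge of its component, with g as its only neighbour. Both are set aside and then
    -- go to different sides, so each side grows by one.
    one : ∀ g M → M₂ ↭ g ∷ M → All (Apart f) M → proj₁ g ≡ x ⊎ proj₂ g ≡ y → Goal
    one g M q fM g~f with Matching-resp-↭ q m₂
    ... | gM ∷ m with exchange M₁ M m₁ m (s≤s⁻¹ (subst (3 + length M₁ ≤_) (↭.↭-length q) ≤M₂))
    ... | N₁ , N₂ , n₁ , n₂ , p , l = place
      where
      fN : All (Apart f) (N₁ ++ N₂)
      fN = ↭.All-resp-↭ (↭-sym p) (All.++⁺ fM₁ fM)

      -- g and f share an endpoint, so an edge apart from f can meet g only at the other endpoint,
      -- where two disjoint edges cannot both arrive.
      avoid : ∀ {a b} → Apart f a → Apart f b → Apart a b → Apart g a ⊎ Apart g b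
      avoid {a} {b} fa fb ab with apart? g a | apart? g b
      ... | yes ga | _ = inj₁ ga
      ... | no _ | yes gb = inj₂ gb
      ... | no ga | no gb = ⊥-elim ([ same₁ , same₂ ]′ g~f)
        where
        same₁ : proj₁ g ≢ x
        same₁ eq = ga ((λ z → proj₁ fa (trans (sym eq) z)) , λ u →
                   gb ((λ z → proj₁ fb (trans (sym eq) z)) , λ v → proj₂ ab (trans (sym u) v)))

        same₂ : proj₂ g ≢ y
        same₂ eq = ga ((λ u → gb ((λ v → proj₁ ab (trans (sym u) v)) ,
                                  (λ z → proj₂ fb (trans (sym eq) z)))) ,
                       (λ z → proj₂ fa (trans (sym eq) z)))

      avoids : ∀ M → All (Apart f) M → Matching M →
               AllPairs (λ a b → Apart g a ⊎ Apart g b) M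
      avoids [] _ _ = []
      avoids (a ∷ M) (fa ∷ fM) (aM ∷ m) =
        All.zipWith (λ (fb , ab) → avoid fa fb ab) (fM , aM) ∷ avoids M fM m

      -- `M` is apart from g, and at most one edge of `M₁` meets it. Since `N₁ ++ N₂` is a
      -- rearrangement of `M₁ ++ M`, one of its two sides is free for g.
      pairs : AllPairs (λ a b → Apart g a ⊎ Apart g b) (N₁ ++ N₂)
      pairs = AllPairs-resp-↭ (λ { (inj₁ u) → inj₂ u ; (inj₂ u) → inj₁ u }) (↭-sym p)
        (AllPairs.++⁺ (avoids M₁ fM₁ m₁)
          (AllPairs.map inj₁ (AllPairs-const m gM))
          (All.map (λ _ → All.map inj₂ gM) fM₁))
        where
        AllPairs-const : ∀ {M} → Matching M → All (Apart g) M → AllPairs (λ a _ → Apart g a) M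
        AllPairs-const [] [] = []
        AllPairs-const (aM ∷ m) (ga ∷ gM) = All.map (λ _ → ga) aM ∷ AllPairs-const m gM

      final : ∀ {a b} → a ∷ b ∷ N₁ ++ N₂ ↭ f ∷ g ∷ M₁ ++ M →
              a ∷ b ∷ N₁ ++ N₂ ↭ f ∷ M₁ ++ M₂
      final r = ↭-trans r (prep f (↭-trans (↭-sym (↭.shift g M₁ M)) (↭.++⁺ˡ M₁ (↭-sym q))))

      place : Goal
      place with all? (apart? g) N₁
      ... | yes gN₁ = g ∷ N₁ , f ∷ N₂ , gN₁ ∷ n₁ , All.++⁻ʳ N₁ fN ∷ n₂ ,
            ↭-trans (prep g (↭.shift f N₁ N₂))
              (final (Perm.swap g f p)) , cong suc l
      ... | no ¬gN₁ = f ∷ N₁ , g ∷ N₂ , All.++⁻ˡ N₁ fN ∷ n₁ , gN₂ ∷ n₂ ,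
            ↭-trans (prep f (↭.shift g N₁ N₂)) (final (prep f (prep g p))) , cong suc l
        where
        gN₂ : All (Apart g) N₂
        gN₂ with find (All.¬All⇒Any¬ (apart? g) N₁ ¬gN₁)
        ... | a , a∈ , ¬ga = All.map [ (λ ga → contradiction ga ¬ga) , id ]′
                (All.lookup (proj₂ (proj₂ (AllPairs-++⁻ N₁ pairs))) a∈)

    two : ∀ g h M → M₂ ↭ g ∷ h ∷ M → All (Apart f) M → proj₁ g ≡ x → proj₂ h ≡ y → Goal
    two g@(.x , b) h@(a , .y) M q fM refl refl with Matching-resp-↭ q m₂
    ... | ((x≢a , b≢y) ∷ gM) ∷ hM ∷ m = done
      where
      -- The path g, f, h is contracted to k. Wherever k ends up, it expands to g and h, and f goes
      -- to the other side; this adds one edge to each side.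
      k : A × A
      k = a , b

      fk : Apart f k
      fk = x≢a , ≢-sym b≢y

      kM : All (Apart k) M
      kM = All.zipWith (λ (u , v) → proj₁ v , proj₂ u) (gM , hM)

      outer : ∀ L → All (Apart f) L → All (Apart k) L → All (Apart g) L × All (Apart h) L
      outer L fL kL = All.zipWith (λ (u , v) → proj₁ u , proj₂ v) (fL , kL) ,
                      All.zipWith (λ (u , v) → proj₁ v , proj₂ u) (fL , kL)

      insert : ∀ L → All (Apart f) L → Matching (k ∷ L) → Matching (g ∷ h ∷ L)
      insert L fL (kL ∷ l) with outer L fL kL
      ... | gL , hL = ((x≢a , b≢y) ∷ gL) ∷ hL ∷ l

      final : ∀ {L} → k ∷ L ↭ M₁ ++ k ∷ M → f ∷ g ∷ h ∷ L ↭ f ∷ M₁ ++ M₂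
      final {L} r = prep f (begin
        g ∷ h ∷ L           ↭⟨ prep g (prep h (↭.drop-∷ (↭-trans r (↭.shift k M₁ M)))) ⟩
        g ∷ h ∷ M₁ ++ M     ↭⟨ ↭.shifts (g ∷ h ∷ []) M₁ ⟩
        M₁ ++ g ∷ h ∷ M     ↭⟨ ↭.++⁺ˡ M₁ (↭-sym q) ⟩
        M₁ ++ M₂            ∎)
        where open PermutationReasoning

      done : Goal
      done with exchange M₁ (k ∷ M) m₁ (kM ∷ m)
                  (s≤s⁻¹ (subst (3 + length M₁ ≤_) (↭.↭-length q) ≤M₂))
      ... | N₁ , N₂ , n₁ , n₂ , p , l
        with ↭.All-resp-↭ (↭-sym p) (All.++⁺ fM₁ (fk ∷ fM))
           | ∈.∈-++⁻ N₁ (↭.∈-resp-↭ (↭-sym p) (∈.∈-++⁺ʳ M₁ (here refl)))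
      ... | fN | inj₁ k∈ with extract k∈
      ... | N , r = g ∷ h ∷ N , f ∷ N₂ ,
            insert N (All.tail (↭.All-resp-↭ r (All.++⁻ˡ N₁ fN))) (Matching-resp-↭ r n₁) ,
            All.++⁻ʳ N₁ fN ∷ n₂ ,
            ↭-trans (↭.shift f (g ∷ h ∷ N) N₂)
              (final (↭-trans (↭.++⁺ʳ N₂ (↭-sym r)) p)) ,
            cong suc (trans (sym (↭.↭-length r)) l)
      done | N₁ , N₂ , n₁ , n₂ , p , l | fN | inj₂ k∈ with extract k∈
      ... | N , r = f ∷ N₁ , g ∷ h ∷ N , All.++⁻ˡ N₁ fN ∷ n₁ ,
            insert N (All.tail (↭.All-resp-↭ r (All.++⁻ʳ N₁ fN))) (Matching-resp-↭ r n₂) ,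
            ↭-trans (prep f (↭-sym (↭.shifts (g ∷ h ∷ []) N₁)))
              (final (↭-trans (↭-sym (↭.shift k N₁ N)) (↭-trans (↭.++⁺ˡ N₁ (↭-sym r)) p))) ,
            cong suc l

    cases : Goal
    cases with any? (λ g → proj₁ g ≟ x) M₂
    ... | no ¬g with any? (λ h → proj₂ h ≟ y) M₂
    ...   | no ¬h = disjoint (All.zipWith (λ (u , v) → ≢-sym u , ≢-sym v)
                      (All.¬Any⇒All¬ M₂ ¬g , All.¬Any⇒All¬ M₂ ¬h))
    ...   | yes h∈ with find h∈
    ...     | h , h∈ , eh with extract h∈
    ...       | M , q with Matching-resp-↭ q m₂
    ...         | hM ∷ _ = one h M q (All.zipWith (λ (u , v) → ≢-sym u , λ z → proj₂ v (trans eh z))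
                             (All.tail (↭.All-resp-↭ q (All.¬Any⇒All¬ M₂ ¬g)) , hM)) (inj₂ eh)
    cases | yes g∈ with find g∈
    ... | g , g∈ , eg with extract g∈
    ... | M , q with Matching-resp-↭ q m₂
    ... | gM ∷ m with any? (λ h → proj₂ h ≟ y) M
    ...   | no ¬h = one g M q (All.zipWith (λ (u , v) → (λ z → proj₁ u (trans eg z)) , ≢-sym v)
                      (gM , All.¬Any⇒All¬ M ¬h)) (inj₁ eg)
    ...   | yes h∈ with find h∈
    ...     | h , h∈ , eh with extract h∈
    ...       | M′ , q′ with ↭.All-resp-↭ q′ gM | Matching-resp-↭ q′ m
    ...         | _ ∷ gM′ | hM′ ∷ _ = two g h M′ (↭-trans q (prep g q′))
                    (All.zipWith (λ (u , v) → (λ z → proj₁ u (trans eg z)) ,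
                                              (λ z → proj₂ v (trans eh z))) (gM′ , hM′)) eg eh

-- Families of chains and the concavity of c

module FinitePoset
  {D : Set} (_≟_ : DecidableEquality D) (_≼_ : D → D → Set)
  (≼-refl : ∀ {x} → x ≼ x) (≼-trans : ∀ {x y z} → x ≼ y → y ≼ z → x ≼ z)
  (≼-antisym : ∀ {x y} → x ≼ y → y ≼ x → x ≡ y)
  (V : List D) (V-unique : Unique V) (V-complete : ∀ x → x ∈ V)
  where

  open Matchings _≟_
  open import Data.List.Membership.DecPropositional _≟_ using (_∈?_)

  Chain : List D → Set
  Chain C = ∀ {x y} → x ∈ C → y ∈ C → x ≼ y ⊎ y ≼ x

  -- Spelled out so that it unfolds to `UnionOfChains P k m` when `D` is `𝒟 P`.
  Family : ℕ → ℕ → Set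
  Family k m =
    Σ[ C ∈ (Fin k → List D) ]
      (∀ j → Chain (C j)) ×
      Σ[ S ∈ List D ]
        Unique S × (∀ x → x ∈ S ⇔ (∃[ j ] x ∈ C j)) × length S ≡ m

  Sorted : List D → Set
  Sorted = AllPairs _≼_

  chain⇒sorted : ∀ xs → Chain xs → ∃[ ys ] ys ↭ xs × Sorted ys
  chain⇒sorted [] _ = [] , ↭-refl , []
  chain⇒sorted (x ∷ xs) ch with chain⇒sorted xs (λ p q → ch (there p) (there q))
  ... | ys , p , s with insert ys s (All.tabulate λ y∈ → ch (here refl) (there (↭.∈-resp-↭ p y∈)))
    where
    insert : ∀ ys → Sorted ys → All (λ y → x ≼ y ⊎ y ≼ x) ys → ∃[ zs ] zs ↭ x ∷ ys × Sorted zs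
    insert [] _ _ = [ x ] , ↭-refl , [] ∷ []
    insert (y ∷ ys) (y≼ ∷ s) (inj₁ x≼y ∷ _) =
      x ∷ y ∷ ys , ↭-refl , (x≼y ∷ All.map (≼-trans x≼y) y≼) ∷ y≼ ∷ s
    insert (y ∷ ys) (y≼ ∷ s) (inj₂ y≼x ∷ c) with insert ys s c
    ... | zs , p , t = y ∷ zs , ↭-trans (prep y p) (Perm.swap y x ↭-refl) ,
                       ↭.All-resp-↭ (↭-sym p) (y≼x ∷ y≼) ∷ t
  ... | zs , q , t = zs , ↭-trans q (prep x p) , t

  sorted⇒chain : ∀ {xs} → Sorted xs → Chain xs
  sorted⇒chain _ (here refl) (here refl) = inj₁ ≼-refl
  sorted⇒chain (x≼ ∷ _) (here refl) (there q) = inj₁ (All.lookup x≼ q)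
  sorted⇒chain (x≼ ∷ _) (there p) (here refl) = inj₂ (All.lookup x≼ p)
  sorted⇒chain (_ ∷ s) (there p) (there q) = sorted⇒chain s p q

  -- Chains may overlap: each element of `S` is given to the first chain that contains it, and what
  -- is left of a chain is still a chain.
  chains⇒paths : ∀ {k} (C : Fin k → List D) → (∀ j → Chain (C j)) → ∀ S →
                 (∀ {x} → x ∈ S → ∃[ j ] x ∈ C j) →
                 ∃[ L ] All Sorted L × concat L ↭ S × length L ≡ k
  chains⇒paths {zero} C ch [] _ = [] , [] , ↭-refl , refl
  chains⇒paths {zero} C ch (x ∷ S) f with () ← proj₁ (f (here refl))
  chains⇒paths {suc k} C ch S f
    with chain⇒sorted (filter (_∈? C fzero) S)
           (λ p q → ch fzero (proj₂ (∈.∈-filter⁻ (_∈? C fzero) {xs = S} p))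
               (proj₂ (∈.∈-filter⁻ (_∈? C fzero) {xs = S} q)))
       | chains⇒paths (C ∘ fsuc) (ch ∘ fsuc) (filter (¬? ∘ (_∈? C fzero)) S) rest
    where
    rest : ∀ {x} → x ∈ filter (¬? ∘ (_∈? C fzero)) S → ∃[ j ] x ∈ C (fsuc j)
    rest x∈ with ∈.∈-filter⁻ (¬? ∘ (_∈? C fzero)) {xs = S} x∈
    ... | x∈S , x∉ with f x∈S
    ... | fzero , q = contradiction q x∉
    ... | fsuc j , q = j , q
  ... | p , p↭ , s | L , ss , L↭ , l =
    p ∷ L , s ∷ ss , ↭-trans (↭.++⁺ p↭ L↭) (↭-sym (filter-split (_∈? C fzero) S)) , cong suc l

  paths⇒family : ∀ {k} L → All Sorted L → Unique (concat L) → length L ≤ k →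
                 Family k (length (concat L))
  paths⇒family L s u l = pick L , chains L s , concat L , u ,
                         (λ x → mk⇔ (to L l) (λ (j , p) → from L j p)) , refl
    where
    pick : ∀ {k} → List (List D) → Fin k → List D
    -- Surplus indices receive the empty chain, which is why `length L ≤ k` is enough.
    pick [] _ = []
    pick (p ∷ L) fzero = p
    pick (p ∷ L) (fsuc j) = pick L j

    chains : ∀ {k} L → All Sorted L → (j : Fin k) → Chain (pick L j)
    chains [] _ j ()
    chains (p ∷ L) (s ∷ ss) fzero = sorted⇒chain s
    chains (p ∷ L) (s ∷ ss) (fsuc j) = chains L ss j

    to : ∀ {k x} L → length L ≤ k → x ∈ concat L → ∃[ j ] x ∈ pick {k} L j
    to (p ∷ L) (s≤s l) x∈ with ∈.∈-++⁻ p x∈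
    ... | inj₁ x∈p = fzero , x∈p
    ... | inj₂ x∈L with to L l x∈L
    ... | j , q = fsuc j , q

    from : ∀ {k x} L (j : Fin k) → x ∈ pick L j → x ∈ concat L
    from (p ∷ L) fzero q = ∈.∈-++⁺ˡ q
    from (p ∷ L) (fsuc j) q = ∈.∈-++⁺ʳ p (from L j q)

  Loop : D × D → Set
  Loop f = proj₁ f ≡ proj₂ f

  loop? : Decidable Loop
  loop? f = proj₁ f ≟ proj₂ f

  loops : List (D × D) → ℕ
  loops M = length (filter loop? M)

  complement : ∀ U → Unique U → length (filter (¬? ∘ (_∈? U)) V) + length U ≡ length V
  complement U u = begin
    length (filter (¬? ∘ (_∈? U)) V) + length U   ≡⟨ ℕ.+-comm (length (filter (¬? ∘ (_∈? U)) V)) _ ⟩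
    length U + length (filter (¬? ∘ (_∈? U)) V)   ≡⟨ List.length-++ U ⟨
    length (U ++ filter (¬? ∘ (_∈? U)) V)
      ≡⟨ ↭.↭-length (↭-trans (↭.++⁺ʳ _ U↭) (↭-sym (filter-split (_∈? U) V))) ⟩
    length V                                      ∎
    where
    open ≡-Reasoning
    U↭ : U ↭ filter (_∈? U) V
    U↭ = Unique-⊆-⊇⇒↭ u (Unique.filter⁺ (_∈? U) V-unique)
           (λ p → ∈.∈-filter⁺ (_∈? U) (V-complete _) p)
           (λ p → proj₂ (∈.∈-filter⁻ (_∈? U) {xs = V} p))

  edges : List D → List (D × D)
  edges [] = []
  edges (x ∷ []) = []
  edges (x ∷ y ∷ xs) = (x , y) ∷ edges (y ∷ xs)

  edges-∈ : ∀ x xs → All (λ f → proj₁ f ∈ x ∷ xs × proj₂ f ∈ xs) (edges (x ∷ xs))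
  edges-∈ x [] = []
  edges-∈ x (y ∷ xs) = (here refl , here refl) ∷
    All.map (λ (p , q) → there p , there q) (edges-∈ y xs)

  edges-⊆ : ∀ xs → All (λ f → proj₁ f ∈ xs × proj₂ f ∈ xs) (edges xs)
  edges-⊆ [] = []
  edges-⊆ (x ∷ xs) = All.map (λ (p , q) → p , there q) (edges-∈ x xs)

  edges-matching : ∀ xs → Unique xs → Matching (edges xs)
  edges-matching [] _ = []
  edges-matching (x ∷ []) _ = []
  edges-matching (x ∷ y ∷ xs) (x∉ ∷ u@(y∉ ∷ _)) =
    All.map (λ (p , q) → All.lookup x∉ p , All.lookup y∉ q) (edges-∈ y xs) ∷
    edges-matching (y ∷ xs) u

  Increasing : D × D → Set
  Increasing f = proj₁ f ≼ proj₂ f × ¬ Loop f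

  edges-increasing : ∀ xs → Unique xs → Sorted xs → All Increasing (edges xs)
  edges-increasing [] _ _ = []
  edges-increasing (x ∷ []) _ _ = []
  edges-increasing (x ∷ y ∷ xs) ((x≢y ∷ _) ∷ u) ((x≼y ∷ _) ∷ s) =
    (x≼y , x≢y) ∷ edges-increasing (y ∷ xs) u s

  -- Only an inequality, because the empty list has as many elements as edges.
  edges-length : ∀ xs → length xs ≤ suc (length (edges xs))
  edges-length [] = z≤n
  edges-length (x ∷ []) = s≤s z≤n
  edges-length (x ∷ y ∷ xs) = s≤s (edges-length (y ∷ xs))

  all-edges : ∀ L → Unique (concat L) → All Sorted L →
    ∃[ M ] Matching M × All Increasing M ×
           All (λ f → proj₁ f ∈ concat L × proj₂ f ∈ concat L) M ×
           length (concat L) ≤ length L + length M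
  all-edges [] _ _ = [] , [] , [] , [] , z≤n
  all-edges (p ∷ L) u (s ∷ ss) with AllPairs-++⁻ p u
  ... | up , uL , cross with all-edges L uL ss
  ... | M , m , inc , M⊆ , l =
    edges p ++ M ,
    AllPairs.++⁺ (edges-matching p up) m
      (All.map (λ (a , b) → All.map (λ (c , d) →
        All.lookup (All.lookup cross a) c , All.lookup (All.lookup cross b) d) M⊆) (edges-⊆ p)) ,
    All.++⁺ (edges-increasing p up s) inc ,
    All.++⁺ (All.map (λ (a , b) → ∈.∈-++⁺ˡ a , ∈.∈-++⁺ˡ b) (edges-⊆ p))
            (All.map (λ (a , b) → ∈.∈-++⁺ʳ p a , ∈.∈-++⁺ʳ p b) M⊆) ,
    bound
    where
    open ℕ.≤-Reasoning
    bound : length (p ++ concat L) ≤ suc (length L) + length (edges p ++ M)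
    bound = begin
      length (p ++ concat L)                              ≡⟨ List.length-++ p ⟩
      length p + length (concat L)                        ≤⟨ ℕ.+-mono-≤ (edges-length p) l ⟩
      suc (length (edges p)) + (length L + length M)      ≡⟨ cong suc (ℕ.+-assoc (length (edges p)) _ _) ⟨
      suc (length (edges p) + length L + length M)        ≡⟨ cong (λ z → suc (z + length M))
          (ℕ.+-comm (length (edges p)) _) ⟩
      suc (length L + length (edges p) + length M)        ≡⟨ cong suc (ℕ.+-assoc (length L) _ _) ⟩
      suc (length L) + (length (edges p) + length M)      ≡⟨ cong (suc (length L) +_)
          (List.length-++ (edges p)) ⟨
      suc (length L) + length (edges p ++ M)              ∎

  -- Uncovered elements become loops, so that families of k chains become
  -- matchings with |V| − k edges.
  family⇒matching : ∀ {k m} → Family k m →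
    ∃[ M ] Matching M × All (λ f → proj₁ f ≼ proj₂ f) M ×
           loops M + m ≡ length V × length V ≤ k + length M
  family⇒matching {k} {m} (C , ch , S , uS , S⇔ , refl)
    with chains⇒paths C ch S (λ {x} → Equivalence.to (S⇔ x))
  ... | L , ss , L↭ , refl
    with all-edges L (Unique-resp-↭ (↭-sym L↭) uS) ss
  ... | M , mM , inc , M⊆ , l = M ++ map diag U , matching , All.++⁺ (All.map proj₁ inc)
      (All.map⁺ (All.tabulate λ _ → ≼-refl)) , count , bound
    where
    diag : D → D × D
    diag x = x , x
    U = filter (¬? ∘ (_∈? concat L)) V

    apart : ∀ {x y} → x ∈ concat L → y ∉ concat L → x ≢ y
    apart p q refl = q p

    U∉ : All (_∉ concat L) U
    U∉ = All.all-filter (¬? ∘ (_∈? concat L)) V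

    matching : Matching (M ++ map diag U)
    matching = AllPairs.++⁺ mM
      (AllPairs.map⁺ (AllPairs.map (λ p → p , p) (Unique.filter⁺ (¬? ∘ (_∈? concat L)) V-unique)))
      (All.map (λ (a , b) → All.map⁺ (All.map (λ c → apart a c , apart b c) U∉)) M⊆)

    filter-M : filter loop? (M ++ map diag U) ≡ map diag U
    filter-M = trans (List.filter-++ loop? M (map diag U))
      (cong₂ _++_ (List.filter-none loop? (All.map proj₂ inc))
                  (List.filter-all loop? (All.map⁺ (All.tabulate λ _ → refl))))

    U+S : length U + length S ≡ length V
    U+S = trans (cong (length U +_) (sym (↭.↭-length L↭)))
      (complement (concat L) (Unique-resp-↭ (↭-sym L↭) uS))

    count : loops (M ++ map diag U) + length S ≡ length V
    count = trans (cong (_+ length S) (trans (cong length filter-M) (List.length-map diag U))) U+S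

    open ℕ.≤-Reasoning
    bound : length V ≤ length L + length (M ++ map diag U)
    bound = begin
      length V                                       ≡⟨ U+S ⟨
      length U + length S                            ≡⟨ ℕ.+-comm (length U) _ ⟩
      length S + length U                            ≡⟨ cong₂ _+_ (↭.↭-length L↭) (List.length-map diag U) ⟨
      length (concat L) + length (map diag U)        ≤⟨ ℕ.+-monoˡ-≤ _ l ⟩
      length L + length M + length (map diag U)      ≡⟨ ℕ.+-assoc (length L) _ _ ⟩
      length L + (length M + length (map diag U))    ≡⟨ cong (length L +_) (List.length-++ M) ⟨
      length L + length (M ++ map diag U)            ∎

  -- The ends serve as bounds of the elements; apart from sortedness this is all that concatenation
  -- and the exclusion of cycles require.
  record Path : Set where
    field
      start end : D
      elements  : List D
      sorted    : Sorted elements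
      start≼end : start ≼ end
      start≼    : All (start ≼_) elements
      ≼end      : All (_≼ end) elements
  open Path

  single : D → Path
  single x = record
    { start = x ; end = x ; elements = [ x ] ; sorted = [] ∷ [] ; start≼end = ≼-refl
    ; start≼ = ≼-refl ∷ [] ; ≼end = ≼-refl ∷ [] }

  join : (p q : Path) → end p ≼ start q → Path
  join p q x≼y = record
    { start = start p ; end = end q ; elements = elements p ++ elements q
    ; sorted = AllPairs.++⁺ (sorted p) (sorted q)
        (All.map (λ a≼ → All.map (≼-trans (≼-trans a≼ x≼y)) (start≼ q)) (≼end p))
    ; start≼end = ≼-trans (start≼end p) (≼-trans x≼y (start≼end q))
    ; start≼ = All.++⁺ (start≼ p) (All.map (≼-trans (≼-trans (start≼end p) x≼y)) (start≼ q))
    ; ≼end = All.++⁺ (All.map (λ a≼ → ≼-trans a≼ (≼-trans x≼y (start≼end q))) (≼end p)) (≼end q) }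

  -- Starting from singletons, each edge joins the path ending in x to the path starting in y and so
  -- lowers the number of paths by one. The last two components record which elements are still
  -- available as a start or as an end.
  matching⇒paths : ∀ U M → Matching M → All Increasing M →
    All (λ f → proj₁ f ∈ U × proj₂ f ∈ U) M →
    ∃[ L ] concat (map elements L) ↭ U × length L + length M ≡ length U ×
      (∀ {x} → x ∈ U → x ∉ map proj₂ M → x ∈ map start L) ×
      (∀ {x} → x ∈ U → x ∉ map proj₁ M → x ∈ map end L)
  matching⇒paths U [] _ _ _ =
    map single U , subst (_↭ U) (sym (singles U)) ↭-refl ,
    trans (ℕ.+-identityʳ _) (List.length-map single U) ,
    (λ p _ → ∈.∈-map⁺ start (∈.∈-map⁺ single p)) , (λ p _ → ∈.∈-map⁺ end (∈.∈-map⁺ single p))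
    where
    singles : ∀ U → concat (map elements (map single U)) ≡ U
    singles [] = refl
    singles (x ∷ U) = cong (x ∷_) (singles U)
  matching⇒paths U ((x , y) ∷ M) (f# ∷ m) ((x≼y , x≢y) ∷ inc) ((x∈ , y∈) ∷ M⊆)
    with matching⇒paths U M m inc M⊆
  ... | L , L↭ , l , starts , ends
    with ∈.∈-map⁻ start (starts y∈ (fresh₂ f#)) | ∈.∈-map⁻ end (ends x∈ (fresh₁ f#))
    where
    fresh₁ : All (Apart (x , y)) M → x ∉ map proj₁ M
    fresh₁ a q with ∈.∈-map⁻ proj₁ q
    ... | f , f∈ , eq = proj₁ (All.lookup a f∈) eq
    fresh₂ : All (Apart (x , y)) M → y ∉ map proj₂ M
    fresh₂ a q with ∈.∈-map⁻ proj₂ q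
    ... | f , f∈ , eq = proj₂ (All.lookup a f∈) eq
  ... | p , p∈ , refl | q , q∈ , refl with extract p∈
  ... | L₁ , r₁ with ↭.∈-resp-↭ r₁ q∈
  -- If the two paths coincided, `start≼end` would give y ≼ x and hence x = y: no cycle can close.
  ... | here refl = contradiction (≼-antisym x≼y (start≼end p)) x≢y
  ... | there q∈′ with extract q∈′
  ... | L₂ , r₂ = join q p x≼y ∷ L₂ , perm , count , starts′ , ends′
    where
    r : L ↭ p ∷ q ∷ L₂
    r = ↭-trans r₁ (prep p r₂)

    concat-↭ : ∀ {xss yss : List (List D)} → xss ↭ yss → concat xss ↭ concat yss
    concat-↭ Perm.refl = ↭-refl
    concat-↭ (prep xs p) = ↭.++⁺ˡ xs (concat-↭ p)
    concat-↭ (Perm.swap xs ys p) = ↭-trans (↭.shifts xs ys) (↭.++⁺ˡ ys (↭.++⁺ˡ xs (concat-↭ p)))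
    concat-↭ (Perm.trans p q) = ↭-trans (concat-↭ p) (concat-↭ q)

    perm : concat (map elements (join q p x≼y ∷ L₂)) ↭ U
    perm = ↭-trans (↭.++-assoc (elements q) (elements p) (concat (map elements L₂)))
      (↭-trans (↭.shifts (elements q) (elements p))
        (↭-trans (↭-sym (concat-↭ (↭.map⁺ elements r))) L↭))

    count : suc (length L₂) + suc (length M) ≡ length U
    count = trans (cong suc (ℕ.+-suc (length L₂) (length M)))
      (trans (cong (_+ length M) (sym (↭.↭-length r))) l)

    starts′ : ∀ {z} → z ∈ U → z ∉ start p ∷ map proj₂ M → z ∈ start q ∷ map start L₂
    starts′ z∈ z∉ with ↭.∈-resp-↭ (↭.map⁺ start r) (starts z∈ (z∉ ∘ there))
    ... | here eq = contradiction (here eq) z∉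
    ... | there w = w

    ends′ : ∀ {z} → z ∈ U → z ∉ end q ∷ map proj₁ M → z ∈ end p ∷ map end L₂
    ends′ z∈ z∉ with ↭.∈-resp-↭ (↭.map⁺ end r) (ends z∈ (z∉ ∘ there))
    ... | here eq = here eq
    ... | there (here eq) = contradiction (here eq) z∉
    ... | there (there w) = there w

  -- A loop uses both copies of its element, so no other edge touches it. Without the loops, |V| -
  -- loops elements and |M| - loops edges remain, which make |V| - |M| paths.
  matching⇒family : ∀ {k} M → Matching M → All (λ f → proj₁ f ≼ proj₂ f) M →
    length V ≤ k + length M → ∃[ m ] Family k m × loops M + m ≡ length V
  matching⇒family {k} M m inc bound
    with Matching-resp-↭ (filter-split loop? M) m
  ... | m′ with AllPairs-++⁻ (filter loop? M) m′
  ... | m₁ , m₂ , cross with matching⇒paths U (filter (¬? ∘ loop?) M) m₂ inc′ ends∈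
    where
    O = map proj₁ (filter loop? M)
    U = filter (¬? ∘ (_∈? O)) V

    inc′ : All Increasing (filter (¬? ∘ loop?) M)
    inc′ = All.zip (All.filter⁺ (¬? ∘ loop?) inc , All.all-filter (¬? ∘ loop?) M)

    ∉₁ : ∀ {f} → f ∈ filter (¬? ∘ loop?) M → proj₁ f ∉ O
    ∉₁ f∈ p with ∈.∈-map⁻ proj₁ p
    ... | g , g∈ , eq = proj₁ (All.lookup (All.lookup cross g∈) f∈) (sym eq)

    ∉₂ : ∀ {f} → f ∈ filter (¬? ∘ loop?) M → proj₂ f ∉ O
    ∉₂ f∈ p with ∈.∈-map⁻ proj₁ p
    ... | g , g∈ , eq = proj₂ (All.lookup (All.lookup cross g∈) f∈)
                          (sym (trans eq (proj₂ (∈.∈-filter⁻ loop? {xs = M} g∈))))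

    ends∈ : All (λ f → proj₁ f ∈ U × proj₂ f ∈ U) (filter (¬? ∘ loop?) M)
    ends∈ = All.tabulate λ f∈ → ∈.∈-filter⁺ (¬? ∘ (_∈? O)) (V-complete _) (∉₁ f∈) ,
                                ∈.∈-filter⁺ (¬? ∘ (_∈? O)) (V-complete _) (∉₂ f∈)
  ... | L , L↭ , l , _ =
    _ , paths⇒family (map elements L) (All.map⁺ (All.tabulate λ {p} _ → sorted p))
          (Unique-resp-↭ (↭-sym L↭) (Unique.filter⁺ (¬? ∘ (_∈? O)) V-unique)) short , total
    where
    O = map proj₁ (filter loop? M)
    U = filter (¬? ∘ (_∈? O)) V

    U+O : length U + loops M ≡ length V
    U+O = trans (cong (length U +_) (sym (List.length-map proj₁ (filter loop? M))))
      (complement O (AllPairs.map⁺ (AllPairs.map proj₁ m₁)))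

    total : loops M + length (concat (map elements L)) ≡ length V
    total = trans (cong (loops M +_) (↭.↭-length L↭)) (trans (ℕ.+-comm (loops M) _) U+O)

    open ℕ.≤-Reasoning
    N = length (filter (¬? ∘ loop?) M)
    short : length (map elements L) ≤ k
    short = subst (_≤ k) (sym (List.length-map elements L)) (ℕ.+-cancelʳ-≤ (length M) _ _ (begin
      length L + length M        ≡⟨ cong (length L +_) (trans (↭.↭-length (filter-split loop? M))
          (List.length-++ (filter loop? M))) ⟩
      length L + (loops M + N)   ≡⟨ cong (length L +_) (ℕ.+-comm (loops M) N) ⟩
      length L + (N + loops M)   ≡⟨ ℕ.+-assoc (length L) N _ ⟨
      length L + N + loops M     ≡⟨ cong (_+ loops M) l ⟩
      length U + loops M         ≡⟨ U+O ⟩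
      length V                   ≤⟨ bound ⟩
      k + length M               ∎))

  loops-++ : ∀ M N → loops (M ++ N) ≡ loops M + loops N
  loops-++ M N = trans (cong length (List.filter-++ loop? M N)) (List.length-++ (filter loop? M))

  -- Exchange preserves the multiset of edges, hence the total number of loops, that is, of
  -- uncovered elements, while both matchings become large enough for k + 1 chains.
  concave : ∀ {a b c k} → Family k a → Family (2 + k) c →
            (∀ {m} → Family (suc k) m → m ≤ b) → a + c ≤ b + b
  concave {a} {b} {c} {k} F G max with family⇒matching F | family⇒matching G
  ... | M₁ , m₁ , i₁ , w₁ , l₁ | M₂ , m₂ , i₂ , w₂ , l₂
    with length V ≤? suc k + length M₂
  -- `M₂` already has enough edges for k + 1 chains, as `M₁` always has, so a and c are each at most
  -- b.
  ... | yes V≤ = ℕ.+-mono-≤ (covered M₁ m₁ i₁ w₁ (ℕ.m≤n⇒m≤1+n l₁)) (covered M₂ m₂ i₂ w₂ V≤)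
    where
    covered : ∀ {m} M → Matching M → All (λ f → proj₁ f ≼ proj₂ f) M →
              loops M + m ≡ length V → length V ≤ suc k + length M → m ≤ b
    covered M mM i w l =
      let m′ , H , w′ = matching⇒family M mM i l
      in subst (_≤ b) (ℕ.+-cancelˡ-≡ (loops M) _ _ (trans w′ (sym w))) (max H)
  -- Fewer chains have more edges: `M₁` is the larger matching, here by at least two.
  ... | no V≰ with exchange M₂ M₁ m₂ m₁
                     (ℕ.+-cancelˡ-≤ k _ _ (ℕ.≤-trans (subst (_≤ length V) shift (ℕ.≰⇒> V≰)) l₁))
    where
    shift : suc (suc k + length M₂) ≡ k + (2 + length M₂)
    shift = sym (trans (ℕ.+-suc k _) (cong suc (ℕ.+-suc k _)))
  ... | N₁ , N₂ , n₁ , n₂ , p , l = final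
    where
    inc : All (λ f → proj₁ f ≼ proj₂ f) (N₁ ++ N₂)
    inc = ↭.All-resp-↭ (↭-sym p) (All.++⁺ i₂ i₁)

    lengths : suc (length N₂) ≡ length M₁
    lengths = ℕ.+-cancelˡ-≡ (length M₂) _ _ (begin
      length M₂ + suc (length N₂)   ≡⟨ ℕ.+-suc (length M₂) _ ⟩
      suc (length M₂) + length N₂   ≡⟨ cong (_+ length N₂) l ⟨
      length N₁ + length N₂         ≡⟨ List.length-++ N₁ ⟨
      length (N₁ ++ N₂)             ≡⟨ ↭.↭-length p ⟩
      length (M₂ ++ M₁)             ≡⟨ List.length-++ M₂ ⟩
      length M₂ + length M₁         ∎)
      where open ≡-Reasoning

    weights : loops N₁ + loops N₂ ≡ loops M₁ + loops M₂
    weights = begin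
      loops N₁ + loops N₂   ≡⟨ loops-++ N₁ N₂ ⟨
      loops (N₁ ++ N₂)      ≡⟨ ↭.↭-length (↭.filter-↭ loop? p) ⟩
      loops (M₂ ++ M₁)      ≡⟨ loops-++ M₂ M₁ ⟩
      loops M₂ + loops M₁   ≡⟨ ℕ.+-comm (loops M₂) _ ⟩
      loops M₁ + loops M₂   ∎
      where open ≡-Reasoning

    interchange : ∀ x y z w → (x + y) + (z + w) ≡ (x + z) + (y + w)
    interchange x y z w = begin
      (x + y) + (z + w)   ≡⟨ ℕ.+-assoc x y _ ⟩
      x + (y + (z + w))   ≡⟨ cong (x +_) (ℕ.+-assoc y z w) ⟨
      x + (y + z + w)     ≡⟨ cong (λ v → x + (v + w)) (ℕ.+-comm y z) ⟩
      x + (z + y + w)     ≡⟨ cong (x +_) (ℕ.+-assoc z y w) ⟩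
      x + (z + (y + w))   ≡⟨ ℕ.+-assoc x z _ ⟨
      (x + z) + (y + w)   ∎
      where open ≡-Reasoning

    final : a + c ≤ b + b
    final =
      let b₁ , H₁ , v₁ = matching⇒family {suc k} N₁ n₁ (All.++⁻ˡ N₁ inc)
            (subst (length V ≤_) (trans (cong suc (sym (ℕ.+-suc k _))) (cong (suc k +_) (sym l))) l₂)
          b₂ , H₂ , v₂ = matching⇒family {suc k} N₂ n₂ (All.++⁻ʳ N₁ inc)
            (subst (length V ≤_) (trans (cong (k +_) (sym lengths)) (ℕ.+-suc k _)) l₁)
      in subst (_≤ b + b) (same b₁ b₂ v₁ v₂) (ℕ.+-mono-≤ (max H₁) (max H₂))
      where
      open ≡-Reasoning
      same : ∀ b₁ b₂ → loops N₁ + b₁ ≡ length V → loops N₂ + b₂ ≡ length V → b₁ + b₂ ≡ a + c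
      same b₁ b₂ v₁ v₂ = ℕ.+-cancelˡ-≡ (loops M₁ + loops M₂) _ _ (begin
        (loops M₁ + loops M₂) + (b₁ + b₂)   ≡⟨ cong (_+ (b₁ + b₂)) weights ⟨
        (loops N₁ + loops N₂) + (b₁ + b₂)   ≡⟨ interchange (loops N₁) _ _ _ ⟩
        (loops N₁ + b₁) + (loops N₂ + b₂)   ≡⟨ cong₂ _+_ (trans v₁ (sym w₁)) (trans v₂ (sym w₂)) ⟩
        (loops M₁ + a) + (loops M₂ + c)     ≡⟨ interchange (loops M₁) _ _ _ ⟩
        (loops M₁ + loops M₂) + (a + c)     ∎)

  cover-family : ∀ {k} (C : Fin k → List D) → (∀ j → Chain (C j)) →
    ∃[ m ] Family k m × ∃[ U ] Unique U × (∀ {x} → x ∈ U → ∀ j → x ∉ C j) × m + length U ≡ length V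
  cover-family C ch = _ ,
    (C , ch , filter covered? V , Unique.filter⁺ covered? V-unique ,
     (λ x → mk⇔ (λ p → proj₂ (∈.∈-filter⁻ covered? {xs = V} p))
                (∈.∈-filter⁺ covered? (V-complete x))) , refl) ,
    filter (¬? ∘ covered?) V , Unique.filter⁺ (¬? ∘ covered?) V-unique ,
    (λ p j q → proj₂ (∈.∈-filter⁻ (¬? ∘ covered?) {xs = V} p) (j , q)) ,
    trans (sym (List.length-++ (filter covered? V))) (sym (↭.↭-length (filter-split covered? V)))
    where
    covered? : Decidable (λ x → ∃[ j ] x ∈ C j)
    covered? x = Fin.any? (λ j → x ∈? C j)

  -- By the pigeonhole principle k chains cannot hold all k + 1 elements of an antichain;
  -- disjointness of the antichains makes the missed elements distinct.
  antichains-miss : ∀ {k m} μ (a : Fin μ → Fin (suc k) → D) →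
    (∀ z {s t} → s Data.Fin.< t → ¬ (a z s ≼ a z t) × ¬ (a z t ≼ a z s)) →
    (∀ {y z s t} → a y s ≡ a z t → y ≡ z) →
    Family k m → m + μ ≤ length V
  antichains-miss {k} μ a anti inj (C , ch , S , uS , S⇔ , refl) =
    subst (_≤ length V) (trans (List.length-++ S) (cong (length S +_) len))
      (Unique-⊆⇒length-≤ {xs = S ++ map b (allFin μ)} (AllPairs.++⁺ uS
        (Unique.map⁺ inj (Unique.allFin⁺ μ))
        (All.tabulate λ x∈ → All.map⁺ (All.tabulate λ {z} _ eq → proj₂ (missed z) (subst (_∈ S) eq x∈))))
        (λ _ → V-complete _))
    where
    missed : ∀ z → ∃[ t ] a z t ∉ S
    missed z with Fin.any? (λ t → ¬? (a z t ∈? S))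
    ... | yes p = p
    ... | no ¬p = ⊥-elim (collide (Fin.pigeonhole ℕ.≤-refl (proj₁ ∘ chain)))
      where
      chain : ∀ t → ∃[ j ] a z t ∈ C j
      chain t with a z t ∈? S
      ... | yes q = Equivalence.to (S⇔ _) q
      ... | no q = contradiction (t , q) ¬p

      collide : ¬ (∃[ s ] ∃[ t ] s Data.Fin.< t × proj₁ (chain s) ≡ proj₁ (chain t))
      collide (s , t , s<t , eq)
        with ch (proj₁ (chain t)) (subst (λ j → a z s ∈ C j) eq (proj₂ (chain s))) (proj₂ (chain t))
      ... | inj₁ le = proj₁ (anti z s<t) le
      ... | inj₂ ge = proj₂ (anti z s<t) ge

    b : Fin μ → D
    b z = a z (proj₁ (missed z))

    len : length (map b (allFin μ)) ≡ μ
    len = trans (List.length-map b (allFin μ)) (List.length-tabulate id)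

-- The order of the poset in the coordinates A, B and K

AllPairs-lookup : {A : Set} {R : A → A → Set} {xs : List A} → AllPairs R xs →
                  ∀ {i j} → toℕ i < toℕ j → R (lookup xs i) (lookup xs j)
AllPairs-lookup (px ∷ pxs) {fzero} {fsuc j} _ = All.lookup px (∈.∈-lookup j)
AllPairs-lookup (px ∷ pxs) {fsuc i} {fsuc j} (s≤s i<j) = AllPairs-lookup pxs i<j

-- An element is given by its distances A and B to the two ends of its part
-- and by its copy number; ≼ is the product order in A and B (reversed),
-- refined by the copy number.
module Poset (P : Powers) (isP : IsPartition P) where

  increasing : AllPairs (λ a b → part a < part b) P
  increasing = Linked.Linked⇒AllPairs ℕ.<-trans (proj₁ isP)
    where import Data.List.Relation.Unary.Linked.Properties as Linked

  p n : Fin (length P) → ℕ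
  p i = part (lookup P i)
  n i = mult (lookup P i)

  p-mono : ∀ {i j} → toℕ i < toℕ j → p i < p j
  p-mono = AllPairs-lookup increasing

  p-cancel-< : ∀ {i j} → p i < p j → toℕ i < toℕ j
  p-cancel-< {i} {j} lt with ℕ.<-cmp (toℕ i) (toℕ j)
  ... | tri< i<j _ _ = i<j
  ... | tri≈ _ eq _ = contradiction lt (ℕ.<-irrefl (cong p (Fin.toℕ-injective eq)))
  ... | tri> _ _ j<i = contradiction lt (ℕ.<-asym (p-mono j<i))

  p-injective : ∀ {i j} → p i ≡ p j → i ≡ j
  p-injective {i} {j} eq with ℕ.<-cmp (toℕ i) (toℕ j)
  ... | tri< i<j _ _ = contradiction (p-mono i<j) (ℕ.<-irrefl eq)
  ... | tri≈ _ eq′ _ = Fin.toℕ-injective eq′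
  ... | tri> _ _ j<i = contradiction (p-mono j<i) (ℕ.<-irrefl (sym eq))

  n-positive : ∀ i → 0 < n i
  n-positive i = proj₂ (All.lookup (proj₂ isP) (∈.∈-lookup i))

  S A B K : 𝒟 P → ℕ
  S x = p (𝒟.index x)
  A x = toℕ (𝒟.height x)
  B x = S x ∸ suc (A x)
  K x = toℕ (𝒟.copy x)

  A<S : ∀ x → A x < S x
  A<S x = Fin.toℕ<n (𝒟.height x)

  A+B : ∀ x → suc (A x + B x) ≡ S x
  A+B x = ℕ.m+[n∸m]≡n (A<S x)

  infix 4 _⊑_
  _⊑_ : 𝒟 P → 𝒟 P → Set
  x ⊑ y = A x ≤ A y × B y ≤ B x × (A x ≡ A y → B x ≡ B y → K x ≤ K y)

  ⊑-refl : ∀ {x} → x ⊑ x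
  ⊑-refl = ℕ.≤-refl , ℕ.≤-refl , λ _ _ → ℕ.≤-refl

  ⊑-trans : ∀ {x y z} → x ⊑ y → y ⊑ z → x ⊑ z
  ⊑-trans (a , b , k) (a′ , b′ , k′) = ℕ.≤-trans a a′ , ℕ.≤-trans b′ b , λ eqA eqB →
    ℕ.≤-trans
      (k (ℕ.≤-antisym a (ℕ.≤-trans a′ (ℕ.≤-reflexive (sym eqA))))
         (ℕ.≤-antisym (ℕ.≤-trans (ℕ.≤-reflexive eqB) b′) b))
      (k′ (ℕ.≤-antisym a′ (ℕ.≤-trans (ℕ.≤-reflexive (sym eqA)) a))
          (ℕ.≤-antisym (ℕ.≤-trans b (ℕ.≤-reflexive eqB)) b′))

  elt-≡ : ∀ {x y} → A x ≡ A y → B x ≡ B y → K x ≡ K y → x ≡ y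
  elt-≡ {x} {y} eqA eqB eqK
    with p-injective {𝒟.index x} {𝒟.index y}
           (trans (sym (A+B x)) (trans (cong₂ (λ a b → suc (a + b)) eqA eqB) (A+B y)))
  ... | refl = cong₂ (elt (𝒟.index x)) (Fin.toℕ-injective eqA) (Fin.toℕ-injective eqK)

  ⊑-antisym : ∀ {x y} → x ⊑ y → y ⊑ x → x ≡ y
  ⊑-antisym (a , b , k) (a′ , b′ , k′) = elt-≡ eqA eqB (ℕ.≤-antisym (k eqA eqB) (k′ (sym eqA) (sym eqB)))
    where
    eqA = ℕ.≤-antisym a a′
    eqB = ℕ.≤-antisym b′ b

  -- α raises A and keeps B, β keeps A and lowers B, e raises only K, and ω raises A and lowers B.
  ⋖⇒⊑ : ∀ {x y} → x ⋖ y → x ⊑ y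
  ⋖⇒⊑ {x} {y} (α i≡ u≡ _ _) = ℕ.<⇒≤ A< , ℕ.≤-reflexive (sym B≡) , λ eq _ → contradiction A< (ℕ.<-irrefl eq)
    where
    Ay+Sx : A y + S x ≡ A x + S y
    Ay+Sx = ℕ.suc-injective u≡

    A< : A x < A y
    A< = ℕ.+-cancelʳ-< (S x) (A x) (A y)
      (subst (A x + S x <_) (sym Ay+Sx) (ℕ.+-monoʳ-< (A x) (p-mono (ℕ.≤-reflexive (sym i≡)))))

    open ≡-Reasoning
    B≡ : B x ≡ B y
    B≡ = ℕ.+-cancelˡ-≡ (suc (A y + A x)) _ _ (begin
      suc (A y + A x + B x)     ≡⟨ cong suc (ℕ.+-assoc (A y) (A x) (B x)) ⟩
      suc (A y + (A x + B x))   ≡⟨ ℕ.+-suc (A y) _ ⟨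
      A y + suc (A x + B x)     ≡⟨ cong (A y +_) (A+B x) ⟩
      A y + S x                 ≡⟨ Ay+Sx ⟩
      A x + S y                 ≡⟨ cong (A x +_) (A+B y) ⟨
      A x + suc (A y + B y)     ≡⟨ ℕ.+-suc (A x) _ ⟩
      suc (A x + (A y + B y))   ≡⟨ cong suc (ℕ.+-assoc (A x) (A y) (B y)) ⟨
      suc (A x + A y + B y)     ≡⟨ cong (λ z → suc (z + B y)) (ℕ.+-comm (A x) (A y)) ⟩
      suc (A y + A x + B y)     ∎)
  ⋖⇒⊑ {x} {y} (β i≡ u≡ _ _) = ℕ.≤-reflexive (sym A≡) , ℕ.<⇒≤ B< , λ _ eq → contradiction B<
      (ℕ.<-irrefl (sym eq))
    where
    A≡ : A y ≡ A x
    A≡ = ℕ.suc-injective u≡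

    B< : B y < B x
    B< = ℕ.+-cancelˡ-< (A x) _ _ (subst (λ a → a + B y < A x + B x) A≡
      (s≤s⁻¹ (subst₂ _<_ (sym (A+B y)) (sym (A+B x)) (p-mono (ℕ.≤-reflexive (sym i≡))))))
  ⋖⇒⊑ {x} {y} (e i≡ u≡ k≡) =
    ℕ.≤-reflexive (sym A≡) , ℕ.≤-reflexive (cong₂ (λ i a → p i ∸ suc a) (Fin.toℕ-injective i≡) A≡) ,
    λ _ _ → ℕ.≤-trans (ℕ.n≤1+n _) (ℕ.≤-reflexive (sym (ℕ.suc-injective k≡)))
    where
    A≡ : A y ≡ A x
    A≡ = ℕ.suc-injective u≡
  ⋖⇒⊑ {x} {y} (ω i≡ _ u≡ _ _) = ℕ.<⇒≤ A< ,
    ℕ.≤-trans (ℕ.≤-reflexive (cong (λ i → p i ∸ suc (A y)) (Fin.toℕ-injective i≡)))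
        (ℕ.∸-monoʳ-≤ (S x) (ℕ.<⇒≤ (s≤s A<))) ,
    λ eq _ → contradiction A< (ℕ.<-irrefl eq)
    where
    A< : A x < A y
    A< = ℕ.≤-reflexive (sym (ℕ.suc-injective u≡))

  ≼⇒⊑ : ∀ {x y} → x ≼ y → x ⊑ y
  ≼⇒⊑ ε = ⊑-refl
  ≼⇒⊑ (c ◅ cs) = ⊑-trans (⋖⇒⊑ c) (≼⇒⊑ cs)

  copies : ∀ {i h} {k l : Fin (n i)} → toℕ k ≤ toℕ l → elt {P} i h k ≼ elt i h l
  copies {i} {h} {k} {l} le = go (toℕ l ∸ toℕ k) (ℕ.m∸n+n≡m le)
    where
    go : ∀ d {k l : Fin (n i)} → d + toℕ k ≡ toℕ l → elt {P} i h k ≼ elt i h l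
    go zero eq with Fin.toℕ-injective eq
    ... | refl = ε
    go (suc d) {k} {l} eq =
      e refl refl (cong suc (Fin.toℕ-fromℕ< k<)) ◅
      go d (trans (cong (d +_) (Fin.toℕ-fromℕ< k<)) (trans (ℕ.+-suc d (toℕ k)) eq))
      where
      k< : suc (toℕ k) < n i
      k< = ℕ.≤-<-trans (subst (suc (toℕ k) ≤_) eq (s≤s (ℕ.m≤n+m _ d))) (Fin.toℕ<n l)

  -- Copies are quantified at both ends: a cover leaves from a last copy and arrives at a first one,
  -- so a cover between positions relates all their copies.
  Reach : (i j : Fin (length P)) → ℕ → ℕ → Set
  Reach i j a b = ∀ {h h′ k k′} → toℕ h ≡ a → toℕ h′ ≡ b → elt {P} i h k ≼ elt j h′ k′

  reach-cover : ∀ {i j a b} →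
    (∀ {h h′ k k′} → toℕ h ≡ a → toℕ h′ ≡ b → suc (toℕ k′) ≡ 1 → suc (toℕ k) ≡ n i →
      elt {P} i h k ⋖ elt j h′ k′) →
    Reach i j a b
  reach-cover {i} {j} f {k = k} {k′} ha hb =
    copies (subst (toℕ k ≤_) (sym last≡) (s≤s⁻¹ (subst (suc (toℕ k) ≤_) (sym (ℕ.suc-pred (n i) ⦃ nz ⦄))
        (Fin.toℕ<n k)))) ◅◅
    (f ha hb (cong suc first≡) (trans (cong suc last≡) (ℕ.suc-pred (n i) ⦃ nz ⦄)) ◅
     copies (subst (_≤ toℕ k′) (sym first≡) z≤n))
    where
    nz = >-nonZero (n-positive i)
    last< : pred (n i) < n i
    last< = ℕ.≤-reflexive (ℕ.suc-pred (n i) ⦃ nz ⦄)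
    last≡ : toℕ (fromℕ< last<) ≡ pred (n i)
    last≡ = Fin.toℕ-fromℕ< last<
    first≡ : toℕ (fromℕ< (n-positive j)) ≡ 0
    first≡ = Fin.toℕ-fromℕ< (n-positive j)

  reach-trans : ∀ {i j l a b c} → b < p j → Reach i j a b → Reach j l b c → Reach i l a c
  reach-trans {j = j} b< r s ha hc =
    r {k′ = fromℕ< (n-positive j)} ha (Fin.toℕ-fromℕ< b<) ◅◅ s (Fin.toℕ-fromℕ< b<) hc

  next : ∀ {i j : Fin (length P)} → toℕ i < toℕ j → ∃[ l ] toℕ l ≡ suc (toℕ i)
  next {j = j} lt = fromℕ< l< , Fin.toℕ-fromℕ< l<
    where l< = ℕ.≤-<-trans lt (Fin.toℕ<n j)

  -- Iterated α keeps B; the equation expresses that B agrees at position a of the part p i and at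
  -- position b of the part p j.
  up : ∀ {i j} a b → toℕ i < toℕ j → a < p i → b + p i ≡ a + p j → Reach i j a b
  up {i} {j} a b lt = go (toℕ j ∸ suc (toℕ i)) a b (ℕ.m∸n+n≡m lt)
    where
    go : ∀ d {i j} a b → d + suc (toℕ i) ≡ toℕ j → a < p i → b + p i ≡ a + p j → Reach i j a b
    go zero a b eq a< b≡ = reach-cover λ { refl refl → α (sym eq) (cong suc b≡) }
    go (suc d) {i} {j} a b eq a< b≡
      with next {i} {j} (ℕ.≤-trans (ℕ.m≤n+m _ (suc d)) (ℕ.≤-reflexive eq))
    ... | l , l≡ = reach-trans c< (reach-cover λ { refl eq′ → α l≡ (cong suc (trans (cong (_+ p i) eq′) c≡)) })
          (go d c b (trans (cong (λ z → d + suc z) l≡) (trans (ℕ.+-suc d _) eq)) c< step)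
      where
      pi≤pl : p i ≤ p l
      pi≤pl = ℕ.<⇒≤ (p-mono (ℕ.≤-reflexive (sym l≡)))
      c = a + (p l ∸ p i)
      c≡ : c + p i ≡ a + p l
      c≡ = trans (ℕ.+-assoc a _ _) (cong (a +_) (ℕ.m∸n+n≡m pi≤pl))
      c< : c < p l
      c< = ℕ.+-cancelʳ-< (p i) _ _ (subst (_< p l + p i) (sym c≡)
             (subst (a + p l <_) (ℕ.+-comm (p i) _) (ℕ.+-monoˡ-< (p l) a<)))
      open ≡-Reasoning
      step : b + p l ≡ c + p j
      step = ℕ.+-cancelʳ-≡ (p i) _ _ (begin
        b + p l + p i     ≡⟨ ℕ.+-assoc b _ _ ⟩
        b + (p l + p i)   ≡⟨ cong (b +_) (ℕ.+-comm (p l) _) ⟩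
        b + (p i + p l)   ≡⟨ ℕ.+-assoc b _ _ ⟨
        b + p i + p l     ≡⟨ cong (_+ p l) b≡ ⟩
        a + p j + p l     ≡⟨ ℕ.+-assoc a _ _ ⟩
        a + (p j + p l)   ≡⟨ cong (a +_) (ℕ.+-comm (p j) _) ⟩
        a + (p l + p j)   ≡⟨ ℕ.+-assoc a _ _ ⟨
        a + p l + p j     ≡⟨ cong (_+ p j) c≡ ⟨
        c + p i + p j     ≡⟨ ℕ.+-assoc c _ _ ⟩
        c + (p i + p j)   ≡⟨ cong (c +_) (ℕ.+-comm (p i) _) ⟩
        c + (p j + p i)   ≡⟨ ℕ.+-assoc c _ _ ⟨
        c + p j + p i     ∎)

  down : ∀ {i j} a → toℕ j < toℕ i → a < p j → Reach i j a a
  down {i} {j} a lt = go (toℕ i ∸ suc (toℕ j)) (ℕ.m∸n+n≡m lt)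
    where
    go : ∀ d {i j} → d + suc (toℕ j) ≡ toℕ i → a < p j → Reach i j a a
    go zero eq a< = reach-cover λ { refl h → β (sym eq) (cong suc h) }
    go (suc d) {i} {j} eq a<
      with next {j} {i} (ℕ.≤-trans (ℕ.m≤n+m _ (suc d)) (ℕ.≤-reflexive eq))
    ... | l , l≡ = reach-trans a<l
          (go d (trans (cong (λ z → d + suc z) l≡) (trans (ℕ.+-suc d _) eq)) a<l)
          (reach-cover λ { refl h → β l≡ (cong suc h) })
      where
      a<l : a < p l
      a<l = ℕ.<-trans a< (p-mono (ℕ.≤-reflexive (sym l≡)))

  -- If p + 1 or p - 1 is a part, going there and back by α and β raises A and lowers B by one; ω
  -- supplies this move exactly when neither is present.
  step : ∀ {i} a → suc a < p i → Reach i i a (suc a)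
  step {i} a a< with Fin.any? (λ j → p j ℕ.≟ suc (p i)) | Fin.any? (λ j → suc (p j) ℕ.≟ p i)
  ... | yes (j , eq) | _ =
    reach-trans (subst (suc a <_) (sym eq) (ℕ.m≤n⇒m≤1+n a<))
      (up a (suc a) i<j (ℕ.<⇒≤ a<) (trans (sym (ℕ.+-suc a _)) (cong (a +_) (sym eq))))
      (down (suc a) i<j a<)
    where i<j = p-cancel-< (ℕ.≤-reflexive (sym eq))
  ... | no _ | yes (j , eq) =
    reach-trans a<j (down a j<i a<j)
      (up a (suc a) j<i a<j (trans (sym (ℕ.+-suc a _)) (cong (a +_) eq)))
    where
    j<i = p-cancel-< (ℕ.≤-reflexive eq)
    a<j = s≤s⁻¹ (subst (suc a <_) (sym eq) a<)
  ... | no ¬above | no ¬below = reach-cover λ { refl eq → ω refl isolated (cong suc eq) }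
    where
    import Data.List.Relation.Unary.Any as Any
    import Data.List.Relation.Unary.Any.Properties as Any
    isolated : All (λ a → part a ≢ suc (p i) × suc (part a) ≢ p i) P
    isolated = All.tabulate λ q →
      (λ eq → ¬above (Any.index q , trans (cong part (sym (Any.lookup-index q))) eq)) ,
      (λ eq → ¬below (Any.index q , trans (cong (suc ∘ part) (sym (Any.lookup-index q))) eq))

  steps : ∀ {i j a b c} → Reach i j a b → b ≤ c → c < p j → Reach i j a c
  steps {i} {j} {a} {b} {c} r b≤c c< = go (c ∸ b) r (ℕ.m∸n+n≡m b≤c)
    where
    go : ∀ d {b} → Reach i j a b → d + b ≡ c → Reach i j a c
    go zero r refl = r
    go (suc d) {b} r eq = go d (reach-trans (ℕ.<-trans (ℕ.n<1+n b) b+1<) r (step b b+1<))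
                            (trans (ℕ.+-suc d b) eq)
      where b+1< = ℕ.≤-<-trans (subst (suc b ≤_) eq (s≤s (ℕ.m≤n+m b d))) c<

  -- `up` or `down` leads to the part of y while changing only one of A and B. From there on S is
  -- fixed, and the rest consists of moves that raise A and lower B by one.
  ⊑⇒≼ : ∀ {x y} → x ⊑ y → x ≼ y
  ⊑⇒≼ {x} {y} (a≤ , b≤ , k≤) with ℕ.<-cmp (toℕ (𝒟.index x)) (toℕ (𝒟.index y))
  ... | tri< lt _ _ = steps (up (A x) c lt (A<S x) c≡) c≤ (A<S y) refl refl
    where
    open ≡-Reasoning
    Sx≤Sy = ℕ.<⇒≤ (p-mono lt)
    c = A x + (S y ∸ S x)
    c≡ : c + S x ≡ A x + S y
    c≡ = trans (ℕ.+-assoc (A x) _ _) (cong (A x +_) (ℕ.m∸n+n≡m Sx≤Sy))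
    c+B : suc (c + B x) ≡ S y
    c+B = ℕ.+-cancelˡ-≡ (A x) _ _ (begin
      A x + suc (c + B x)     ≡⟨ ℕ.+-suc (A x) _ ⟩
      suc (A x + (c + B x))   ≡⟨ cong suc (ℕ.+-assoc (A x) c _) ⟨
      suc (A x + c + B x)     ≡⟨ cong (λ z → suc (z + B x)) (ℕ.+-comm (A x) c) ⟩
      suc (c + A x + B x)     ≡⟨ cong suc (ℕ.+-assoc c (A x) _) ⟩
      suc (c + (A x + B x))   ≡⟨ ℕ.+-suc c _ ⟨
      c + suc (A x + B x)     ≡⟨ cong (c +_) (A+B x) ⟩
      c + S x                 ≡⟨ c≡ ⟩
      A x + S y               ∎)
    c≤ : c ≤ A y
    c≤ = ℕ.+-cancelʳ-≤ (B x) _ _ (s≤s⁻¹ (subst (_≤ suc (A y + B x)) (sym c+B)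
           (subst (_≤ suc (A y + B x)) (A+B y) (s≤s (ℕ.+-monoʳ-≤ (A y) b≤)))))
  ... | tri> _ _ gt = steps (down (A x) gt (ℕ.≤-<-trans a≤ (A<S y))) a≤ (A<S y) refl refl
  ... | tri≈ _ eq _ with Fin.toℕ-injective eq
  ... | refl with ℕ.m≤n⇒m<n∨m≡n a≤
  ... | inj₁ a< = steps (step (A x) (ℕ.≤-<-trans a< (A<S y))) a< (A<S y) refl refl
  ... | inj₂ a≡ with Fin.toℕ-injective a≡
  ... | refl = copies (k≤ refl refl)

  ≼-antisym : ∀ {x y} → x ≼ y → y ≼ x → x ≡ y
  ≼-antisym r s = ⊑-antisym (≼⇒⊑ r) (≼⇒⊑ s)

  comparable : ∀ x y → ¬ (A x < A y × B x < B y) → ¬ (A y < A x × B y < B x) → x ≼ y ⊎ y ≼ x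
  comparable x y ¬lt ¬gt with ℕ.<-cmp (A x) (A y)
  ... | tri< a< a≢ _ = inj₁ (⊑⇒≼ (ℕ.<⇒≤ a< , ℕ.≮⇒≥ (λ b< → ¬lt (a< , b<)) , λ eq → contradiction eq a≢))
  ... | tri> _ a≢ a> = inj₂ (⊑⇒≼ (ℕ.<⇒≤ a> , ℕ.≮⇒≥ (λ b> → ¬gt (a> , b>)) , λ eq → contradiction (sym eq) a≢))
  ... | tri≈ _ a≡ _ with ℕ.<-cmp (B x) (B y)
  ... | tri< b< b≢ _ = inj₂ (⊑⇒≼ (ℕ.≤-reflexive (sym a≡) , ℕ.<⇒≤ b< , λ _ eq → contradiction (sym eq) b≢))
  ... | tri> _ b≢ b> = inj₁ (⊑⇒≼ (ℕ.≤-reflexive a≡ , ℕ.<⇒≤ b> , λ _ eq → contradiction eq b≢))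
  ... | tri≈ _ b≡ _ with ℕ.≤-total (K x) (K y)
  ... | inj₁ k≤ = inj₁ (⊑⇒≼ (ℕ.≤-reflexive a≡ , ℕ.≤-reflexive (sym b≡) , λ _ _ → k≤))
  ... | inj₂ k≥ = inj₂ (⊑⇒≼ (ℕ.≤-reflexive (sym a≡) , ℕ.≤-reflexive b≡ , λ _ _ → k≥))

  incomparable : ∀ {x y} → A x < A y → B x < B y → ¬ (x ≼ y) × ¬ (y ≼ x)
  incomparable a< b< = (λ r → ℕ.<⇒≱ b< (proj₁ (proj₂ (≼⇒⊑ r)))) , (λ r → ℕ.<⇒≱ a< (proj₁ (≼⇒⊑ r)))

  infix 4 _≟_
  _≟_ : DecidableEquality (𝒟 P)
  x ≟ y with A x ℕ.≟ A y | B x ℕ.≟ B y | K x ℕ.≟ K y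
  ... | yes a | yes b | yes k = yes (elt-≡ a b k)
  ... | no ¬a | _ | _ = no λ { refl → ¬a refl }
  ... | yes _ | no ¬b | _ = no λ { refl → ¬b refl }
  ... | yes _ | yes _ | no ¬k = no λ { refl → ¬k refl }

  elements : List (𝒟 P)
  elements = List.deduplicate _≟_
    (concatMap (λ i → concatMap (λ h → map (elt i h) (allFin (n i))) (allFin (p i))) (allFin (length P)))
    where import Data.List as List

  elements-unique : Unique elements
  elements-unique = deduplicate-! _≟_ _
    where open import Data.List.Relation.Unary.Unique.DecPropositional.Properties

  elements-complete : ∀ x → x ∈ elements
  elements-complete (elt i h k) = ∈.∈-deduplicate⁺ _≟_
    (∈.∈-concatMap⁺ _ (lose (∈.∈-allFin i)
      (∈.∈-concatMap⁺ _ (lose (∈.∈-allFin h) (∈.∈-map⁺ (elt i h) (∈.∈-allFin k))))))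

  open FinitePoset _≟_ _≼_ ε _◅◅_ ≼-antisym elements elements-unique elements-complete public
    using (Chain; Family; concave; cover-family; antichains-miss)

-- Levels and the chains that follow them

q-of : (ℕ → ℕ) → ℕ → ℕ
q-of p t = p t + (t + t)

within : ∀ {x y} → x ≡ y ⊎ x ≡ suc y → y ≤ x × x ≤ suc y
within (inj₁ eq) = ℕ.≤-reflexive (sym eq) , ℕ.m≤n⇒m≤1+n (ℕ.≤-reflexive eq)
within (inj₂ eq) = ℕ.<⇒≤ (ℕ.≤-reflexive (sym eq)) , ℕ.≤-reflexive eq

module _ (P : Powers) (isP : IsPartition P) where

  open Poset P isP hiding (p; n)

  -- Level t consists of the parts q t and q t + 1, with multiplicities N t and
  -- M t; M t = 0 when q t + 1 is not a part.
  record Levels (r μ : ℕ) (p N M : ℕ → ℕ) : Set where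
    q : ℕ → ℕ
    q = q-of p
    field
      locate   : ∀ x → ∃[ t ] t < r × (S x ≡ q t × K x < N t ⊎ S x ≡ suc (q t) × K x < M t)
      lower    : ∀ {t a k} → t < r → a < q t → k < N t → ∃[ x ] S x ≡ q t × A x ≡ a × K x ≡ k
      upper    : ∀ {t a k} → t < r → a < suc (q t) → k < M t → ∃[ x ] S x ≡ suc (q t) × A x ≡ a × K x ≡ k
      positive : ∀ {t} → t < r → 0 < p t
      -- Levels with equal `p` act like levels of one spread even when they come from two. The
      -- inequality is what `narrow-flat` consumes.
      compat   : ∀ {s t} → s ≤ t → t < r → p s < p t ⊎ p s ≡ p t × μ ≤ p s * N s + suc (p s) * M t
      tight    : ∃[ i ] ∃[ j ] i ≤ j × j < r × p i ≡ p j × μ ≡ p i * N i + suc (p i) * M j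

    p-≤ : ∀ {s t} → s ≤ t → t < r → p s ≤ p t
    p-≤ le lt with compat le lt
    ... | inj₁ p< = ℕ.<⇒≤ p<
    ... | inj₂ (p≡ , _) = ℕ.≤-reflexive p≡

    q-≤ : ∀ {s t} → s ≤ t → t < r → q s ≤ q t
    q-≤ le lt = ℕ.+-mono-≤ (p-≤ le lt) (ℕ.+-mono-≤ le le)

    q-suc : ∀ {t} → suc t < r → suc (suc (q t)) ≤ q (suc t)
    q-suc {t} lt = subst (_≤ q (suc t)) eq (ℕ.+-monoˡ-≤ (suc t + suc t) (p-≤ (ℕ.n≤1+n t) lt))
      where
      eq : p t + (suc t + suc t) ≡ suc (suc (q t))
      eq = trans (ℕ.+-suc (p t) _) (cong suc (trans (cong (p t +_) (ℕ.+-suc t t)) (ℕ.+-suc (p t) _)))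

  module WeakChains (m : ℕ) (d : ℕ → ℕ) (d-mono : ∀ {b c} → b ≤ c → c < m → d b ≤ d c) where

    -- Call min(A, B) the depth. Chain c runs through the parts d c and d c + 1 at depth at least c,
    -- and through all larger parts at depth exactly c.
    On : ℕ → 𝒟 P → Set
    On c x = c ≤ A x × c ≤ B x × d c ≤ S x × (S x ≤ suc (d c) ⊎ A x ≡ c ⊎ B x ≡ c)

    on? : ∀ c → Decidable (On c)
    on? c x = (c ≤? A x) ×-dec (c ≤? B x) ×-dec (d c ≤? S x) ×-dec
              ((S x ≤? suc (d c)) ⊎-dec (A x ℕ.≟ c) ⊎-dec (B x ℕ.≟ c))
      where open import Relation.Nullary using (_×-dec_; _⊎-dec_)

    chain : Fin m → List (𝒟 P)
    chain c = filter (on? (toℕ c)) elements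

    -- If A and B both grow strictly from x to y, then S grows by at least two and y has depth above
    -- c, so y is neither in one of the two parts nor at depth exactly c.
    separated : ∀ c {x y} → On c x → On c y → ¬ (A x < A y × B x < B y)
    separated c {x} {y} (a≥ , b≥ , d≤ , _) (_ , _ , _ , inj₁ S≤) (a< , b<) =
      ℕ.<⇒≱ (s≤s (s≤s d≤)) (ℕ.≤-trans (subst₂ (λ u v → suc u ≤ v) (cong suc (A+B x)) (A+B y) two) S≤)
      where
      two : suc (suc (suc (A x + B x))) ≤ suc (A y + B y)
      two = s≤s (subst (_≤ A y + B y) (cong suc (ℕ.+-suc (A x) (B x))) (ℕ.+-mono-≤ a< b<))
    separated c (a≥ , _) (_ , _ , _ , inj₂ (inj₁ a≡)) (a< , _) =
      ℕ.<⇒≱ a< (ℕ.≤-trans (ℕ.≤-reflexive a≡) a≥)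
    separated c (_ , b≥ , _) (_ , _ , _ , inj₂ (inj₂ b≡)) (_ , b<) =
      ℕ.<⇒≱ b< (ℕ.≤-trans (ℕ.≤-reflexive b≡) b≥)

    chain-chain : ∀ c → Chain (chain c)
    chain-chain c {x} {y} x∈ y∈ = comparable x y (separated (toℕ c) {x} {y} ox oy)
        (separated (toℕ c) {y} {x} oy ox)
      where
      ox = proj₂ (∈.∈-filter⁻ (on? (toℕ c)) {xs = elements} x∈)
      oy = proj₂ (∈.∈-filter⁻ (on? (toℕ c)) {xs = elements} y∈)

    Covered : 𝒟 P → Set
    Covered x = ∃[ c ] x ∈ chain c

    covered : ∀ {c x} → c < m → On c x → Covered x
    covered {c} {x} c< o = fromℕ< c< , ∈.∈-filter⁺ (on? _) (elements-complete x)
      (subst (λ z → On z x) (sym (Fin.toℕ-fromℕ< c<)) o)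

    low : ∀ x → A x ⊓ B x < m → d (A x ⊓ B x) ≤ S x → Covered x
    low x w< d≤ = covered w<
      (ℕ.m⊓n≤m (A x) (B x) , ℕ.m⊓n≤n (A x) (B x) , d≤ , inj₂ (min (ℕ.⊓-sel (A x) (B x))))
      where
      min : A x ⊓ B x ≡ A x ⊎ A x ⊓ B x ≡ B x → A x ≡ A x ⊓ B x ⊎ B x ≡ A x ⊓ B x
      min (inj₁ eq) = inj₁ (sym eq)
      min (inj₂ eq) = inj₂ (sym eq)

    -- An element of depth w < c is missed by chain c but lies on chain w, because d w ≤ d c.
    near : ∀ x {c} → c < m → S x ≡ d c ⊎ S x ≡ suc (d c) → Covered x
    near x {c} c< S≡ with c ≤? A x ⊓ B x
    ... | yes c≤ = covered c< (ℕ.≤-trans c≤ (ℕ.m⊓n≤m (A x) (B x)) ,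
                     ℕ.≤-trans c≤ (ℕ.m⊓n≤n (A x) (B x)) , proj₁ (within S≡) , inj₁ (proj₂ (within S≡)))
    ... | no c≰ = low x (ℕ.<-trans w<c c<) (ℕ.≤-trans (d-mono (ℕ.<⇒≤ w<c) c<) (proj₁ (within S≡)))
      where
      w<c = ℕ.≰⇒> c≰

  module LevelCover {r μ : ℕ} {p N M : ℕ → ℕ} (L : Levels (suc r) μ p N M) where

    open Levels L

    full-family : Family (suc r) (length elements)
    full-family with cover-family chain chain-chain
      where open WeakChains (suc r) q q-≤
    ... | m , F , [] , _ , _ , eq = subst (Family (suc r)) (trans (sym (ℕ.+-identityʳ m)) eq) F
    ... | m , F , x ∷ _ , _ , miss , _ with locate x
    ... | t , t< , S≡ with WeakChains.near (suc r) q q-≤ x t< (Data.Sum.map proj₁ proj₁ S≡)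
      where import Data.Sum
    ... | c , x∈ = contradiction x∈ (miss (here refl) c)

    i j : ℕ
    i = proj₁ tight
    j = proj₁ (proj₂ tight)

    i≤j : i ≤ j
    i≤j = proj₁ (proj₂ (proj₂ tight))

    j≤r : j ≤ r
    j≤r = s≤s⁻¹ (proj₁ (proj₂ (proj₂ (proj₂ tight))))

    pi≡pj : p i ≡ p j
    pi≡pj = proj₁ (proj₂ (proj₂ (proj₂ (proj₂ tight))))

    μ≡ : μ ≡ p i * N i + suc (p i) * M j
    μ≡ = proj₂ (proj₂ (proj₂ (proj₂ (proj₂ tight))))

    -- Dropping one chain: below level i and above level j the chains follow
    -- the levels, in between they follow the pairs q c + 1, q (c + 1).
    d : ℕ → ℕ
    d c with c <? i | c <? j
    ... | yes _ | _ = q c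
    ... | no _ | yes _ = suc (q c)
    ... | no _ | no _ = q (suc c)

    d-before : ∀ {c} → c < i → d c ≡ q c
    d-before {c} lt with c <? i | c <? j
    ... | yes _ | _ = refl
    ... | no ≮ | _ = contradiction lt ≮

    d-between : ∀ {c} → i ≤ c → c < j → d c ≡ suc (q c)
    d-between {c} ge lt with c <? i | c <? j
    ... | yes c<i | _ = contradiction ge (ℕ.<⇒≱ c<i)
    ... | no _ | yes _ = refl
    ... | no _ | no ≮ = contradiction lt ≮

    d-after : ∀ {c} → j ≤ c → d c ≡ q (suc c)
    d-after {c} ge with c <? i | c <? j
    ... | yes c<i | _ = contradiction (ℕ.≤-trans i≤j ge) (ℕ.<⇒≱ c<i)
    ... | no _ | yes c<j = contradiction ge (ℕ.<⇒≱ c<j)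
    ... | no _ | no _ = refl

    q≤d : ∀ {c} → c < r → q c ≤ d c
    q≤d {c} lt with c <? i | c <? j
    ... | yes _ | _ = ℕ.≤-refl
    ... | no _ | yes _ = ℕ.n≤1+n _
    ... | no _ | no _ = q-≤ (ℕ.n≤1+n c) (s≤s lt)

    d≤q : ∀ {c} → c < r → d c ≤ q (suc c)
    d≤q {c} lt with c <? i | c <? j
    ... | yes _ | _ = q-≤ (ℕ.n≤1+n c) (s≤s lt)
    ... | no _ | yes _ = ℕ.≤-trans (ℕ.n≤1+n _) (q-suc (s≤s lt))
    ... | no _ | no _ = ℕ.≤-refl

    d-mono : ∀ {b c} → b ≤ c → c < r → d b ≤ d c
    d-mono {b} {c} b≤c c< with ℕ.m≤n⇒m<n∨m≡n b≤c
    ... | inj₂ refl = ℕ.≤-refl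
    ... | inj₁ b<c = ℕ.≤-trans (d≤q (ℕ.<-trans b<c c<)) (ℕ.≤-trans (q-≤ b<c (ℕ.m≤n⇒m≤1+n c<)) (q≤d c<))

    open WeakChains r d d-mono

    code : 𝒟 P → ℕ × ℕ × ℕ
    code x = S x , A x , K x

    code-injective : ∀ {x y} → code x ≡ code y → x ≡ y
    code-injective {x} {y} eq = elt-≡ eqA (cong₂ (λ s a → s ∸ suc a) (cong proj₁ eq) eqA)
        (cong (proj₂ ∘ proj₂) eq)
      where eqA = cong (proj₁ ∘ proj₂) eq

    -- For s = w + 2t the range t ≤ A < t + w consists of the positions of depth at least t in the
    -- part s.
    box : ℕ → ℕ → ℕ → ℕ → List (ℕ × ℕ × ℕ)
    box s t w k = cartesianProductWith (λ a b → s , t + a , b) (upTo w) (upTo k)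

    box-length : ∀ s t w k → length (box s t w k) ≡ w * k
    box-length s t w k = trans (length-cartesianProductWith (λ a b → s , t + a , b) (upTo w) (upTo k))
      (cong₂ _*_ (List.length-upTo w) (List.length-upTo k))

    code∈box : ∀ x {s} w k t → S x ≡ s → s ≡ w + (t + t) → t ≤ A x ⊓ B x → K x < k → code x ∈ box s t w k
    code∈box x {s} w k t refl s≡ t≤ K< =
      subst (λ a → (S x , a , K x) ∈ box (S x) t w k) (ℕ.m+[n∸m]≡n t≤A)
        (∈.∈-cartesianProductWith⁺ _ (∈.∈-upTo⁺ a<) (∈.∈-upTo⁺ K<))
      where
      t≤A = ℕ.≤-trans t≤ (ℕ.m⊓n≤m (A x) (B x))
      t≤B = ℕ.≤-trans t≤ (ℕ.m⊓n≤n (A x) (B x))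
      open ℕ.≤-Reasoning
      a< : A x ∸ t < w
      a< = ℕ.+-cancelʳ-≤ (t + t) _ _ (begin
        suc (A x ∸ t) + (t + t)   ≡⟨ cong suc (ℕ.+-assoc (A x ∸ t) t t) ⟨
        suc (A x ∸ t + t + t)     ≡⟨ cong (λ z → suc (z + t)) (ℕ.m∸n+n≡m t≤A) ⟩
        suc (A x + t)             ≤⟨ s≤s (ℕ.+-monoʳ-≤ (A x) t≤B) ⟩
        suc (A x + B x)           ≡⟨ A+B x ⟩
        S x                       ≡⟨ s≡ ⟩
        w + (t + t)               ∎)

    -- q i and q j + 1 are the only parts that belong to no pair d c, d c + 1. Chains of smaller
    -- index still catch their positions of small depth, which leaves q i - 2i = p i and q j + 1 -
    -- 2j = p j + 1 positions per copy.
    holes : List (ℕ × ℕ × ℕ)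
    holes = box (q i) i (p i) (N i) ++ box (suc (q j)) j (suc (p j)) (M j)

    holes-length : length holes ≡ μ
    holes-length = trans (List.length-++ (box (q i) i (p i) (N i)))
      (trans (cong₂ _+_ (box-length (q i) i (p i) (N i)) (box-length (suc (q j)) j (suc (p j)) (M j)))
        (trans (cong (λ z → p i * N i + suc z * M j) (sym pi≡pj)) (sym μ≡)))

    classify : ∀ x → Covered x ⊎ code x ∈ holes
    classify x with locate x
    ... | t , t< , inj₁ (S≡ , K<) with ℕ.<-cmp t i
    ...   | tri< t<i _ _ = inj₁ (near x (ℕ.≤-trans t<i (ℕ.≤-trans i≤j j≤r))
        (inj₁ (trans S≡ (sym (d-before t<i)))))
    ...   | tri≈ _ refl _ with t ≤? A x ⊓ B x
    ...     | yes t≤ = inj₂ (∈.∈-++⁺ˡ {xs = box (q i) i (p i) (N i)} (code∈box x (p i) (N i) i S≡ refl t≤ K<))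
    ...     | no t≰ = inj₁ (low x (ℕ.≤-trans w< (ℕ.≤-trans i≤j j≤r))
                        (ℕ.≤-trans (ℕ.≤-reflexive (d-before w<))
                            (ℕ.≤-trans (q-≤ (ℕ.<⇒≤ w<) t<) (ℕ.≤-reflexive (sym S≡)))))
      where w< = ℕ.≰⇒> t≰
    classify x | suc t , s≤s t< , inj₁ (S≡ , K<) | tri> _ _ (s≤s i≤t) with suc t ≤? j
    ... | yes t<j = inj₁ (near x t< (inj₂ (trans S≡ (trans q≡ (cong suc (sym (d-between i≤t t<j)))))))
      where
      -- `p` does not decrease and takes equal values at i and j, so it is constant in between;
      -- hence q t + 1 and q (t + 1) are consecutive numbers.
      p≡ : p (suc t) ≡ p t
      p≡ = ℕ.≤-antisym
        (ℕ.≤-trans (p-≤ t<j (s≤s j≤r)) (ℕ.≤-trans (ℕ.≤-reflexive (sym pi≡pj)) (p-≤ i≤t (ℕ.m≤n⇒m≤1+n t<))))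
        (p-≤ (ℕ.n≤1+n t) (s≤s t<))
      q≡ : q (suc t) ≡ suc (suc (q t))
      q≡ = trans (cong (_+ (suc t + suc t)) p≡)
        (trans (ℕ.+-suc (p t) _) (cong suc (trans (cong (p t +_) (ℕ.+-suc t t)) (ℕ.+-suc (p t) _))))
    ... | no t≮j = inj₁ (near x t< (inj₁ (trans S≡ (sym (d-after (s≤s⁻¹ (ℕ.≰⇒> t≮j)))))))
    classify x | t , t< , inj₂ (S≡ , K<) with ℕ.<-cmp t j
    ... | tri≈ _ refl _ with t ≤? A x ⊓ B x
    ...   | yes t≤ = inj₂ (∈.∈-++⁺ʳ (box (q i) i (p i) (N i)) (code∈box x (suc (p j)) (M j) j S≡ refl t≤ K<))
    ...   | no t≰ = inj₁ (low x (ℕ.≤-trans w< j≤r) (ℕ.≤-trans (d≤q (ℕ.≤-trans w< j≤r))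
                      (ℕ.≤-trans (q-≤ w< t<) (ℕ.≤-trans (ℕ.n≤1+n _) (ℕ.≤-reflexive (sym S≡))))))
      where w< = ℕ.≰⇒> t≰
    classify x | t , t< , inj₂ (S≡ , K<) | tri< t<j _ _ with t <? i
    ... | yes t<i = inj₁ (near x (ℕ.≤-trans t<j j≤r) (inj₂ (trans S≡ (cong suc (sym (d-before t<i))))))
    ... | no t≮i = inj₁ (near x (ℕ.≤-trans t<j j≤r) (inj₁ (trans S≡ (sym (d-between (ℕ.≮⇒≥ t≮i) t<j)))))
    classify x | suc t , s≤s t< , inj₂ (S≡ , K<) | tri> _ _ (s≤s j≤t) =
      inj₁ (near x t< (inj₂ (trans S≡ (cong suc (sym (d-after j≤t))))))

    partial-family : ∃[ m ] Family r m × length elements ≤ m + μ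
    partial-family =
      let m , F , U , uU , miss , eq = cover-family chain chain-chain
          bound = subst₂ _≤_ (List.length-map code U) holes-length
            (Unique-⊆⇒length-≤ {xs = map code U} {holes} (Unique.map⁺ code-injective uU)
              (λ c∈ → let x , x∈ , eq′ = ∈.∈-map⁻ code c∈ in
                [ (λ (c , q) → contradiction q (miss x∈ c)) , (λ q → subst (_∈ holes) (sym eq′) q) ]′
                    (classify x)))
      in m , F , ℕ.≤-trans (ℕ.≤-reflexive (sym eq)) (ℕ.+-monoʳ-≤ m bound)

-- Packing disjoint antichains

quotient : ∀ m {n} → 0 < n → ∃[ a ] a * n ≤ m × m < suc a * n
quotient m {n} n>0 = m / n , ℕ.≤-trans (ℕ.m≤n+m _ (m % n)) (ℕ.≤-reflexive (sym eq)) ,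
  subst (_< suc (m / n) * n) (sym eq) (ℕ.+-monoˡ-< (m / n * n) (m%n<n m n))
  where
  open import Data.Nat.DivMod using (m≡m%n+[m/n]*n; m%n<n)
  instance
    n≢0 : NonZero n
    n≢0 = >-nonZero n>0
  eq : m ≡ m % n + m / n * n
  eq = m≡m%n+[m/n]*n m n

-- The value for modulus 0 is a dummy: a copy is only chosen where the multiplicity is positive.
residue : ℕ → ℕ → ℕ
residue z zero = 0
residue z (suc n) = z % suc n

residue< : ∀ z {n} → 0 < n → residue z n < n
residue< z {suc n} _ = m%n<n z (suc n)
  where open import Data.Nat.DivMod using (m%n<n)

residue-injective : ∀ {y z} n → y ≤ z → z < n + y → residue y n ≡ residue z n → y ≡ z
residue-injective zero y≤z z<y _ = contradiction y≤z (ℕ.<⇒≱ z<y)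
residue-injective {y} {z} n@(suc _) y≤z z<n+y eq = trans y≡
    (trans (cong₂ (λ r k → r + k * n) eq quot≡) (sym z≡))
  where
  open import Data.Nat.DivMod using (m≡m%n+[m/n]*n; /-monoˡ-≤)
  y≡ = m≡m%n+[m/n]*n y n
  z≡ = m≡m%n+[m/n]*n z n
  open ℕ.≤-Reasoning
  quot≡ : y / n ≡ z / n
  quot≡ with ℕ.m≤n⇒m<n∨m≡n (/-monoˡ-≤ n y≤z)
  ... | inj₂ q≡ = q≡
  ... | inj₁ q< = contradiction (begin
    n + y                       ≡⟨ cong (n +_) (trans y≡ (ℕ.+-comm (y % n) _)) ⟩
    n + (y / n * n + y % n)     ≡⟨ ℕ.+-assoc n _ _ ⟨
    suc (y / n) * n + y % n     ≤⟨ ℕ.+-monoˡ-≤ (y % n) (ℕ.*-monoˡ-≤ n q<) ⟩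
    z / n * n + y % n           ≡⟨ cong (z / n * n +_) eq ⟩
    z / n * n + z % n           ≡⟨ trans z≡ (ℕ.+-comm (z % n) _) ⟨
    z                           ∎) (ℕ.<⇒≱ z<n+y)

-- Left unreduced, so that comparing slopes and scaling by them stays within products of natural
-- numbers.
record Fraction : Set where
  constructor frac
  field
    num den : ℕ
    den>0   : 0 < den
open Fraction

infix 4 _≤ᶠ_
_≤ᶠ_ : Fraction → Fraction → Set
f ≤ᶠ g = num f * den g ≤ num g * den f

_⊔ᶠ_ : Fraction → Fraction → Fraction
f ⊔ᶠ g with num f * den g ≤? num g * den f
... | yes _ = g
... | no _ = f

-- The maximum is one of its two arguments. In this way the upper bounds of `Flat` survive it, while
-- `Steep` and `Narrow` survive as lower bounds.
⊔ᶠ-induction : (Q : Fraction → Set) → ∀ f g → Q f → Q g → Q (f ⊔ᶠ g)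
⊔ᶠ-induction Q f g qf qg with num f * den g ≤? num g * den f
... | yes _ = qg
... | no _ = qf

f≤f⊔g : ∀ f g → f ≤ᶠ f ⊔ᶠ g
f≤f⊔g f g with num f * den g ≤? num g * den f
... | yes le = le
... | no _ = ℕ.≤-refl

g≤f⊔g : ∀ f g → g ≤ᶠ f ⊔ᶠ g
g≤f⊔g f g with num f * den g ≤? num g * den f
... | yes _ = ℕ.≤-refl
... | no ≰ = ℕ.<⇒≤ (ℕ.≰⇒> ≰)

exchange-factors : ∀ x y z → x * y * z ≡ x * z * y
exchange-factors x y z = trans (ℕ.*-assoc x y z) (trans (cong (x *_) (ℕ.*-comm y z)) (sym (ℕ.*-assoc x z y)))

cancel-≤ : ∀ {k x y} → 0 < k → x * k ≤ y * k → x ≤ y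
cancel-≤ {k} {x} {y} k>0 = ℕ.*-cancelʳ-≤ x y k ⦃ >-nonZero k>0 ⦄

module Packing (P : Powers) (isP : IsPartition P)
  {r μ : ℕ} {p N M : ℕ → ℕ} (L : Levels P isP (suc r) μ p N M) (μ>0 : 0 < μ) where

  open Poset P isP hiding (p; n)
  open Levels L

  -- With slope κ at level t, the z-th antichain has there the element with
  -- A = t + ⌊z/κ⌋ and B = t + ⌈(μ − z)/κ⌉ − 1.  Slopes non-increasing in t make
  -- A and B increase; Steep and the first half of Flat put A + B + 1 among the
  -- parts of the level; Narrow and the second half of Flat leave enough copies.
  Steep Narrow : ℕ → Fraction → Set
  Steep t f = μ * den f ≤ suc (p t) * num f
  Narrow t f = μ * den f ≤ p t * num f + M t * den f

  Flat : ℕ → Fraction → Set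
  Flat t f = p t * num f ≤ μ * den f × suc (p t) * num f ≤ (μ + N t) * den f

  scale-num : ∀ c f g → f ≤ᶠ g → c * num f * den g ≤ c * num g * den f
  scale-num c f g le = subst₂ _≤_ (sym (ℕ.*-assoc c _ _)) (sym (ℕ.*-assoc c _ _)) (ℕ.*-monoʳ-≤ c le)

  Steep-up : ∀ t f g → f ≤ᶠ g → Steep t f → Steep t g
  Steep-up t f g le s = cancel-≤ (den>0 f) (begin
    μ * den g * den f            ≡⟨ exchange-factors μ _ _ ⟩
    μ * den f * den g            ≤⟨ ℕ.*-monoˡ-≤ (den g) s ⟩
    suc (p t) * num f * den g    ≤⟨ scale-num (suc (p t)) f g le ⟩
    suc (p t) * num g * den f    ∎)
    where open ℕ.≤-Reasoning

  Narrow-up : ∀ t f g → f ≤ᶠ g → Narrow t f → Narrow t g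
  Narrow-up t f g le s = cancel-≤ (den>0 f) (begin
    μ * den g * den f                              ≡⟨ exchange-factors μ _ _ ⟩
    μ * den f * den g                              ≤⟨ ℕ.*-monoˡ-≤ (den g) s ⟩
    (p t * num f + M t * den f) * den g            ≡⟨ ℕ.*-distribʳ-+ (den g) (p t * num f) _ ⟩
    p t * num f * den g + M t * den f * den g      ≤⟨ ℕ.+-mono-≤ (scale-num (p t) f g le)
        (ℕ.≤-reflexive (exchange-factors (M t) _ _)) ⟩
    p t * num g * den f + M t * den g * den f      ≡⟨ ℕ.*-distribʳ-+ (den f) (p t * num g) _ ⟨
    (p t * num g + M t * den g) * den f            ∎)
    where open ℕ.≤-Reasoning

  -- This is the second half of `Flat` at s for the slope (μ - M t) / p t. If p s < p t it holds
  -- factor by factor; if p s = p t, multiplying out reduces it to the inequality of `compat`.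
  narrow-flat : ∀ {s t} → s ≤ t → t < suc r → suc (p s) * (μ ∸ M t) ≤ (μ + N s) * p t
  narrow-flat {s} {t} s≤t t< with compat s≤t t<
  ... | inj₁ p< = subst (suc (p s) * (μ ∸ M t) ≤_) (ℕ.*-comm (p t) _)
        (ℕ.*-mono-≤ p< (ℕ.≤-trans (ℕ.m∸n≤m μ (M t)) (ℕ.m≤m+n μ (N s))))
  ... | inj₂ (p≡ , μ≤) with ℕ.≤-total (M t) μ
  ... | inj₂ μ≤M = subst (_≤ (μ + N s) * p t) (sym (trans (cong (suc (p s) *_) (ℕ.m≤n⇒m∸n≡0 μ≤M))
      (ℕ.*-zeroʳ (suc (p s))))) z≤n
  ... | inj₁ M≤μ = subst (λ z → suc (p s) * e′ ≤ (μ + N s) * z) p≡ (begin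
    e′ + p s * e′                             ≤⟨ ℕ.+-monoˡ-≤ (p s * e′) e′≤ ⟩
    p s * N s + p s * M t + p s * e′          ≡⟨ ℕ.+-assoc (p s * N s) _ _ ⟩
    p s * N s + (p s * M t + p s * e′)        ≡⟨ cong (p s * N s +_) (ℕ.*-distribˡ-+ (p s) (M t) e′) ⟨
    p s * N s + p s * (M t + e′)              ≡⟨ cong (λ z → p s * N s + p s * z) (ℕ.m+[n∸m]≡n M≤μ) ⟩
    p s * N s + p s * μ                       ≡⟨ ℕ.+-comm (p s * N s) _ ⟩
    p s * μ + p s * N s                       ≡⟨ ℕ.*-distribˡ-+ (p s) μ (N s) ⟨
    p s * (μ + N s)                           ≡⟨ ℕ.*-comm (p s) _ ⟩
    (μ + N s) * p s                           ∎)
    where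
    open ℕ.≤-Reasoning
    e′ = μ ∸ M t
    e′≤ : e′ ≤ p s * N s + p s * M t
    e′≤ = ℕ.+-cancelˡ-≤ (M t) _ _ (begin
      M t + e′                                ≡⟨ ℕ.m+[n∸m]≡n M≤μ ⟩
      μ                                       ≤⟨ μ≤ ⟩
      p s * N s + (M t + p s * M t)           ≡⟨ ℕ.+-assoc (p s * N s) _ _ ⟨
      p s * N s + M t + p s * M t             ≡⟨ cong (_+ p s * M t) (ℕ.+-comm (p s * N s) _) ⟩
      M t + p s * N s + p s * M t             ≡⟨ ℕ.+-assoc (M t) _ _ ⟩
      M t + (p s * N s + p s * M t)           ∎)

  -- The least slope that is Steep and Narrow at t.
  least : ∀ t → t < suc r → Fraction
  least t t< = frac μ (suc (p t)) z<s ⊔ᶠ frac (μ ∸ M t) (p t) (positive t<)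

  least-Steep : ∀ t t< → Steep t (least t t<)
  least-Steep t t< = Steep-up t f (least t t<) (f≤f⊔g f _) (ℕ.≤-reflexive (ℕ.*-comm μ _))
    where f = frac μ (suc (p t)) z<s

  least-Narrow : ∀ t t< → Narrow t (least t t<)
  least-Narrow t t< = Narrow-up t g (least t t<) (g≤f⊔g (frac μ (suc (p t)) z<s) g) (begin
    μ * p t                          ≤⟨ ℕ.*-monoˡ-≤ (p t) (ℕ.m≤n+m∸n μ (M t)) ⟩
    (M t + (μ ∸ M t)) * p t          ≡⟨ ℕ.*-distribʳ-+ (p t) (M t) _ ⟩
    M t * p t + (μ ∸ M t) * p t      ≡⟨ ℕ.+-comm (M t * p t) _ ⟩
    (μ ∸ M t) * p t + M t * p t      ≡⟨ cong (_+ M t * p t) (ℕ.*-comm _ (p t)) ⟩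
    p t * (μ ∸ M t) + M t * p t      ∎)
    where
    open ℕ.≤-Reasoning
    g = frac (μ ∸ M t) (p t) (positive t<)

  least-Flat : ∀ {s t} t< → s ≤ t → Flat s (least t t<)
  least-Flat {s} {t} t< s≤t = ⊔ᶠ-induction (Flat s) (frac μ (suc (p t)) z<s)
      (frac (μ ∸ M t) (p t) (positive t<))
    (subst (p s * μ ≤_) (ℕ.*-comm _ μ) (ℕ.*-monoˡ-≤ μ (ℕ.m≤n⇒m≤1+n ps≤pt)) ,
     subst (suc (p s) * μ ≤_) (ℕ.*-comm _ (μ + N s)) (ℕ.*-mono-≤ (s≤s ps≤pt) (ℕ.m≤m+n μ (N s))))
    (subst (p s * (μ ∸ M t) ≤_) (ℕ.*-comm _ μ) (ℕ.*-mono-≤ ps≤pt (ℕ.m∸n≤m μ (M t))) ,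
     narrow-flat s≤t t<)
    where ps≤pt = p-≤ s≤t t<

  -- The maximum of `least` over the levels from t on, which every non-increasing choice of slopes
  -- has to dominate. The recursion runs on k, the distance to the last level.
  slope′ : ∀ k t → k + t ≡ r → Fraction
  slope′ zero t eq = least t (s≤s (ℕ.≤-reflexive eq))
  slope′ (suc k) t eq = least t (s≤s (subst (t ≤_) eq (ℕ.m≤n+m t (suc k)))) ⊔ᶠ slope′ k (suc t)
      (trans (ℕ.+-suc k t) eq)

  slope-Steep : ∀ k t eq → Steep t (slope′ k t eq)
  slope-Steep zero t eq = least-Steep t _
  slope-Steep (suc k) t eq = Steep-up t (least t _) (slope′ (suc k) t eq)
      (f≤f⊔g (least t _) (slope′ k (suc t) _)) (least-Steep t _)

  slope-Narrow : ∀ k t eq → Narrow t (slope′ k t eq)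
  slope-Narrow zero t eq = least-Narrow t _
  slope-Narrow (suc k) t eq = Narrow-up t (least t _) (slope′ (suc k) t eq)
      (f≤f⊔g (least t _) (slope′ k (suc t) _)) (least-Narrow t _)

  -- The slope at t is `least` of some level t′ ≥ t, and `least-Flat` covers every s ≤ t′.
  slope-Flat : ∀ k t eq {s} → s ≤ t → Flat s (slope′ k t eq)
  slope-Flat zero t eq s≤t = least-Flat _ s≤t
  slope-Flat (suc k) t eq {s} s≤t =
    ⊔ᶠ-induction (Flat s) (least t _) (slope′ k (suc t) _) (least-Flat _ s≤t)
        (slope-Flat k (suc t) _ (ℕ.m≤n⇒m≤1+n s≤t))

  Level : Set
  Level = ∃[ k ] ∃[ t ] k + t ≡ r

  level : Level → ℕ
  level l = proj₁ (proj₂ l)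

  level< : ∀ l → level l < suc r
  level< (k , t , eq) = s≤s (subst (t ≤_) eq (ℕ.m≤n+m t k))

  slope : Level → Fraction
  slope (k , t , eq) = slope′ k t eq

  slope-num>0 : ∀ l → 0 < num (slope l)
  slope-num>0 l@(k , t , eq) with num (slope l) | slope-Steep k t eq
  ... | suc _ | _ = z<s
  ... | zero | s = contradiction (subst (μ * den (slope l) ≤_) (ℕ.*-zeroʳ (suc (p t))) s)
                     (ℕ.<⇒≱ (ℕ.*-mono-< μ>0 (den>0 (slope l))))

  record Point (z : ℕ) (l : Level) : Set where
    f = slope l
    t = level l
    field
      a b : ℕ
      a≤ : a * num f ≤ z * den f
      <a : z * den f < suc a * num f
      b< : b * num f < (μ ∸ z) * den f
      ≤b : (μ ∸ z) * den f ≤ suc b * num f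

  point : ∀ {z} → z < μ → ∀ l → Point z l
  point {z} z<μ l =
    let f = slope l
        a , a≤ , <a = quotient (z * den f) (slope-num>0 l)
        -- For positive m, ⌈m / n⌉ - 1 is the quotient of m - 1 by n.
        b , b≤ , <b = quotient (pred ((μ ∸ z) * den f)) (slope-num>0 l)
        eq = ℕ.suc-pred ((μ ∸ z) * den f) ⦃ >-nonZero (ℕ.*-mono-< (ℕ.m<n⇒0<n∸m z<μ) (den>0 f)) ⦄
    in record { a = a ; b = b ; a≤ = a≤ ; <a = <a
              ; b< = subst (b * num f <_) eq (s≤s b≤)
              ; ≤b = subst (_≤ suc b * num f) eq <b }

  module PointProperties {z : ℕ} (z<μ : z < μ) {l : Level} (x : Point z l) where
    open Point x

    whole : z * den f + (μ ∸ z) * den f ≡ μ * den f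
    whole = trans (sym (ℕ.*-distribʳ-+ (den f) z (μ ∸ z))) (cong (_* den f) (ℕ.m+[n∸m]≡n (ℕ.<⇒≤ z<μ)))

    -- With κ = num / den, the bounds on a and b add up to (a + b) κ < μ < (a + b + 2) κ. Comparing
    -- this with the slope conditions determines a + b up to one and shows that the part in question
    -- has a copy.
    sum-< : (a + b) * num f < μ * den f
    sum-< = subst₂ _<_ (sym (ℕ.*-distribʳ-+ (num f) a b)) whole (ℕ.+-mono-≤-< a≤ b<)

    sum-> : μ * den f < (2 + (a + b)) * num f
    sum-> = subst₂ _<_ whole
      (trans (sym (ℕ.*-distribʳ-+ (num f) (suc a) (suc b))) (cong (_* num f) (cong suc (ℕ.+-suc a b))))
      (ℕ.+-mono-<-≤ <a ≤b)

    flat = slope-Flat (proj₁ l) t (proj₂ (proj₂ l)) ℕ.≤-refl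

    a+b≤p : a + b ≤ p t
    a+b≤p = s≤s⁻¹ (ℕ.*-cancelʳ-< (num f) _ _ (ℕ.<-≤-trans sum-< (slope-Steep (proj₁ l) t (proj₂ (proj₂ l)))))

    p≤a+b+1 : p t ≤ suc (a + b)
    p≤a+b+1 = s≤s⁻¹ (ℕ.*-cancelʳ-< (num f) _ _ (ℕ.≤-<-trans (proj₁ flat) sum->))

    N>0 : suc (a + b) ≡ p t → 0 < N t
    N>0 eq = ℕ.+-cancelˡ-< μ 0 (N t) (subst (_< μ + N t) (sym (ℕ.+-identityʳ μ))
      (ℕ.*-cancelʳ-< (den f) _ _ (ℕ.<-≤-trans sum-> (subst (λ w → suc w * num f ≤ (μ + N t) * den f)
          (sym eq) (proj₂ flat)))))

    M>0 : a + b ≡ p t → 0 < M t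
    M>0 eq with M t | slope-Narrow (proj₁ l) t (proj₂ (proj₂ l))
    ... | suc _ | _ = z<s
    ... | zero | s = contradiction (ℕ.≤-trans s (ℕ.≤-reflexive (ℕ.+-identityʳ _)))
                       (ℕ.<⇒≱ (subst (λ w → w * num f < μ * den f) eq sum-<))

  open Point

  a-mono : ∀ {z l l′} (x : Point z l) (y : Point z l′) → slope l′ ≤ᶠ slope l → a x ≤ a y
  a-mono {z} {l} {l′} x y le = s≤s⁻¹ (ℕ.*-cancelʳ-< (num g) _ _ (ℕ.≤-<-trans (cancel-≤ (den>0 h) (begin
    a x * num g * den h      ≤⟨ scale-num (a x) g h le ⟩
    a x * num h * den g      ≤⟨ ℕ.*-monoˡ-≤ (den g) (a≤ x) ⟩
    z * den h * den g        ≡⟨ exchange-factors z _ _ ⟩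
    z * den g * den h        ∎)) (<a y)))
    where
    open ℕ.≤-Reasoning
    h = slope l
    g = slope l′

  b-mono : ∀ {z l l′} (x : Point z l) (y : Point z l′) → slope l′ ≤ᶠ slope l → b x ≤ b y
  b-mono {z} {l} {l′} x y le = s≤s⁻¹ (ℕ.*-cancelʳ-< (num g) _ _
      (ℕ.<-≤-trans (ℕ.*-cancelʳ-< (den h) _ _ (begin-strict
    b x * num g * den h          ≤⟨ scale-num (b x) g h le ⟩
    b x * num h * den g          <⟨ ℕ.*-monoˡ-< (den g) ⦃ >-nonZero (den>0 g) ⦄ (b< x) ⟩
    (μ ∸ z) * den h * den g      ≡⟨ exchange-factors (μ ∸ z) _ _ ⟩
    (μ ∸ z) * den g * den h      ∎)) (≤b y)))
    where
    open ℕ.≤-Reasoning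
    h = slope l
    g = slope l′

  -- Adding z < (a + 1) κ and μ - y ≤ (b + 1) κ gives μ + (z - y) < (p + 1) κ, which is at most μ +
  -- N by `Flat`.
  same-cell-N : ∀ {y z l} → y ≤ z → z < μ → (u : Point y l) (v : Point z l) →
    a u ≡ a v → b u ≡ b v → suc (a u + b u) ≡ p (level l) → z < N (level l) + y
  same-cell-N {y} {z} {l} y≤z z<μ u v a≡ b≡ eq = ℕ.+-cancelʳ-< (μ ∸ y) _ _
    (subst (z + (μ ∸ y) <_) (sym (trans (ℕ.+-assoc Nt y _)
        (trans (cong (Nt +_) (ℕ.m+[n∸m]≡n (ℕ.≤-trans y≤z (ℕ.<⇒≤ z<μ)))) (ℕ.+-comm Nt μ))))
      (ℕ.*-cancelʳ-< (den f′) _ _ (begin-strict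
        (z + (μ ∸ y)) * den f′                      ≡⟨ ℕ.*-distribʳ-+ (den f′) z _ ⟩
        z * den f′ + (μ ∸ y) * den f′               <⟨ ℕ.+-mono-<-≤ (<a v) (≤b u) ⟩
        suc (a v) * num f′ + suc (b u) * num f′     ≡⟨ ℕ.*-distribʳ-+ (num f′) (suc (a v)) _ ⟨
        (suc (a v) + suc (b u)) * num f′            ≡⟨ cong (_* num f′)
            (trans (cong suc (ℕ.+-suc (a v) (b u))) (cong suc
            (trans (cong (λ w → suc (w + b u)) (sym a≡)) eq))) ⟩
        suc (p (level l)) * num f′                  ≤⟨ proj₂
            (slope-Flat (proj₁ l) (level l) (proj₂ (proj₂ l)) ℕ.≤-refl) ⟩
        (μ + Nt) * den f′                           ∎)))
    where
    open ℕ.≤-Reasoning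
    f′ = slope l
    Nt = N (level l)

  -- Adding a κ ≤ y and b κ < μ - z gives p κ < μ - (z - y), whereas μ ≤ p κ + M by `Narrow`.
  same-cell-M : ∀ {y z l} → y ≤ z → z < μ → (u : Point y l) (v : Point z l) →
    a u ≡ a v → b u ≡ b v → a u + b u ≡ p (level l) → z < M (level l) + y
  same-cell-M {y} {z} {l} y≤z z<μ u v a≡ b≡ eq = ℕ.+-cancelʳ-< (μ ∸ z) _ _
    (subst (_< Mt + y + (μ ∸ z)) (sym (ℕ.m+[n∸m]≡n (ℕ.<⇒≤ z<μ)))
      (ℕ.*-cancelʳ-< (den f′) _ _ (begin-strict
        μ * den f′                                          ≤⟨ slope-Narrow (proj₁ l) (level l)
            (proj₂ (proj₂ l)) ⟩
        p (level l) * num f′ + Mt * den f′                  ≡⟨ cong (λ w → w * num f′ + Mt * den f′)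
            (trans (sym eq) (cong (a u +_) b≡)) ⟩
        (a u + b v) * num f′ + Mt * den f′                  ≡⟨ cong (_+ Mt * den f′)
            (ℕ.*-distribʳ-+ (num f′) (a u) _) ⟩
        a u * num f′ + b v * num f′ + Mt * den f′           <⟨ ℕ.+-monoˡ-< (Mt * den f′)
            (ℕ.+-mono-≤-< (a≤ u) (b< v)) ⟩
        y * den f′ + (μ ∸ z) * den f′ + Mt * den f′         ≡⟨ cong (_+ Mt * den f′)
            (ℕ.*-distribʳ-+ (den f′) y _) ⟨
        (y + (μ ∸ z)) * den f′ + Mt * den f′                ≡⟨ ℕ.*-distribʳ-+ (den f′) (y + (μ ∸ z)) Mt ⟨
        (y + (μ ∸ z) + Mt) * den f′                         ≡⟨ cong (_* den f′)
            (trans (ℕ.+-comm _ Mt) (sym (ℕ.+-assoc Mt y _))) ⟩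
        (Mt + y + (μ ∸ z)) * den f′                         ∎)))
    where
    open ℕ.≤-Reasoning
    f′ = slope l
    Mt = M (level l)

  -- Antichains that share a position have indices in a window no longer than the multiplicity, so
  -- the index modulo the multiplicity assigns them different copies.
  Site : ∀ {z l} → Point z l → Set
  Site {z} {l} u = ∃[ x ] A x ≡ level l + a u × B x ≡ level l + b u ×
    (S x ≡ q (level l) × K x ≡ residue z (N (level l)) ⊎ S x ≡ suc (q (level l)) × K x ≡ residue z
        (M (level l)))

  interleave : ∀ t x y → t + x + (t + y) ≡ x + y + (t + t)
  interleave t x y = begin
    t + x + (t + y)   ≡⟨ cong (_+ (t + y)) (ℕ.+-comm t x) ⟩
    x + t + (t + y)   ≡⟨ ℕ.+-assoc x t _ ⟩
    x + (t + (t + y)) ≡⟨ cong (x +_) (ℕ.+-assoc t t y) ⟨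
    x + (t + t + y)   ≡⟨ cong (x +_) (ℕ.+-comm (t + t) y) ⟩
    x + (y + (t + t)) ≡⟨ ℕ.+-assoc x y _ ⟨
    x + y + (t + t)   ∎
    where open ≡-Reasoning

  site : ∀ {z l} → z < μ → (u : Point z l) → Site u
  site {z} {l} z<μ u with ℕ.m≤n⇒m<n∨m≡n a+b≤p
    where open PointProperties z<μ u
  ... | inj₂ eq =
    let x , S≡ , A≡ , K≡ = upper {t′} {t′ + a u} {residue z (M t′)} (level< l) (s≤s A≤)
            (residue< z (PointProperties.M>0 z<μ u eq))
    in x , A≡ , cancel x A≡ (trans S≡ (cong suc (sym size))) , inj₂ (S≡ , K≡)
    where
    t′ = level l
    size : t′ + a u + (t′ + b u) ≡ q t′
    size = trans (interleave t′ _ _) (cong (_+ (t′ + t′)) eq)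
    A≤ : t′ + a u ≤ q t′
    A≤ = subst (t′ + a u ≤_) size (ℕ.m≤m+n _ _)
    cancel : ∀ x → A x ≡ t′ + a u → S x ≡ suc (t′ + a u + (t′ + b u)) → B x ≡ t′ + b u
    cancel x A≡ S≡ = ℕ.+-cancelˡ-≡ (t′ + a u) _ _
      (ℕ.suc-injective (trans (cong (λ w → suc (w + B x)) (sym A≡)) (trans (A+B x) S≡)))
  ... | inj₁ lt =
    let x , S≡ , A≡ , K≡ = lower {t′} {t′ + a u} {residue z (N t′)} (level< l) A<
            (residue< z (PointProperties.N>0 z<μ u eq))
    in x , A≡ , cancel x A≡ (trans S≡ (sym size)) , inj₁ (S≡ , K≡)
    where
    t′ = level l
    eq : suc (a u + b u) ≡ p t′
    eq = ℕ.≤-antisym lt (PointProperties.p≤a+b+1 z<μ u)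
    size : suc (t′ + a u + (t′ + b u)) ≡ q t′
    size = trans (cong suc (interleave t′ _ _)) (cong (_+ (t′ + t′)) eq)
    A< : t′ + a u < q t′
    A< = subst (t′ + a u <_) size (s≤s (ℕ.m≤m+n _ _))
    cancel : ∀ x → A x ≡ t′ + a u → S x ≡ suc (t′ + a u + (t′ + b u)) → B x ≡ t′ + b u
    cancel x A≡ S≡ = ℕ.+-cancelˡ-≡ (t′ + a u) _ _
      (ℕ.suc-injective (trans (cong (λ w → suc (w + B x)) (sym A≡)) (trans (A+B x) S≡)))

  slope-mono : ∀ k {t} eq j {s} eq′ → s ≤ t → slope′ k t eq ≤ᶠ slope′ j s eq′
  slope-mono k {t} eq j {s} eq′ s≤t with ℕ.m≤n⇒m<n∨m≡n s≤t
  ... | inj₂ refl with ℕ.+-cancelʳ-≡ s k j (trans eq (sym eq′))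
  ... | refl with ℕ.≡-irrelevant eq eq′
  ... | refl = ℕ.≤-refl
  slope-mono k {t} eq zero {s} eq′ s≤t | inj₁ s<t =
    contradiction (subst (t ≤_) (trans eq (sym eq′)) (ℕ.m≤n+m t k)) (ℕ.<⇒≱ s<t)
  slope-mono k {t} eq (suc j) {s} eq′ s≤t | inj₁ s<t =
    ≤ᶠ-trans (slope′ k t eq) (slope′ j (suc s) _) (slope′ (suc j) s eq′)
      (slope-mono k eq j (trans (ℕ.+-suc j s) eq′) s<t) (g≤f⊔g (least s _) (slope′ j (suc s) _))
    where
    ≤ᶠ-trans : ∀ f g h → f ≤ᶠ g → g ≤ᶠ h → f ≤ᶠ h
    ≤ᶠ-trans f g h fg gh = cancel-≤ (den>0 g) (begin
      num f * den h * den g   ≡⟨ exchange-factors (num f) _ _ ⟩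
      num f * den g * den h   ≤⟨ ℕ.*-monoˡ-≤ (den h) fg ⟩
      num g * den f * den h   ≡⟨ exchange-factors (num g) _ _ ⟩
      num g * den h * den f   ≤⟨ ℕ.*-monoˡ-≤ (den f) gh ⟩
      num h * den g * den f   ≡⟨ exchange-factors (num h) _ _ ⟩
      num h * den f * den g   ∎)
      where open ℕ.≤-Reasoning

  value-gap : ∀ {s t} → s < t → t < suc r → suc (q s) < q t
  value-gap s<t t< = ℕ.≤-trans (q-suc (ℕ.≤-<-trans s<t t<)) (q-≤ s<t t<)

  level-unique : ∀ {x s t} → s < suc r → t < suc r →
    S x ≡ q s ⊎ S x ≡ suc (q s) → S x ≡ q t ⊎ S x ≡ suc (q t) → s ≡ t
  level-unique {x} {s} {t} s<r t<r Ss St with ℕ.<-cmp s t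
  ... | tri≈ _ eq _ = eq
  ... | tri< s<t _ _ = contradiction (ℕ.≤-trans (proj₁ (within St)) (proj₂ (within Ss)))
      (ℕ.<⇒≱ (value-gap s<t t<r))
  ... | tri> _ _ t<s = contradiction (ℕ.≤-trans (proj₁ (within Ss)) (proj₂ (within St)))
      (ℕ.<⇒≱ (value-gap t<s s<r))

  sites-≤ : ∀ {y z l} (y≤z : y ≤ z) (z<μ : z < μ) (u : Point y l) (v : Point z l)
    (g : Site u) (h : Site v) → proj₁ g ≡ proj₁ h → y ≡ z
  sites-≤ {y} {z} {l} y≤z z<μ u v (x , A≡ , B≡ , c) (.x , A≡′ , B≡′ , c′) refl = case c c′
    where
    t′ = level l
    a≡ : a u ≡ a v
    a≡ = ℕ.+-cancelˡ-≡ t′ _ _ (trans (sym A≡) A≡′)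
    b≡ : b u ≡ b v
    b≡ = ℕ.+-cancelˡ-≡ t′ _ _ (trans (sym B≡) B≡′)
    size : S x ≡ suc (a u + b u) + (t′ + t′)
    size = trans (sym (A+B x)) (cong suc (trans (cong₂ _+_ A≡ B≡) (interleave t′ _ _)))

    case : S x ≡ q t′ × K x ≡ residue y (N t′) ⊎ S x ≡ suc (q t′) × K x ≡ residue y (M t′) →
           S x ≡ q t′ × K x ≡ residue z (N t′) ⊎ S x ≡ suc (q t′) × K x ≡ residue z (M t′) → y ≡ z
    case (inj₁ (S≡ , K≡)) (inj₁ (_ , K≡′)) = residue-injective (N t′) y≤z
      (same-cell-N y≤z z<μ u v a≡ b≡ (ℕ.+-cancelʳ-≡ (t′ + t′) _ _ (trans (sym size) S≡))) (trans (sym K≡) K≡′)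
    case (inj₂ (S≡ , K≡)) (inj₂ (_ , K≡′)) = residue-injective (M t′) y≤z
      (same-cell-M y≤z z<μ u v a≡ b≡ (ℕ.+-cancelʳ-≡ (t′ + t′) _ _ (ℕ.suc-injective (trans (sym size) S≡))))
          (trans (sym K≡) K≡′)
    case (inj₁ (S≡ , _)) (inj₂ (S≡′ , _)) = contradiction (trans (sym S≡′) S≡) ℕ.1+n≢n
    case (inj₂ (S≡ , _)) (inj₁ (S≡′ , _)) = contradiction (trans (sym S≡) S≡′) ℕ.1+n≢n

  to-level : Fin (suc r) → Level
  to-level t = r ∸ toℕ t , toℕ t , ℕ.m∸n+n≡m (Fin.toℕ≤pred[n] t)

  the-point : (z : Fin μ) (t : Fin (suc r)) → Point (toℕ z) (to-level t)
  the-point z t = point (Fin.toℕ<n z) (to-level t)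

  the-site : (z : Fin μ) (t : Fin (suc r)) → Site (the-point z t)
  the-site z t = site (Fin.toℕ<n z) (the-point z t)

  the-element : Fin μ → Fin (suc r) → 𝒟 P
  the-element z t = proj₁ (the-site z t)

  -- The summand t in A and B grows strictly, so it is enough that a and b do not decrease as the
  -- slope falls.
  antichain : ∀ z {s t} → toℕ s < toℕ t →
    ¬ (the-element z s ≼ the-element z t) × ¬ (the-element z t ≼ the-element z s)
  antichain z {s} {t} s<t = incomparable
    (subst₂ _<_ (sym (proj₁ (proj₂ (the-site z s)))) (sym (proj₁ (proj₂ (the-site z t))))
      (ℕ.+-mono-<-≤ s<t (a-mono (the-point z s) (the-point z t) le)))
    (subst₂ _<_ (sym (proj₁ (proj₂ (proj₂ (the-site z s))))) (sym (proj₁ (proj₂ (proj₂ (the-site z t)))))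
      (ℕ.+-mono-<-≤ s<t (b-mono (the-point z s) (the-point z t) le)))
    where
    le : slope (to-level t) ≤ᶠ slope (to-level s)
    le = slope-mono (r ∸ toℕ t) _ (r ∸ toℕ s) _ (ℕ.<⇒≤ s<t)

  disjoint : ∀ {y z s t} → the-element y s ≡ the-element z t → y ≡ z
  disjoint {y} {z} {s} {t} eq = same-level s≡t eq
    where
    value : ∀ w u → S (the-element w u) ≡ q (toℕ u) ⊎ S (the-element w u) ≡ suc (q (toℕ u))
    value w u = Data.Sum.map proj₁ proj₁ (proj₂ (proj₂ (proj₂ (the-site w u))))
      where import Data.Sum

    s≡t : s ≡ t
    s≡t = Fin.toℕ-injective (level-unique {the-element z t} (Fin.toℕ<n s) (Fin.toℕ<n t)
      (subst (λ x → S x ≡ q (toℕ s) ⊎ S x ≡ suc (q (toℕ s))) eq (value y s)) (value z t))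

    same-level : ∀ {s t} → s ≡ t → the-element y s ≡ the-element z t → y ≡ z
    same-level {s} refl eq = Fin.toℕ-injective ([ forth , back ]′ (ℕ.≤-total (toℕ y) (toℕ z)))
      where
      forth : toℕ y ≤ toℕ z → toℕ y ≡ toℕ z
      forth y≤z = sites-≤ y≤z (Fin.toℕ<n z) (the-point y s) (the-point z s) (the-site y s) (the-site z s) eq
      back : toℕ z ≤ toℕ y → toℕ y ≡ toℕ z
      back z≤y = sym (sites-≤ z≤y (Fin.toℕ<n y) (the-point z s) (the-point y s) (the-site z s)
          (the-site y s) (sym eq))

  family-misses : ∀ {m} → Family r m → m + μ ≤ length elements
  family-misses = antichains-miss μ the-element antichain
    (λ {y} {z} {s} {t} → disjoint {y} {z} {s} {t})

-- Spreads as sequences of pairs of parts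

half : {A : Set} → List A → ℕ
half [] = 0
half (_ ∷ []) = 1
half (_ ∷ _ ∷ Q) = suc (half Q)

first : Powers → ℕ
first [] = 0
first (a ∷ _) = part a

Consecutive : Powers → Set
Consecutive Q = Linked (λ a b → part b ≡ suc (part a)) Q × All (λ a → 1 ≤ mult a) Q

double-suc : ∀ t → suc t + suc t ≡ suc (suc (t + t))
double-suc t = cong suc (ℕ.+-suc t t)

double-+ : ∀ x h → x + (suc h + suc h) ≡ suc (suc x) + (h + h)
double-+ x h = trans (cong (x +_) (double-suc h)) (trans (ℕ.+-suc x _) (cong suc (ℕ.+-suc x _)))

multAt-odd : ∀ a b Q s → multAt (a ∷ b ∷ Q) (suc (suc s + suc s)) ≡ multAt Q (suc (s + s))
multAt-odd a b Q s rewrite ℕ.+-suc s s = refl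

multAt-even : ∀ a b Q s → multAt (a ∷ b ∷ Q) (suc (suc (suc s + suc s))) ≡ multAt Q (suc (suc (s + s)))
multAt-even a b Q s rewrite ℕ.+-suc s s = refl

-- The number r of a spread

parts-first : ∀ {Q} → Consecutive Q → ∀ {i} → i < half Q → first Q + (i + i) ∈ parts Q
parts-first {a ∷ Q} (_ , 1≤m ∷ _) {zero} _ = ∈.∈-++⁺ˡ (subst (_∈ replicate (mult a) (part a))
    (sym (ℕ.+-identityʳ _)) (first-copy 1≤m))
  where
  first-copy : ∀ {m x} → 1 ≤ m → x ∈ replicate m x
  first-copy {suc m} _ = here refl
parts-first {a ∷ []} _ {suc i} (s≤s ())
parts-first {a ∷ b ∷ c ∷ Q} (b≡ ∷ c≡ ∷ l , _ ∷ _ ∷ ms) {suc i} (s≤s i<) =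
  ∈.∈-++⁺ʳ (replicate (mult a) (part a)) (∈.∈-++⁺ʳ (replicate (mult b) (part b))
    (subst (_∈ parts (c ∷ Q)) eq (parts-first {c ∷ Q} (l , ms) i<)))
  where
  eq : part c + (i + i) ≡ part a + (suc i + suc i)
  eq = trans (cong (_+ (i + i)) (trans c≡ (cong suc b≡))) (sym (double-+ (part a) i))

parts-pair : ∀ {a b x} → part b ≡ suc (part a) → x ∈ parts (a ∷ b ∷ []) → part a ≤ x × x ≤ suc (part a)
parts-pair {a} {b} b≡ x∈ with ∈.∈-++⁻ (replicate (mult a) (part a)) x∈
... | inj₁ x∈a with All.lookup (All.replicate⁺ {P = _≡ part a} (mult a) refl) x∈a
...   | refl = ℕ.≤-refl , ℕ.n≤1+n _
parts-pair {a} {b} b≡ x∈ | inj₂ x∈b with ∈.∈-++⁻ (replicate (mult b) (part b)) x∈b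
... | inj₁ x∈b′ with All.lookup (All.replicate⁺ {P = _≡ part b} (mult b) refl) x∈b′
...   | refl = subst (λ z → part a ≤ z × z ≤ suc (part a)) (sym b≡) (ℕ.n≤1+n _ , ℕ.≤-refl)

-- Pairs of consecutive parts are almost rectangular. Conversely, every second part, starting with
-- the smallest, needs a block of its own, since two of these differ by at least two.
Isr-half : ∀ Q → Consecutive Q → Isr Q (half Q)
Isr-half Q con = (blocks Q con) , λ { r (Qs , ar , p , refl) → minimal Qs ar p }
  where
  blocks : ∀ Q → Consecutive Q → Σ[ Qs ∈ List (List ℕ) ]
    All AlmostRectangular Qs × concat Qs ↭ parts Q × length Qs ≡ half Q
  blocks [] _ = [] , [] , ↭-refl , refl
  blocks (a ∷ []) _ = parts (a ∷ []) ∷ [] , single ∷ [] ,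
    Perm.↭-reflexive (List.++-identityʳ _) , refl
    where
    value : ∀ {x} → x ∈ parts (a ∷ []) → x ≡ part a
    value {x} x∈ = All.lookup (All.replicate⁺ {P = _≡ part a} (mult a) refl)
      (subst (x ∈_) (List.++-identityʳ _) x∈)
    single : AlmostRectangular (parts (a ∷ []))
    single x∈ y∈ = subst₂ (λ x y → x ≤ y + 1) (sym (value x∈)) (sym (value y∈)) (ℕ.m≤m+n _ 1)
  blocks (a ∷ b ∷ Q) (l , _ ∷ _ ∷ ms)
    with blocks Q (tail² l , ms)
    where
    tail² : ∀ {a b Q} → Linked (λ a b → part b ≡ suc (part a)) (a ∷ b ∷ Q) → Linked
        (λ a b → part b ≡ suc (part a)) Q
    tail² (_ ∷ [-]) = []
    tail² (_ ∷ _ ∷ l) = l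
  ... | Qs , ar , p , eq = parts (a ∷ b ∷ []) ∷ Qs , pair ∷ ar , ↭-trans (↭.++⁺ˡ _ p)
      (Perm.↭-reflexive regroup) , cong suc eq
    where
    pair : AlmostRectangular (parts (a ∷ b ∷ []))
    pair {x} {y} x∈ y∈ = ℕ.≤-trans (proj₂ (parts-pair {a} {b} (Linked.head l) x∈))
      (subst (suc (part a) ≤_) (ℕ.+-comm 1 y) (s≤s (proj₁ (parts-pair {a} {b} (Linked.head l) y∈))))
    A′ = replicate (mult a) (part a)
    B′ = replicate (mult b) (part b)
    regroup : (A′ ++ B′ ++ []) ++ parts Q ≡ A′ ++ B′ ++ parts Q
    regroup = trans (List.++-assoc A′ (B′ ++ []) _) (cong (A′ ++_) (List.++-assoc B′ [] _))

  minimal : ∀ Qs → All AlmostRectangular Qs → concat Qs ↭ parts Q → half Q ≤ length Qs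
  minimal Qs ar p = Fin.injective⇒≤ {f = proj₁ ∘ block} injective
    where
    find-block : ∀ {x} Qs → x ∈ concat Qs → ∃[ j ] x ∈ lookup Qs j
    find-block (xs ∷ Qs) x∈ with ∈.∈-++⁻ xs x∈
    ... | inj₁ q = fzero , q
    ... | inj₂ q = let j , q′ = find-block Qs q in fsuc j , q′

    block : (i : Fin (half Q)) → ∃[ j ] first Q + (toℕ i + toℕ i) ∈ lookup Qs j
    block i = find-block Qs (↭.∈-resp-↭ (↭-sym p) (parts-first con (Fin.toℕ<n i)))

    apart : ∀ i i′ → toℕ i < toℕ i′ → proj₁ (block i) ≢ proj₁ (block i′)
    apart i i′ lt eq = ℕ.<⇒≱ far (All.lookup ar (∈.∈-lookup (proj₁ (block i′)))
        (proj₂ (block i′)) (subst (λ j → _ ∈ lookup Qs j) eq (proj₂ (block i))))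
      where
      open ℕ.≤-Reasoning
      far : first Q + (toℕ i + toℕ i) + 1 < first Q + (toℕ i′ + toℕ i′)
      far = begin-strict
        first Q + (toℕ i + toℕ i) + 1       <⟨ ℕ.≤-reflexive
            (trans (cong suc (ℕ.+-comm _ 1)) (sym (double-+ (first Q) (toℕ i)))) ⟩
        first Q + (suc (toℕ i) + suc (toℕ i)) ≤⟨ ℕ.+-monoʳ-≤ (first Q) (ℕ.+-mono-≤ lt lt) ⟩
        first Q + (toℕ i′ + toℕ i′)         ∎

    injective : ∀ {i i′} → proj₁ (block i) ≡ proj₁ (block i′) → i ≡ i′
    injective {i} {i′} eq with ℕ.<-cmp (toℕ i) (toℕ i′)
    ... | tri< lt _ _ = contradiction eq (apart i i′ lt)
    ... | tri≈ _ i≡ _ = Fin.toℕ-injective i≡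
    ... | tri> _ _ gt = contradiction (sym eq) (apart i′ i gt)

-- Levels of a partition

record Level : Set where
  constructor lv
  field
    base low high : ℕ
open Level

at : List Level → ℕ → Level
at [] _ = lv 0 0 0
at (l ∷ L) zero = l
at (l ∷ L) (suc s) = at L s

at-++ˡ : ∀ L {L′ s} → s < length L → at (L ++ L′) s ≡ at L s
at-++ˡ (l ∷ L) {s = zero} _ = refl
at-++ˡ (l ∷ L) {s = suc s} (s≤s lt) = at-++ˡ L lt

at-++ʳ : ∀ L {L′} s → at (L ++ L′) (length L + s) ≡ at L′ s
at-++ʳ [] s = refl
at-++ʳ (l ∷ L) s = at-++ʳ L s

-- An unpaired last part gets `high` 0, in accordance with the convention that n is 0 at s + 1.
pairs : ℕ → Powers → List Level
pairs c [] = []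
pairs c (a ∷ []) = lv c (mult a) 0 ∷ []
pairs c (a ∷ b ∷ Q) = lv c (mult a) (mult b) ∷ pairs c Q

pairs-length : ∀ c Q → length (pairs c Q) ≡ half Q
pairs-length c [] = refl
pairs-length c (a ∷ []) = refl
pairs-length c (a ∷ b ∷ Q) = cong suc (pairs-length c Q)

pairs-base : ∀ c Q {s} → s < half Q → base (at (pairs c Q) s) ≡ c
pairs-base c (a ∷ []) {zero} _ = refl
pairs-base c (a ∷ []) {suc s} (s≤s ())
pairs-base c (a ∷ b ∷ Q) {zero} _ = refl
pairs-base c (a ∷ b ∷ Q) {suc s} (s≤s lt) = pairs-base c Q lt

pairs-low : ∀ c Q s → low (at (pairs c Q) s) ≡ multAt Q (suc (s + s))
pairs-low c [] s = refl
pairs-low c (a ∷ []) zero = refl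
pairs-low c (a ∷ []) (suc s) = refl
pairs-low c (a ∷ b ∷ Q) zero = refl
pairs-low c (a ∷ b ∷ Q) (suc s) = trans (pairs-low c Q s) (sym (multAt-odd a b Q s))

pairs-high : ∀ c Q s → high (at (pairs c Q) s) ≡ multAt Q (suc (suc (s + s)))
pairs-high c [] s = refl
pairs-high c (a ∷ []) zero = refl
pairs-high c (a ∷ []) (suc s) = refl
pairs-high c (a ∷ b ∷ Q) zero = refl
pairs-high c (a ∷ b ∷ Q) (suc s) = trans (pairs-high c Q s) (sym (multAt-even a b Q s))

-- With t the number of levels of the preceding spreads, this is the smallest part of the spread
-- shifted down by 2t, the factor p in its contribution to μ.
offset : ℕ → Powers → ℕ
offset t Q = first Q ∸ (t + t)

levels : ℕ → List Powers → List Level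
levels t [] = []
levels t (Q ∷ Ps) = pairs (offset t Q) Q ++ levels (t + half Q) Ps

-- A left inverse of `levels`, by which membership in the partition can be read off level by level;
-- an upper part of multiplicity 0 is omitted.
expand : ℕ → List Level → Powers
expand t [] = []
expand t (lv c n zero ∷ L) = ((c + (t + t)) ^^ n) ∷ expand (suc t) L
expand t (lv c n m@(suc _) ∷ L) = ((c + (t + t)) ^^ n) ∷ (suc (c + (t + t)) ^^ m) ∷ expand (suc t) L

Fits : ℕ → Level → Power → Set
Fits u l a = part a ≡ base l + (u + u) × mult a ≡ low l ⊎
             part a ≡ suc (base l + (u + u)) × mult a ≡ high l

expand-∈ : ∀ t L {a} → a ∈ expand t L → ∃[ s ] s < length L × Fits (t + s) (at L s) a
expand-∈ t (lv c n m ∷ L) {a} = inspect m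
  where
  later : ∀ m → a ∈ expand (suc t) L → ∃[ s ] s < suc (length L) × Fits (t + s) (at (lv c n m ∷ L) s) a
  later m a∈ = let s , s< , h = expand-∈ (suc t) L a∈ in
    suc s , s≤s s< , subst (λ u → Fits u (at L s) a) (sym (ℕ.+-suc t s)) h

  inspect : ∀ m → a ∈ expand t (lv c n m ∷ L) → ∃[ s ] s < suc (length L) × Fits (t + s) (at (lv c n m ∷ L) s) a
  inspect zero (here refl) = 0 , z<s , inj₁ (cong (λ u → c + (u + u)) (sym (ℕ.+-identityʳ t)) , refl)
  inspect zero (there a∈) = later zero a∈
  inspect (suc m) (here refl) = 0 , z<s , inj₁ (cong (λ u → c + (u + u)) (sym (ℕ.+-identityʳ t)) , refl)
  inspect (suc m) (there (here refl)) = 0 , z<s , inj₂ (cong (λ u → suc (c + (u + u)))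
      (sym (ℕ.+-identityʳ t)) , refl)
  inspect (suc m) (there (there a∈)) = later (suc m) a∈

∈-expand-low : ∀ t L {s} → s < length L →
  ((base (at L s) + ((t + s) + (t + s))) ^^ low (at L s)) ∈ expand t L
∈-expand-low t (lv c n zero ∷ L) {zero} _ rewrite ℕ.+-identityʳ t = here refl
∈-expand-low t (lv c n (suc m) ∷ L) {zero} _ rewrite ℕ.+-identityʳ t = here refl
∈-expand-low t (lv c n zero ∷ L) {suc s} (s≤s s<) rewrite ℕ.+-suc t s = there (∈-expand-low (suc t) L s<)
∈-expand-low t (lv c n (suc m) ∷ L) {suc s} (s≤s s<) rewrite ℕ.+-suc t s = there
    (there (∈-expand-low (suc t) L s<))

∈-expand-high : ∀ t L {s} → s < length L → 0 < high (at L s) →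
  (suc (base (at L s) + ((t + s) + (t + s))) ^^ high (at L s)) ∈ expand t L
∈-expand-high t (lv c n (suc m) ∷ L) {zero} _ _ rewrite ℕ.+-identityʳ t = there (here refl)
∈-expand-high t (lv c n zero ∷ L) {suc s} (s≤s s<) m> rewrite ℕ.+-suc t s = there
    (∈-expand-high (suc t) L s< m>)
∈-expand-high t (lv c n (suc m) ∷ L) {suc s} (s≤s s<) m> rewrite ℕ.+-suc t s = there
    (there (∈-expand-high (suc t) L s< m>))

expand-pairs : ∀ t c Q L → Consecutive Q → (∀ {a Q′} → Q ≡ a ∷ Q′ → part a ≡ c + (t + t)) →
  expand t (pairs c Q ++ L) ≡ Q ++ expand (t + half Q) L
expand-pairs t c [] L _ _ rewrite ℕ.+-identityʳ t = refl
expand-pairs t c (a ∷ []) L _ start rewrite ℕ.+-comm t 1 =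
  cong (_∷ expand (suc t) L) (cong (_^^ mult a) (sym (start refl)))
expand-pairs t c (a ∷ (pb ^^ suc m) ∷ Q) L (b≡ ∷ l , _ ∷ _ ∷ ms) start
  rewrite ℕ.+-suc t (half Q) =
  cong₂ _∷_ (cong (_^^ mult a) (sym (start refl)))
    (cong₂ _∷_ (cong (_^^ suc m) (trans (cong suc (sym (start refl))) (sym b≡)))
      (expand-pairs (suc t) c Q L (tail l , ms) (next l)))
  where
  tail : ∀ {b Q} → Linked (λ a b → part b ≡ suc (part a)) (b ∷ Q) → Linked (λ a b → part b ≡ suc (part a)) Q
  tail [-] = []
  tail (_ ∷ l) = l
  next : ∀ {Q} → Linked (λ a b → part b ≡ suc (part a)) ((pb ^^ suc m) ∷ Q) →
         ∀ {d Q′} → Q ≡ d ∷ Q′ → part d ≡ c + (suc t + suc t)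
  next (d≡ ∷ _) refl = trans d≡ (trans (cong suc (trans b≡ (cong suc (start refl))))
    (sym (trans (cong (c +_) (double-suc t)) (trans (ℕ.+-suc c _) (cong suc (ℕ.+-suc c _))))))

-- The invariant μ

-- Levels are counted from 0, so the indices 2i - 1 and 2j of the definition of μ become 2i + 1 and
-- 2j + 2.
value : ℕ → Powers → ℕ → ℕ → ℕ
value c Q i j = c * multAt Q (suc (i + i)) + suc c * multAt Q (suc (suc (j + j)))

Bound : ℕ → Powers → ℕ → Set
Bound c Q m = ∀ {i j} → i ≤ j → j < half Q → m ≤ value c Q i j

Attain : ℕ → Powers → ℕ → Set
Attain c Q m = ∃[ i ] ∃[ j ] i ≤ j × j < half Q × m ≡ value c Q i j

argmin : ∀ (f : ℕ → ℕ) n → ∃[ i ] i ≤ n × (∀ {j} → j ≤ n → f i ≤ f j)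
argmin f zero = 0 , z≤n , λ { z≤n → ℕ.≤-refl }
argmin f (suc n) with argmin f n
... | i , i≤n , min with f i ≤? f (suc n)
... | yes le = i , ℕ.m≤n⇒m≤1+n i≤n , λ j≤ → [ (λ j< → min (s≤s⁻¹ j<)) , (λ { refl → le }) ]′ (ℕ.m≤n⇒m<n∨m≡n j≤)
... | no ≰ = suc n , ℕ.≤-refl , λ j≤ → [ (λ j< → ℕ.≤-trans (ℕ.<⇒≤ (ℕ.≰⇒> ≰)) (min (s≤s⁻¹ j<))) ,
    (λ { refl → ℕ.≤-refl }) ]′ (ℕ.m≤n⇒m<n∨m≡n j≤)

spread-minimum : ∀ c Q → 0 < half Q → ∃[ m ] Bound c Q m × Attain c Q m
spread-minimum c Q h>0 with half Q in eq | h>0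
... | suc h | _ =
  let best = λ j → argmin (λ i → value c Q i j) j
      j , j≤ , min = argmin (λ j → value c Q (proj₁ (best j)) j) h
      i , i≤ , _ = best j
  in value c Q i j ,
     (λ {i′} {j′} i′≤ j′< → ℕ.≤-trans (min (s≤s⁻¹ j′<)) (proj₂ (proj₂ (best j′)) i′≤)) ,
     i , j , i≤ , s≤s j≤ , refl

Bounds : ℕ → ℕ → List Powers → Set
Bounds m t [] = ⊤
Bounds m t (Q ∷ Ps) = Bound (offset t Q) Q m × Bounds m (t + half Q) Ps

Attains : ℕ → ℕ → List Powers → Set
Attains m t [] = ⊥
Attains m t (Q ∷ Ps) = Attain (offset t Q) Q m ⊎ Attains m (t + half Q) Ps

Bounds-≤ : ∀ {m m′} t Ps → m ≤ m′ → Bounds m′ t Ps → Bounds m t Ps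
Bounds-≤ t [] le _ = tt
Bounds-≤ t (Q ∷ Ps) le (b , bs) = (λ i≤ j< → ℕ.≤-trans le (b i≤ j<)) , Bounds-≤ _ Ps le bs

-- Equality of offsets happens only when the last level of Q has a single part.
Separated : ℕ → Powers → List Powers → Set
Separated t Q [] = ⊤
Separated t Q (R ∷ _) = offset t Q < offset (t + half Q) R ⊎
                        offset t Q ≤ offset (t + half Q) R × multAt Q (half Q + half Q) ≡ 0

-- `t + t < first Q` keeps `offset` from truncating and makes the base of every level positive.
Valid : ℕ → List Powers → Set
Valid t [] = ⊤
Valid t (Q ∷ Ps) = Consecutive Q × 0 < half Q × t + t < first Q × Separated t Q Ps × Valid (t + half Q) Ps

minimum : ∀ t Q Ps → Valid t (Q ∷ Ps) → ∃[ m ] Bounds m t (Q ∷ Ps) × Attains m t (Q ∷ Ps)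
minimum t Q [] (_ , h>0 , _) =
  let m , b , a = spread-minimum (offset t Q) Q h>0 in m , (b , tt) , inj₁ a
minimum t Q (R ∷ Ps) (_ , h>0 , _ , _ , v)
  with spread-minimum (offset t Q) Q h>0 | minimum (t + half Q) R Ps v
... | m , b , a | m′ , b′ , a′ with ℕ.≤-total m m′
... | inj₁ le = m , (b , Bounds-≤ (t + half Q) (R ∷ Ps) le b′) , inj₁ a
... | inj₂ ge = m′ , ((λ i≤ j< → ℕ.≤-trans ge (b i≤ j<)) , b′) , inj₂ a′

split-index : ∀ h s → s < h ⊎ ∃[ s′ ] s ≡ h + s′
split-index h s with s <? h
... | yes lt = inj₁ lt
... | no ≮ = inj₂ (s ∸ h , sym (ℕ.m+[n∸m]≡n (ℕ.≮⇒≥ ≮)))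

module _ (t : ℕ) (Q : Powers) (Ps : List Powers) where

  here-level : ∀ {s} → s < half Q → at (levels t (Q ∷ Ps)) s ≡ at (pairs (offset t Q) Q) s
  here-level lt = at-++ˡ (pairs (offset t Q) Q) (subst (_ <_) (sym (pairs-length (offset t Q) Q)) lt)

  there-level : ∀ s → at (levels t (Q ∷ Ps)) (half Q + s) ≡ at (levels (t + half Q) Ps) s
  there-level s = subst (λ h → at (levels t (Q ∷ Ps)) (h + s) ≡ at (levels (t + half Q) Ps) s)
    (pairs-length (offset t Q) Q) (at-++ʳ (pairs (offset t Q) Q) s)

  levels-length : length (levels t (Q ∷ Ps)) ≡ half Q + length (levels (t + half Q) Ps)
  levels-length = trans (List.length-++ (pairs (offset t Q) Q))
      (cong (_+ length (levels (t + half Q) Ps)) (pairs-length (offset t Q) Q))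

  there-< : ∀ {s} → half Q + s < length (levels t (Q ∷ Ps)) → s < length (levels (t + half Q) Ps)
  there-< lt = ℕ.+-cancelˡ-< (half Q) _ _ (subst (_ <_) levels-length lt)

  here-base : ∀ {s} → s < half Q → base (at (levels t (Q ∷ Ps)) s) ≡ offset t Q
  here-base lt = trans (cong base (here-level lt)) (pairs-base (offset t Q) Q lt)

  here-low : ∀ {s} → s < half Q → low (at (levels t (Q ∷ Ps)) s) ≡ multAt Q (suc (s + s))
  here-low lt = trans (cong low (here-level lt)) (pairs-low (offset t Q) Q _)

  here-high : ∀ {s} → s < half Q → high (at (levels t (Q ∷ Ps)) s) ≡ multAt Q (suc (suc (s + s)))
  here-high lt = trans (cong high (here-level lt)) (pairs-high (offset t Q) Q _)

levels-positive : ∀ t Ps → Valid t Ps → ∀ {s} → s < length (levels t Ps) → 0 < base (at (levels t Ps) s)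
levels-positive t (Q ∷ Ps) (_ , _ , lt , _ , v) {s} s< with split-index (half Q) s
... | inj₁ s<h = subst (0 <_) (sym (here-base t Q Ps s<h)) (ℕ.m<n⇒0<n∸m lt)
... | inj₂ (s′ , refl) = subst (λ l → 0 < base l) (sym (there-level t Q Ps s′))
                           (levels-positive _ Ps v (there-< t Q Ps s<))

levels-base-≥ : ∀ t Q Ps → Valid t (Q ∷ Ps) → ∀ {s} → s < length (levels t (Q ∷ Ps)) →
  offset t Q ≤ base (at (levels t (Q ∷ Ps)) s)
levels-base-≥ t Q Ps v {s} s< with split-index (half Q) s
... | inj₁ s<h = ℕ.≤-reflexive (sym (here-base t Q Ps s<h))
levels-base-≥ t Q [] v s< | inj₂ (s′ , refl) with () ← there-< t Q [] s<
levels-base-≥ t Q (R ∷ Ps) (_ , _ , _ , sep , v) s< | inj₂ (s′ , refl) =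
  ℕ.≤-trans ([ ℕ.<⇒≤ , proj₁ ]′ sep)
    (subst (λ l → offset (t + half Q) R ≤ base l) (sym (there-level t Q (R ∷ Ps) s′))
      (levels-base-≥ _ R Ps v (there-< t Q (R ∷ Ps) s<)))

Compatible : ℕ → Level → Level → Set
Compatible m l l′ = base l < base l′ ⊎ base l ≡ base l′ × m ≤ base l * low l + suc (base l) * high l′

-- Within a spread the inequality is part of the definition of μ. Between two spreads the bases can
-- only agree if the earlier spread ends with an unpaired part, and then `low-bound` applies.
levels-compatible : ∀ {m} t Ps → Valid t Ps → Bounds m t Ps → ∀ {s s′} → s ≤ s′ → s′ < length (levels t Ps) →
  Compatible m (at (levels t Ps) s) (at (levels t Ps) s′)
levels-compatible {m} t (Q ∷ Ps) v (b , bs) {s} {s′} s≤ s′< with split-index (half Q) s | split-index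
    (half Q) s′
... | inj₁ s<h | inj₁ s′<h = inj₂ (trans (here-base t Q Ps s<h) (sym (here-base t Q Ps s′<h)) ,
      subst (m ≤_) (sym eq) (b s≤ s′<h))
  where
  eq : _ ≡ value (offset t Q) Q s s′
  eq = cong₂ _+_ (cong₂ _*_ (here-base t Q Ps s<h) (here-low t Q Ps s<h))
                 (cong₂ (λ x y → suc x * y) (here-base t Q Ps s<h) (here-high t Q Ps s′<h))
... | inj₂ (u , refl) | inj₁ s′<h = contradiction (ℕ.≤-trans (ℕ.m≤m+n (half Q) u) s≤) (ℕ.<⇒≱ s′<h)
... | inj₂ (u , refl) | inj₂ (u′ , refl) =
  subst₂ (Compatible m) (sym (there-level t Q Ps u)) (sym (there-level t Q Ps u′))
    (levels-compatible _ Ps (proj₂ (proj₂ (proj₂ (proj₂ v)))) bs (ℕ.+-cancelˡ-≤ (half Q) _ _ s≤)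
        (there-< t Q Ps s′<))
levels-compatible {m} t (Q ∷ []) v b s≤ s′< | inj₁ s<h | inj₂ (u′ , refl) with () ← there-< t Q [] s′<
levels-compatible {m} t (Q ∷ R ∷ Ps) (_ , h>0 , _ , sep , v) (b , bs) {s} s≤ s′< | inj₁ s<h | inj₂ (u′ , refl) =
  subst (Compatible m (at L s)) (sym (there-level t Q (R ∷ Ps) u′)) (cases sep)
  where
  L = levels t (Q ∷ R ∷ Ps)
  l′ = at (levels (t + half Q) (R ∷ Ps)) u′
  next : offset (t + half Q) R ≤ base l′
  next = levels-base-≥ _ R Ps v (there-< t Q (R ∷ Ps) s′<)
  base≡ = here-base t Q (R ∷ Ps) s<h

  -- Choosing j as the last level of `Q` makes the second term of the bound vanish; what remains
  -- does not involve the second level and so serves for levels of any later spread.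
  low-bound : multAt Q (half Q + half Q) ≡ 0 → m ≤ base (at L s) * low (at L s)
  low-bound eq = subst (m ≤_) simplify (b (s≤s⁻¹ (subst (s <_) (sym h≡) s<h)) (ℕ.≤-reflexive h≡))
    where
    h = pred (half Q)
    h≡ : suc h ≡ half Q
    h≡ = ℕ.suc-pred (half Q) ⦃ >-nonZero h>0 ⦄
    last≡0 : multAt Q (suc (suc (h + h))) ≡ 0
    last≡0 = trans (cong (multAt Q) (trans (sym (double-suc h)) (cong₂ _+_ h≡ h≡))) eq
    open ≡-Reasoning
    c = offset t Q
    simplify : value c Q s h ≡ base (at L s) * low (at L s)
    simplify = begin
      c * multAt Q (suc (s + s)) + suc c * multAt Q (suc (suc (h + h)))
        ≡⟨ cong (λ z → c * multAt Q (suc (s + s)) + suc c * z) last≡0 ⟩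
      c * multAt Q (suc (s + s)) + suc c * 0
        ≡⟨ cong (c * multAt Q (suc (s + s)) +_) (ℕ.*-zeroʳ (suc c)) ⟩
      c * multAt Q (suc (s + s)) + 0
        ≡⟨ ℕ.+-identityʳ _ ⟩
      c * multAt Q (suc (s + s))
        ≡⟨ cong₂ _*_ base≡ (here-low t Q (R ∷ Ps) s<h) ⟨
      base (at L s) * low (at L s) ∎

  cases : Separated t Q (R ∷ Ps) → Compatible m (at L s) l′
  cases (inj₁ lt) = inj₁ (ℕ.<-≤-trans (subst (_< offset (t + half Q) R) (sym base≡) lt) next)
  cases (inj₂ (le , eq)) with ℕ.m≤n⇒m<n∨m≡n (ℕ.≤-trans (ℕ.≤-trans (ℕ.≤-reflexive base≡) le) next)
  ... | inj₁ lt = inj₁ lt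
  ... | inj₂ same = inj₂ (same , ℕ.≤-trans (low-bound eq) (ℕ.m≤m+n _ _))

levels-tight : ∀ {m} t Ps → Attains m t Ps → let L = levels t Ps in
  ∃[ i ] ∃[ j ] i ≤ j × j < length L × base (at L i) ≡ base (at L j) ×
    m ≡ base (at L i) * low (at L i) + suc (base (at L i)) * high (at L j)
levels-tight t (Q ∷ Ps) (inj₁ (i , j , i≤j , j< , refl)) =
  i , j , i≤j , subst (j <_) (sym (levels-length t Q Ps)) (ℕ.≤-trans j< (ℕ.m≤m+n _ _)) ,
  trans (here-base t Q Ps i<) (sym (here-base t Q Ps j<)) ,
  sym (cong₂ _+_ (cong₂ _*_ (here-base t Q Ps i<) (here-low t Q Ps i<))
                 (cong₂ (λ x y → suc x * y) (here-base t Q Ps i<) (here-high t Q Ps j<)))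
  where i< = ℕ.≤-<-trans i≤j j<
levels-tight {m} t (Q ∷ Ps) (inj₂ a) =
  let i , j , i≤j , j< , base≡ , m≡ = levels-tight _ Ps a
      T = λ l l′ → base l ≡ base l′ × m ≡ base l * low l + suc (base l) * high l′
  in half Q + i , half Q + j , ℕ.+-monoʳ-≤ (half Q) i≤j ,
     subst (half Q + j <_) (sym (levels-length t Q Ps)) (ℕ.+-monoʳ-< (half Q) j<) ,
     subst₂ T (sym (there-level t Q Ps i)) (sym (there-level t Q Ps j)) (base≡ , m≡)

expand-levels : ∀ t Ps → Valid t Ps → expand t (levels t Ps) ≡ concat Ps
expand-levels t [] _ = refl
expand-levels t (Q ∷ Ps) (con , _ , lt , _ , v) =
  trans (expand-pairs t (offset t Q) Q _ con (λ { refl → sym (ℕ.m∸n+n≡m (ℕ.<⇒≤ lt)) }))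
        (cong (Q ++_) (expand-levels _ Ps v))

consecutive-⊖ : ∀ c Q → c ≤ first Q → Consecutive Q → Consecutive (Q ⊖ c)
consecutive-⊖ c Q c≤ (l , ms) = go Q c≤ l , All.map⁺ ms
  where
  go : ∀ Q → c ≤ first Q → Linked (λ a b → part b ≡ suc (part a)) Q → Linked
      (λ a b → part b ≡ suc (part a)) (Q ⊖ c)
  go [] _ [] = []
  go (a ∷ []) _ [-] = [-]
  go (a ∷ b ∷ Q) c≤ (b≡ ∷ l) = trans (cong (_∸ c) b≡) (ℕ.+-∸-assoc 1 c≤) ∷
    go (b ∷ Q) (subst (c ≤_) (sym b≡) (ℕ.m≤n⇒m≤1+n c≤)) l

half-⊖ : ∀ c Q → half (Q ⊖ c) ≡ half Q
half-⊖ c [] = refl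
half-⊖ c (a ∷ []) = refl
half-⊖ c (a ∷ b ∷ Q) = cong suc (half-⊖ c Q)

multAt-⊖ : ∀ c Q i → multAt (Q ⊖ c) i ≡ multAt Q i
multAt-⊖ c [] i = refl
multAt-⊖ c (a ∷ Q) zero = refl
multAt-⊖ c (a ∷ Q) (suc zero) = refl
multAt-⊖ c (a ∷ Q) (suc (suc i)) = multAt-⊖ c Q (suc i)

first-⊖ : ∀ c Q → first (Q ⊖ c) ≡ first Q ∸ c
first-⊖ c [] = sym (ℕ.0∸n≡0 c)
first-⊖ c (a ∷ Q) = refl

value-⊖ : ∀ c Q i j → value (first (Q ⊖ c)) (Q ⊖ c) i j ≡ value (first Q ∸ c) Q i j
value-⊖ c Q i j = cong₂ _+_ (cong₂ _*_ (first-⊖ c Q) (multAt-⊖ c Q _))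
                            (cong₂ (λ x y → suc x * y) (first-⊖ c Q) (multAt-⊖ c Q _))

value-paper : ∀ p Q i j → p * multAt Q (2 * suc i ∸ 1) + (p + 1) * multAt Q (2 * suc j) ≡ value p Q i j
value-paper p Q i j rewrite ℕ.+-identityʳ i | ℕ.+-identityʳ j | ℕ.+-suc i i | ℕ.+-suc j j | ℕ.+-comm p 1 = refl

Isμ-spread⁺ : ∀ Q {m} → Consecutive Q → 0 < half Q → Bound (first Q) Q m → Attain (first Q) Q m → Isμ-spread Q m
Isμ-spread⁺ Q@(a ∷ _) {m} con _ b (i , j , i≤j , j< , m≡) =
  half Q , Isr-half Q con ,
  (suc i , suc j , s≤s z≤n , s≤s i≤j , j< , trans m≡ (sym (value-paper (part a) Q i j))) ,
  λ { x (suc i , suc j , _ , s≤s i≤j , j< , refl) →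
      subst (m ≤_) (sym (value-paper (part a) Q i j)) (b i≤j j<) }

Isμ-spread⁻ : ∀ Q {x} → Consecutive Q → Isμ-spread Q x → Attain (first Q) Q x
Isμ-spread⁻ Q@(a ∷ _) con (r , isr , (suc i , suc j , _ , s≤s i≤j , j< , x≡) , _) =
  -- The r of the hypothesis is only known to be minimal; comparing it with `half Q` gives r ≤
  -- `half Q`.
  i , j , i≤j , ℕ.≤-trans j< (proj₂ isr _ (proj₁ (Isr-half Q con))) , trans x≡ (value-paper (part a) Q i j)

module _ (c : ℕ) (Q : Powers) (con : Consecutive Q) (c≤ : c ≤ first Q) where

  Isμ-spread-⊖⁺ : ∀ {m} → 0 < half Q → Bound (first Q ∸ c) Q m → Attain (first Q ∸ c) Q m → Isμ-spread (Q ⊖ c) m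
  Isμ-spread-⊖⁺ {m} h>0 b (i , j , i≤j , j< , m≡) = Isμ-spread⁺ (Q ⊖ c) (consecutive-⊖ c Q c≤ con)
    (subst (0 <_) (sym (half-⊖ c Q)) h>0)
    (λ {i} {j} i≤j j< → subst (m ≤_) (sym (value-⊖ c Q i j)) (b i≤j (subst (j <_) (half-⊖ c Q) j<)))
    (i , j , i≤j , subst (j <_) (sym (half-⊖ c Q)) j< , trans m≡ (sym (value-⊖ c Q i j)))

  Isμ-spread-⊖⁻ : ∀ {m x} → Bound (first Q ∸ c) Q m → Isμ-spread (Q ⊖ c) x → m ≤ x
  Isμ-spread-⊖⁻ {m} b isμ =
    let i , j , i≤j , j< , x≡ = Isμ-spread⁻ (Q ⊖ c) (consecutive-⊖ c Q c≤ con) isμ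
    in subst (m ≤_) (sym (trans x≡ (value-⊖ c Q i j))) (b i≤j (subst (j <_) (half-⊖ c Q) j<))

-- For t = 0 this unfolds to the shift in `Isμ` with `map half Ps` as the list of ranks; general t
-- is needed for the induction over the spreads.
shift : ℕ → (Ps : List Powers) → Fin (length Ps) → ℕ
shift t Ps k = 2 * (t + sum (take (toℕ k) (map half Ps)))

shift-zero : ∀ t Q Ps → shift t (Q ∷ Ps) fzero ≡ t + t
shift-zero t Q Ps = trans (cong (2 *_) (ℕ.+-identityʳ t)) (cong (t +_) (ℕ.+-identityʳ t))

shift-suc : ∀ t Q Ps k → shift t (Q ∷ Ps) (fsuc k) ≡ shift (t + half Q) Ps k
shift-suc t Q Ps k = cong (2 *_) (sym (ℕ.+-assoc t (half Q) _))

μ-attained : ∀ {m} t Ps → Valid t Ps → Bounds m t Ps → Attains m t Ps →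
  Σ[ k ∈ Fin (length Ps) ] Isμ-spread (lookup Ps k ⊖ shift t Ps k) m
μ-attained {m} t (Q ∷ Ps) (con , h>0 , lt , _) (b , _) (inj₁ a) = fzero ,
  subst (λ c → Isμ-spread (Q ⊖ c) m) (sym (shift-zero t Q Ps)) (Isμ-spread-⊖⁺ (t + t) Q con (ℕ.<⇒≤ lt) h>0 b a)
μ-attained {m} t (Q ∷ Ps) (_ , _ , _ , _ , v) (_ , bs) (inj₂ a) =
  let k , isμ = μ-attained (t + half Q) Ps v bs a
  in fsuc k , subst (λ c → Isμ-spread (lookup Ps k ⊖ c) m) (sym (shift-suc t Q Ps k)) isμ

μ-least : ∀ {m} t Ps → Valid t Ps → Bounds m t Ps →
  ∀ x → (Σ[ k ∈ Fin (length Ps) ] Isμ-spread (lookup Ps k ⊖ shift t Ps k) x) → m ≤ x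
μ-least t (Q ∷ Ps) (con , h>0 , lt , _) (b , _) x (fzero , isμ) =
  Isμ-spread-⊖⁻ (t + t) Q con (ℕ.<⇒≤ lt) b (subst (λ c → Isμ-spread (Q ⊖ c) x) (shift-zero t Q Ps) isμ)
μ-least t (Q ∷ Ps) (_ , _ , _ , _ , v) (_ , bs) x (fsuc k , isμ) =
  μ-least (t + half Q) Ps v bs x (k , subst (λ c → Isμ-spread (lookup Ps k ⊖ c) x) (shift-suc t Q Ps k) isμ)

-- Decomposition into spreads

Gap : Powers → Powers → Set
Gap Q R = All (λ a → All (λ b → part a + 2 ≤ part b) R) Q

decompose : ∀ P → IsPartition P →
  ∃[ Ps ] concat Ps ≡ P × All IsSpread Ps × Linked Gap Ps
decompose [] _ = [] , refl , [] , []
decompose (a ∷ []) isP = [ a ∷ [] ] , refl , ((λ ()) , isP , [-]) ∷ [] , [-]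
decompose (a ∷ b ∷ P) (a<b ∷ l , pa ∷ ps) with decompose (b ∷ P) (l , ps)
... | [] , () , _ , _
... | [] ∷ Ps , _ , (≢[] , _) ∷ _ , _ = contradiction refl ≢[]
... | (.b ∷ Q) ∷ Ps , refl , sp@(_ , (lQ , pQ) , cQ) ∷ sps , gaps with part b ℕ.≟ suc (part a)
... | yes b≡ = (a ∷ b ∷ Q) ∷ Ps , refl ,
      ((λ ()) , (a<b ∷ lQ , pa ∷ pQ) , b≡ ∷ cQ) ∷ sps , extend gaps
  where
  extend : ∀ {Ps} → Linked Gap ((b ∷ Q) ∷ Ps) → Linked Gap ((a ∷ b ∷ Q) ∷ Ps)
  extend [-] = [-]
  extend ((g ∷ gs) ∷ gaps) = (All.map (ℕ.≤-trans (ℕ.+-monoˡ-≤ 2 (ℕ.<⇒≤ a<b))) g ∷ g ∷ gs) ∷ gaps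
... | no b≢ = (a ∷ []) ∷ (b ∷ Q) ∷ Ps , refl ,
      ((λ ()) , ([-] , pa ∷ []) , [-]) ∷ sp ∷ sps , ((a+2≤b ∷ All.map (ℕ.≤-trans a+2≤b) (above lQ)) ∷ []) ∷ gaps
  where
  import Data.List.Relation.Unary.Linked.Properties as Linked
  a+2≤b : part a + 2 ≤ part b
  a+2≤b = subst (_≤ part b) (ℕ.+-comm 2 (part a)) (ℕ.≤∧≢⇒< a<b (b≢ ∘ sym))
  above : ∀ {Q} → Linked (λ a b → part a < part b) (b ∷ Q) → All (λ d → part b ≤ part d) Q
  above l = All.map ℕ.<⇒≤ (AllPairs.head (Linked.Linked⇒AllPairs ℕ.<-trans l))

multAt-drop : ∀ a b Q {n} → 0 < n → multAt (a ∷ b ∷ Q) (suc (suc n)) ≡ multAt Q n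
multAt-drop a b Q {suc n} _ = refl

half-positive : ∀ (a : Power) Q → 0 < half (a ∷ Q)
half-positive a [] = z<s
half-positive a (_ ∷ _) = z<s

-- The parity of the number of parts decides: an even number ends at a + 2h - 1, an odd number at a
-- + 2h - 2, where the last level lacks its upper part.
last-part : ∀ a Q → Linked (λ a b → part b ≡ suc (part a)) (a ∷ Q) → let h = half (a ∷ Q) in
  (∃[ b ] b ∈ a ∷ Q × suc (part b) ≡ part a + (h + h)) ⊎
  (∃[ b ] b ∈ a ∷ Q × suc (suc (part b)) ≡ part a + (h + h) × multAt (a ∷ Q) (h + h) ≡ 0)
last-part a [] _ = inj₂ (a , here refl , ℕ.+-comm 2 (part a) , refl)
last-part a (b ∷ []) (b≡ ∷ _) = inj₁ (b , there (here refl) , trans (cong suc b≡) (ℕ.+-comm 2 (part a)))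
last-part a (b ∷ c ∷ Q) (b≡ ∷ c≡ ∷ l) with last-part c Q l
... | inj₁ (d , d∈ , d≡) = inj₁ (d , there (there d∈) , trans d≡ next)
  where next = trans (cong (_+ (half (c ∷ Q) + half (c ∷ Q))) (trans c≡ (cong suc b≡)))
          (sym (double-+ (part a) (half (c ∷ Q))))
... | inj₂ (d , d∈ , d≡ , m≡) = inj₂ (d , there (there d∈) , trans d≡ next ,
      trans (cong (multAt (a ∷ b ∷ c ∷ Q)) (double-suc h))
          (trans (multAt-drop a b (c ∷ Q) (ℕ.≤-trans (half-positive c Q) (ℕ.m≤m+n h h))) m≡))
  where
  h = half (c ∷ Q)
  next = trans (cong (_+ (half (c ∷ Q) + half (c ∷ Q))) (trans c≡ (cong suc b≡)))
      (sym (double-+ (part a) (half (c ∷ Q))))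

valid : ∀ t Ps → All IsSpread Ps → Linked Gap Ps → (∀ {Q Ps′} → Ps ≡ Q ∷ Ps′ → t + t < first Q) → Valid t Ps
valid t [] _ _ _ = tt
valid t ([] ∷ Ps) ((≢[] , _) ∷ _) _ _ = contradiction refl ≢[]
valid t (Q@(a ∷ Q′) ∷ Ps) ((_ , (_ , ps) , con) ∷ sps) gaps start =
  (con , All.map proj₂ ps) , half-positive a Q′ , start refl , sep Ps sps gaps ,
  valid (t + half Q) Ps sps (Linked.tail gaps) (next Ps sps gaps)
  where
  h = half Q

  swap-half : (t + h) + (t + h) ≡ (t + t) + (h + h)
  swap-half = begin
    (t + h) + (t + h)   ≡⟨ ℕ.+-assoc t h _ ⟩
    t + (h + (t + h))   ≡⟨ cong (t +_) (ℕ.+-assoc h t h) ⟨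
    t + (h + t + h)     ≡⟨ cong (λ z → t + (z + h)) (ℕ.+-comm h t) ⟩
    t + (t + h + h)     ≡⟨ cong (t +_) (ℕ.+-assoc t h h) ⟩
    t + (t + (h + h))   ≡⟨ ℕ.+-assoc t t _ ⟨
    (t + t) + (h + h)   ∎
    where open ≡-Reasoning

  -- A gap of two leads strictly beyond a + 2h from a last part a + 2h - 1, but possibly only to a +
  -- 2h itself from a + 2h - 2. The next offset can therefore stay the same only in the unpaired
  -- case.
  reach : ∀ {R Ps} → IsSpread R → Linked Gap (Q ∷ R ∷ Ps) →
          first Q + (h + h) < first R ⊎ first Q + (h + h) ≤ first R × multAt Q (h + h) ≡ 0
  reach {[]} (≢[] , _) _ = contradiction refl ≢[]
  reach {r ∷ R} _ (gap ∷ _) with last-part a Q′ con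
  ... | inj₁ (b , b∈ , b≡) = inj₁ (subst (_≤ part r) (trans (ℕ.+-comm (part b) 2) (cong suc b≡))
      (All.head (All.lookup gap b∈)))
  ... | inj₂ (b , b∈ , b≡ , m≡) = inj₂ (subst (_≤ part r) (trans (ℕ.+-comm (part b) 2) b≡)
      (All.head (All.lookup gap b∈)) , m≡)

  offset+ : offset t Q + ((t + h) + (t + h)) ≡ first Q + (h + h)
  offset+ = trans (cong (offset t Q +_) swap-half) (trans (sym (ℕ.+-assoc (offset t Q) (t + t) _))
    (cong (_+ (h + h)) (ℕ.m∸n+n≡m (ℕ.<⇒≤ (start refl)))))

  sep : ∀ Ps → All IsSpread Ps → Linked Gap (Q ∷ Ps) → Separated t Q Ps
  sep [] _ _ = tt
  sep (R ∷ Ps) (spR ∷ _) gaps with reach spR gaps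
  ... | inj₁ lt = inj₁ (ℕ.m+n≤o⇒m≤o∸n (suc (offset t Q)) (subst (_< first R) (sym offset+) lt))
  ... | inj₂ (le , eq) = inj₂ (ℕ.m+n≤o⇒m≤o∸n (offset t Q) (subst (_≤ first R) (sym offset+) le) , eq)

  next : ∀ Ps → All IsSpread Ps → Linked Gap (Q ∷ Ps) → ∀ {R Ps′} → Ps ≡ R ∷ Ps′ → (t + h) + (t + h) < first R
  next (R ∷ Ps) (spR ∷ _) gaps refl = ℕ.<-≤-trans
    (subst (_< first Q + (h + h)) (sym swap-half) (ℕ.+-monoˡ-< (h + h) (start refl)))
    ([ ℕ.<⇒≤ , proj₁ ]′ (reach spR gaps))

-- The levels of a partition and the smallest part of λ

module _ (P : Powers) (isP : IsPartition P) (Ps : List Powers) (P≡ : concat Ps ≡ P)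
  (v : Valid 0 Ps) {μ : ℕ} (bounds : Bounds μ 0 Ps) (attains : Attains μ 0 Ps) where

  open Poset P isP

  private
    L : List Level
    L = levels 0 Ps

    expand≡ : expand 0 L ≡ P
    expand≡ = trans (expand-levels 0 Ps v) P≡

    element : ∀ {w m a k} → (w ^^ m) ∈ expand 0 L → a < w → k < m → ∃[ x ] S x ≡ w × A x ≡ a × K x ≡ k
    element {a = a} {k} w∈ a< k< = build (subst (_ ∈_) expand≡ w∈)
      where
      import Data.List.Relation.Unary.Any as Any
      import Data.List.Relation.Unary.Any.Properties as Any
      build : _ ∈ P → _
      build q = elt i (fromℕ< a<′) (fromℕ< k<′) , sym (cong part eq) , Fin.toℕ-fromℕ< a<′ , Fin.toℕ-fromℕ< k<′
        where
        i = Any.index q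
        eq = Any.lookup-index q
        a<′ = subst (a <_) (cong part eq) a<
        k<′ = subst (k <_) (cong mult eq) k<

  partition-levels : Levels P isP (length L) μ (base ∘ at L) (low ∘ at L) (high ∘ at L)
  partition-levels = record
    { locate = λ x →
        let s , s< , fits = expand-∈ 0 L (subst (_ ∈_) (sym expand≡) (∈.∈-lookup (𝒟.index x)))
            copy< = Fin.toℕ<n (𝒟.copy x)
        in s , s< , Data.Sum.map (λ (S≡ , m≡) → S≡ , subst (K x <_) m≡ copy<)
                                 (λ (S≡ , m≡) → S≡ , subst (K x <_) m≡ copy<) fits
    ; lower = λ t< a< k< → element (∈-expand-low 0 L t<) a< k<
    ; upper = λ t< a< k< → element (∈-expand-high 0 L t< (ℕ.≤-trans (s≤s z≤n) k<)) a< k<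
    ; positive = levels-positive 0 Ps v
    ; compat = levels-compatible 0 Ps v bounds
    ; tight = levels-tight 0 Ps attains }
    where import Data.Sum

  μ-positive : 0 < μ
  μ-positive =
    let i , j , i≤j , j< , _ , μ≡ = levels-tight 0 Ps attains
        i< = ℕ.≤-<-trans i≤j j<
        low>0 = proj₂ (All.lookup (proj₂ isP) (subst (((base (at L i) + (i + i)) ^^ low (at L i)) ∈_)
            expand≡ (∈-expand-low 0 L {i} i<)))
    in subst (0 <_) (sym μ≡) (ℕ.≤-trans (ℕ.*-mono-≤ (levels-positive 0 Ps v i<) low>0) (ℕ.m≤m+n _ _))

module _ (P : Powers) (isP : IsPartition P) {r μ : ℕ} {p N M : ℕ → ℕ}
  (L : Levels P isP (suc r) μ p N M) (μ>0 : 0 < μ) where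

  open Poset P isP using (Family; elements; elements-complete; concave)

  smallest-part : ∀ {λs} → Isλ P λs → IsSmallestPart λs μ
  smallest-part {λs} (c , max , λ≡) = (μ>0 , r , λr≡μ) , least
    where
    V = length elements

    c≤V : ∀ k → c k ≤ V
    c≤V k with proj₁ (max k)
    ... | _ , _ , S , uS , _ , eq = subst (_≤ V) eq (Unique-⊆⇒length-≤ uS (λ _ → elements-complete _))

    c-full : c (suc r) ≡ V
    c-full = ℕ.≤-antisym (c≤V (suc r)) (proj₂ (max (suc r)) V (LevelCover.full-family P isP L))

    c-partial : c r + μ ≡ V
    c-partial = ℕ.≤-antisym (Packing.family-misses P isP L μ>0 (proj₁ (max r)))
      (let m , F , V≤ = LevelCover.partial-family P isP L
       in ℕ.≤-trans V≤ (ℕ.+-monoˡ-≤ μ (proj₂ (max r) m F)))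

    λr≡μ : λs r ≡ μ
    λr≡μ = trans (λ≡ r) (trans (cong (_∸ c r) (trans c-full (sym c-partial))) (ℕ.m+n∸m≡n (c r) μ))

    λ-end : λs (suc r) ≡ 0
    λ-end = trans (λ≡ (suc r)) (ℕ.m≤n⇒m∸n≡0 (subst (c (2 + r) ≤_) (sym c-full) (c≤V (2 + r))))

    λ-step : ∀ k → λs (suc k) ≤ λs k
    λ-step k = subst₂ _≤_ (sym (λ≡ (suc k))) (sym (λ≡ k)) (ℕ.m≤n+o⇒m∸n≤o (c (2 + k)) (c (suc k))
      (ℕ.+-cancelˡ-≤ (c k) _ _ (begin
        c k + c (2 + k)                             ≤⟨ concave (proj₁ (max k)) (proj₁ (max (2 + k)))
            (λ {m} → proj₂ (max (suc k)) m) ⟩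
        c (suc k) + c (suc k)                       ≤⟨ ℕ.+-monoʳ-≤ (c (suc k)) (ℕ.m≤n+m∸n (c (suc k)) (c k)) ⟩
        c (suc k) + (c k + (c (suc k) ∸ c k))       ≡⟨ ℕ.+-assoc (c (suc k)) _ _ ⟨
        c (suc k) + c k + (c (suc k) ∸ c k)         ≡⟨ cong (_+ (c (suc k) ∸ c k)) (ℕ.+-comm (c (suc k)) _) ⟩
        c k + c (suc k) + (c (suc k) ∸ c k)         ≡⟨ ℕ.+-assoc (c k) _ _ ⟩
        c k + (c (suc k) + (c (suc k) ∸ c k))       ∎)))
      where open ℕ.≤-Reasoning

    λ-antitone : ∀ {j} d k → d + j ≡ k → λs k ≤ λs j
    λ-antitone zero k refl = ℕ.≤-refl
    λ-antitone (suc d) (suc k) refl = ℕ.≤-trans (λ-step k) (λ-antitone d k refl)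

    least : ∀ x → 1 ≤ x × (∃[ k ] λs k ≡ x) → μ ≤ x
    least x (1≤x , k , refl) with k ≤? r
    ... | yes k≤r = subst (_≤ λs k) λr≡μ (λ-antitone (r ∸ k) r (ℕ.m∸n+n≡m k≤r))
    ... | no k≰r = contradiction
          (subst (λs k ≤_) λ-end (λ-antitone (k ∸ suc r) k (ℕ.m∸n+n≡m (ℕ.≰⇒> k≰r)))) (ℕ.<⇒≱ 1≤x)

theorem3p19 : (n : ℕ) → 0 < n → (P : Powers) → P ⊢ n →
    (λs : ℕ → ℕ) → Isλ P λs →
    ∃[ m ] (IsSmallestPart λs m × Isμ P m)
theorem3p19 n n>0 P (isP , refl) λs isλ with decompose P isP
... | [] , refl , _ = contradiction n>0 λ ()
... | [] ∷ _ , _ , (≢[] , _) ∷ _ , _ = contradiction refl ≢[]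
... | Ps@((a ∷ Q) ∷ Ps′) , P≡ , spreads@((_ , (_ , (a≥1 , _) ∷ _) , _) ∷ _) , gaps =
  let v = valid 0 Ps spreads gaps (λ { refl → a≥1 })
      μ , bounds , attains = minimum 0 (a ∷ Q) Ps′ v
      -- The number of levels is written as a successor, because its predecessor is the number of
      -- chains left after one is dropped.
      length≡ = ℕ.suc-pred (length (levels 0 Ps)) ⦃ >-nonZero (levels-nonempty v) ⦄
      L = subst (λ r → Levels P isP r μ (base ∘ at (levels 0 Ps)) (low ∘ at (levels 0 Ps))
          (high ∘ at (levels 0 Ps))) (sym length≡) (partition-levels P isP Ps P≡ v bounds attains)
  in μ , smallest-part P isP L (μ-positive P isP Ps P≡ v bounds attains) isλ ,
     Ps , map half Ps , P≡ , spreads , gaps , isr spreads ,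
     μ-attained 0 Ps v bounds attains , μ-least 0 Ps v bounds
  where
  levels-nonempty : Valid 0 Ps → 0 < length (levels 0 Ps)
  levels-nonempty (_ , h>0 , _) = subst (0 <_) (sym (levels-length 0 (a ∷ Q) Ps′)) (ℕ.≤-trans h>0 (ℕ.m≤m+n _ _))

  isr : ∀ {Ps} → All IsSpread Ps → Pointwise Isr Ps (map half Ps)
  isr [] = []
  isr ((_ , (_ , ps) , con) ∷ sps) = Isr-half _ (con , All.map proj₂ ps) ∷ isr sps
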